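{- Let $u,v\in S_{\mathbb{Z}_+}$. For $k\ge 0$ put $V_k(u,v)=\{w\in S_{\mathbb{Z}} : c_{\gamma^k(u),\gamma^k(v)}^{\gamma^k(w)}\neq 0\}$, so that $V_0(u,v)\subseteq V_1(u,v)\subseteq\cdots$. Let $\mathrm{BS}(u,v)$ be the smallest integer $j\ge 0$ such that $V_j(u,v)=V_{j+1}(u,v)=V_{j+2}(u,v)=\cdots$, and let $\mathrm{St}(u,v)$ be the smallest integer $j\ge 0$ such that $V_j(u,v)=V_{j+1}(u,v)$. Then: (a) $\mathrm{BS}(u,v)=\mathrm{St}(u,v)$; (b) $\mathrm{BS}(u,v)\le \max\{i : \theta_i(u)=1 \text{ or } \theta_i(v)=1\}$; (c) $\mathrm{BS}(u,v)=\max_{i\ge 0}\bigl(\lambda_i(u)+\lambda_i(v)-i\bigr)$.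
   Context: $S_{\mathbb{Z}}$ is the group of bijections $w:\mathbb{Z}\to\mathbb{Z}$ fixing all but finitely many integers; $S_{\mathbb{Z}_+}\subseteq S_{\mathbb{Z}}$ is the subgroup of those fixing every integer $\le 0$ (i.e. permutations of the positive integers), and $S_n$ those fixing every integer outside $\{1,\dots,n\}$. The shift $\gamma:S_{\mathbb{Z}}\to S_{\mathbb{Z}}$ is $\gamma(w)(i)=w(i-1)+1$. For $w\in S_{\mathbb{Z}_+}$, $\mathfrak{S}_w\in\mathbb{Q}[x_1,x_2,\dots]$ is the Schubert polynomial (stable under $S_n\hookrightarrow S_{n+1}$); these form a basis, and the Schubert structure constants $c_{u,v}^w$ ($u,v,w\in S_{\mathbb{Z}_+}$) are defined by $\mathfrak{S}_u\mathfrak{S}_v=\sum_w c_{u,v}^w\mathfrak{S}_w$. By convention $c_{u,v}^w=0$ if any of $u,v,w$ is not in $S_{\mathbb{Z}_+}$. For $w\in S_{\mathbb{Z}}$: $\theta_i(w)=1$ if there exists $j>i$ with $w(j)<w(i)$, and $\theta_i(w)=0$ otherwise (equivalently, $\theta_i(w)=1$ iff the $i$th entry $\mathrm{code}(w)_i=|\{j>i: w(j)<w(i)\}|$ of the Lehmer code is nonzero); $\lambda_i(w)=\sum_{j\le i}\theta_j(w)$. -}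

module Defs where

open import Data.Bool using (Bool; true; false; _∧_; if_then_else_)
open import Data.Nat as ℕ using (ℕ; zero; suc; _∸_; _≡ᵇ_; _<ᵇ_)
open import Data.Integer as ℤ using (ℤ; +_; ∣_∣; 0ℤ; 1ℤ)
open import Data.List using (List; []; _∷_; map; concatMap; upTo; downFrom; length)
open import Data.Bool.ListAction using (any)
open import Data.Nat.ListAction using (sum)
open import Data.Maybe using (Maybe; just; nothing)
open import Data.Product using (Σ; _×_; _,_; proj₁)
open import Data.List.Membership.Propositional using (_∈_)
open import Data.List.Relation.Unary.AllPairs using (AllPairs)
open import Relation.Binary.PropositionalEquality using (_≡_)
open import Relation.Nullary using (¬_)
open import Relation.Nullary.Decidable using (⌊_⌋)

-- Polynomials in x₁, x₂, … with integer coefficients.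
-- A monomial is an exponent list [a₁, a₂, …] (x₁^a₁ x₂^a₂ ⋯), equal up to
-- trailing zeros; a polynomial is a finite list of (coefficient, monomial)
-- terms; two polynomials are equal when all coefficients agree.

Mono : Set
Mono = List ℕ

Term : Set
Term = ℤ × Mono

Poly : Set
Poly = List Term

eqMon : Mono → Mono → Bool
eqMon []       []       = true
eqMon []       (b ∷ bs) = (b ≡ᵇ 0) ∧ eqMon [] bs
eqMon (a ∷ as) []       = (a ≡ᵇ 0) ∧ eqMon as []
eqMon (a ∷ as) (b ∷ bs) = (a ≡ᵇ b) ∧ eqMon as bs

coeff : Poly → Mono → ℤ
coeff []            m = 0ℤ
coeff ((c , e) ∷ p) m = (if eqMon e m then c else 0ℤ) ℤ.+ coeff p m

infix 4 _≈P_
_≈P_ : Poly → Poly → Set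
p ≈P q = ∀ m → coeff p m ≡ coeff q m

addMon : Mono → Mono → Mono
addMon []       f        = f
addMon (a ∷ as) []       = a ∷ as
addMon (a ∷ as) (b ∷ bs) = (a ℕ.+ b) ∷ addMon as bs

infixl 7 _*P_
_*P_ : Poly → Poly → Poly
p *P q = concatMap (λ t → map (λ s → (proj₁ t ℤ.* proj₁ s , addMon (Data.Product.proj₂ t) (Data.Product.proj₂ s))) q) p

scaleP : ℤ → Poly → Poly
scaleP c = map (λ t → (c ℤ.* proj₁ t , Data.Product.proj₂ t))

get0 : Mono → ℕ → ℕ
get0 []       _       = 0
get0 (a ∷ as) zero    = a
get0 (a ∷ as) (suc k) = get0 as k

set0 : Mono → ℕ → ℕ → Mono
set0 []       zero    x = x ∷ []
set0 []       (suc k) x = 0 ∷ set0 [] k x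
set0 (a ∷ as) zero    x = x ∷ as
set0 (a ∷ as) (suc k) x = a ∷ set0 as k x

-- Divided difference ∂ᵢ f = (f - sᵢ f)/(xᵢ - xᵢ₊₁)  (i ≥ 1), computed
-- termwise: with p, q the exponents of xᵢ, xᵢ₊₁,
--   ∂ᵢ(xᵢ^p xᵢ₊₁^q) =  Σ_{k<p-q} xᵢ^(p-1-k) xᵢ₊₁^(q+k)   if p > q,
--                    = -Σ_{k<q-p} xᵢ^(q-1-k) xᵢ₊₁^(p+k)   if p < q,
--                    = 0                                  if p = q,
-- other variables being sᵢ-invariant factors.
ddTerm : ℕ → Term → Poly
ddTerm i (c , e) =
  let p = get0 e (i ∸ 1)
      q = get0 e i
      upd : ℕ → ℕ → Mono
      upd a b = set0 (set0 e (i ∸ 1) a) i b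
  in if q <ᵇ p
     then map (λ k → (c , upd (p ∸ 1 ∸ k) (q ℕ.+ k))) (upTo (p ∸ q))
     else (if p <ᵇ q
           then map (λ k → (ℤ.- c , upd (q ∸ 1 ∸ k) (p ℕ.+ k))) (upTo (q ∸ p))
           else [])

dd : ℕ → Poly → Poly
dd i = concatMap (ddTerm i)

-- Schubert polynomials of a permutation w ∈ S_n in one-line notation
-- [w(1), …, w(n)]:  𝔖_{w₀} = x₁^(n-1) x₂^(n-2) ⋯ x_{n-1},  and
-- 𝔖_w = ∂ᵢ 𝔖_{w sᵢ} whenever w(i) < w(i+1) (we use the first such i).
-- The first argument is fuel; n*n+1 steps always suffice.

firstAscent : List ℕ → Maybe ℕ
firstAscent (a ∷ b ∷ rest) =
  if a <ᵇ b then just 1 else Data.Maybe.map suc (firstAscent (b ∷ rest))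
firstAscent _ = nothing

swapAt : ℕ → List ℕ → List ℕ
swapAt (suc zero)    (a ∷ b ∷ rest) = b ∷ a ∷ rest
swapAt (suc (suc k)) (a ∷ rest)     = a ∷ swapAt (suc k) rest
swapAt _             l              = l

schubW : ℕ → List ℕ → Poly
schubW zero    w = []
schubW (suc f) w with firstAscent w
... | nothing = (1ℤ , downFrom (length w)) ∷ []
... | just i  = dd i (schubW f (swapAt i w))

record SZ : Set where
  field
    fun   : ℤ → ℤ
    inv   : ℤ → ℤ
    inv∘fun : ∀ i → inv (fun i) ≡ i
    fun∘inv : ∀ i → fun (inv i) ≡ i
    bound : ℕ
    fixed : ∀ i → bound ℕ.< ∣ i ∣ → fun i ≡ i

open SZ public

infix 4 _≐_
_≐_ : SZ → SZ → Set
w ≐ w' = ∀ i → fun w i ≡ fun w' i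

SZ+ : Set
SZ+ = Σ SZ (λ w → ∀ i → i ℤ.≤ 0ℤ → fun w i ≡ i)

word : SZ → List ℕ
word w = map (λ j → ∣ fun w (+ suc j) ∣) (upTo (bound w))

schubert : SZ+ → Poly
schubert (w , _) = schubW (suc (length (word w) ℕ.* length (word w))) (word w)

sumS : (SZ+ → ℤ) → List SZ+ → Poly
sumS c L = concatMap (λ w → scaleP (c w) (schubert w)) L

IsStructureConstants : (SZ+ → SZ+ → SZ+ → ℤ) → Set
IsStructureConstants c =
  (∀ u u' v v' w w' → proj₁ u ≐ proj₁ u' → proj₁ v ≐ proj₁ v' → proj₁ w ≐ proj₁ w' →
     c u v w ≡ c u' v' w')
  × (∀ u v → Σ (List SZ+) λ L →
       AllPairs (λ x y → ¬ (proj₁ x ≐ proj₁ y)) L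
       × (∀ w → (∀ x → x ∈ L → ¬ (proj₁ w ≐ proj₁ x)) → c u v w ≡ 0ℤ)
       × (schubert u *P schubert v ≈P sumS (c u v) L))

shiftF : ℕ → (ℤ → ℤ) → ℤ → ℤ
shiftF k f i = f (i ℤ.- + k) ℤ.+ + k

-- w ∈ V_k(u,v)  ⇔  c^{γᵏ w}_{γᵏ u, γᵏ v} ≠ 0  (with c = 0 when γᵏ w ∉ S_{ℤ₊})
InV : (SZ+ → SZ+ → SZ+ → ℤ) → SZ+ → SZ+ → ℕ → SZ → Set
InV c u v k w =
  Σ SZ+ λ u' → Σ SZ+ λ v' → Σ SZ+ λ x →
    (∀ i → fun (proj₁ u') i ≡ shiftF k (fun (proj₁ u)) i)
    × (∀ i → fun (proj₁ v') i ≡ shiftF k (fun (proj₁ v)) i)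
    × (∀ i → fun (proj₁ x) i ≡ shiftF k (fun w) i)
    × ¬ (c u' v' x ≡ 0ℤ)

VEq : (SZ+ → SZ+ → SZ+ → ℤ) → SZ+ → SZ+ → ℕ → ℕ → Set
VEq c u v j m = ∀ w → (InV c u v j w → InV c u v m w) × (InV c u v m w → InV c u v j w)

IsBS : (SZ+ → SZ+ → SZ+ → ℤ) → SZ+ → SZ+ → ℕ → Set
IsBS c u v j =
  (∀ m → j ℕ.≤ m → VEq c u v j m)
  × (∀ j' → j' ℕ.< j → ¬ (∀ m → j' ℕ.≤ m → VEq c u v j' m))

IsSt : (SZ+ → SZ+ → SZ+ → ℤ) → SZ+ → SZ+ → ℕ → Set
IsSt c u v j =
  VEq c u v j (suc j) × (∀ j' → j' ℕ.< j → ¬ VEq c u v j' (suc j'))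

-- θᵢ(w) for w ∈ S_{ℤ₊}, i ≥ 0: 1 iff ∃ j > i with w(j) < w(i).
-- (Only j ≤ bound need be searched: for j > bound, w(j) = j exceeds every w(i), i ≤ bound,
--  and for i ≥ bound no j > i gives an inversion.)
thetaB : SZ → ℕ → Bool
thetaB w i = any (λ j → ⌊ fun w (+ j) ℤ.<? fun w (+ i) ⌋)
                 (map (λ t → suc i ℕ.+ t) (upTo (bound w ∸ i)))

θ : SZ+ → ℕ → ℕ
θ (w , _) i = if thetaB w i then 1 else 0

-- λᵢ(w) = Σ_{j ≤ i} θⱼ(w) = Σ_{1 ≤ j ≤ i} θⱼ(w) for w ∈ S_{ℤ₊}
λ' : SZ+ → ℕ → ℕ
λ' w i = sum (map (λ t → θ w (suc t)) (upTo i))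

{-# OPTIONS --safe #-}
module Submission where

-- Variables and positions are numbered from 0.  Put π i f = ∂ i (x i f) = f + x (i+1) ∂ i f and E = π 0 ∘ π 1 ∘ π 2 ∘ ⋯.
-- Then E 𝔖_w = 𝔖_{γ w}, every ∂ᵥ E f with v not fixing 1 vanishes at 0, and setting x 0 = 0 inverts E.  Hence
-- c_{γu,γv}^{γw} = c_{u,v}^w, and V_k = V_{k+1} if and only if E f · E g = E (f g) for the Schubert polynomials f, g of
-- γᵏ u, γᵏ v.
--
-- From π i F · π i G = π i (F G) + x i x (i+1) ∂ i F ∂ i G one finds that E f · E g - E (f g) is the sum over i of
-- x 0 ⋯ x (i+1) D i (Uᵢ Vᵢ), where D i = ∂ 0 ⋯ ∂ (i-1), Uᵢ = ∂ i (π (i+1) π (i+2) ⋯ f) and Vᵢ is the same for g; here Uᵢ = 0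
-- where θ(u) vanishes.  By the Leibniz rule D k (x k ^ d a b) loses one power of x k at each position where both θ vanish
-- and gains at most one where neither does.  So it is 0 if d + ∑_{m<k} (θ_m(u) + θ_m(v)) < k, which kills the whole
-- sum when λ_i(u) + λ_i(v) ≤ i for all i, and in the critical case it is ± ∏ ∂ m a · ∏ ∂ m b, over the m < k with
-- θ_m(u) = 1, respectively θ_m(v) = 1.
--
-- If the inequality fails, stop at the first failure and pass to the leading coefficients of f and g in the later variables
-- (this commutes with E): a single critical term is left.  It is nonzero because the reverse lexicographically leading
-- monomial of 𝔖_w has support {i : θ_i(w) = 1}.
open import Defs
open import Algebra.Bundles using (CommutativeRing)
import Algebra.Properties.Group
import Algebra.Solver.Ring
open import Algebra.Solver.Ring.AlmostCommutativeRing using (fromCommutativeRing; _-Raw-AlmostCommutative⟶_)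
open import Data.Bool using (Bool; true; false; _∧_; if_then_else_; T)
open import Data.Empty using (⊥; ⊥-elim)
open import Data.Integer as ℤ using (ℤ; +_; -[1+_]; ∣_∣; 0ℤ; 1ℤ)
import Data.Integer.Properties as ℤₚ
open import Data.Integer.Tactic.RingSolver using (solve-∀)
open import Data.List using (List; []; _∷_; map; length; _++_; upTo; applyUpTo; downFrom)
open import Data.List.Membership.Propositional using (_∈_; find; lose)
open import Data.List.Membership.Propositional.Properties using (∈-map⁺; ∈-map⁻; ∈-upTo⁺)
open import Data.List.Properties using (length-applyUpTo; map-upTo; ++-assoc; ++-identityʳ)
open import Data.List.Relation.Unary.All as All using (All; []; _∷_)
import Data.List.Relation.Unary.All.Properties as All
open import Data.List.Relation.Unary.AllPairs using (AllPairs; []; _∷_)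
open import Data.List.Relation.Unary.Any as Any using (Any; here; there)
import Data.List.Relation.Unary.Any.Properties as Any
open import Data.Maybe as Maybe using (Maybe; just; nothing)
open import Data.Nat as ℕ using (ℕ; zero; suc; _≤_; _<_; z≤n; s≤s; _⊔_; _∸_; _≡ᵇ_; _<ᵇ_)
open import Data.Nat.ListAction using (sum)
import Data.Nat.Properties as ℕₚ
open import Data.Product using (Σ; ∃; _×_; _,_; proj₁; proj₂)
open import Data.Sum using (_⊎_; inj₁; inj₂)
open import Data.Unit using (⊤; tt)
open import Function using (_∘_; id)
open import Level using (0ℓ)
open import Relation.Binary.Definitions using (tri<; tri≈; tri>)
open import Relation.Binary.PropositionalEquality as ≡ using (_≡_; _≢_; _≗_)
open import Relation.Nullary using (yes; no; ¬_; Dec)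
open import Relation.Nullary.Decidable using (⌊_⌋; toWitness; fromWitness)

-- Why multiplicativity decides V_k = V_{k+1}: `E f * E g` and `E (f * g)` agree at x 0 = 0, so they
-- have the same coefficients at shifted permutations, and `E (f * g)` involves only those. Their
-- difference therefore collects exactly the terms of permutations moving 1, which are the new
-- members of V_{k+1}. A shift moves the excess λ_i(u) + λ_i(v) - i from i to i + 1 and lowers it by
-- one, so the inequality holds after k shifts precisely when k is at least the maximum in (c); this
-- also gives (a). For (b), at the maximising i one has λ_i(u) ≤ i, while λ_i(v) is at most the last
-- position with θ = 1.
--
-- The given recursion for Schubert polynomials follows one ascent at a time inside a finite window
-- and says nothing about other divided differences, other windows or linear independence. Hence the
-- inductive characterisation `Sch` and the functionals `κ`, which read coefficients off by reduced
-- words. Nonvanishing rests on leading coefficients: the surviving critical term is a product, and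
-- leading coefficients multiply.

skip : ℕ → ℕ → ℕ
skip zero    k       = suc k
skip (suc i) zero    = zero
skip (suc i) (suc k) = suc (skip i k)

-- An interface to ℤ[x 0, x 1, …]: Q n f = (f - f|_{x n = 0}) / x n, ρ i sends x i to 0 and x j to x (j-1) for j > i,
-- and ct is the constant term.  All operators are determined by their values on products x j * f.
record Calculus : Set₁ where
  field
    ring : CommutativeRing 0ℓ 0ℓ
  open CommutativeRing ring
  field
    const : ℤ → Carrier
    const-0 : const 0ℤ ≈ 0#
    const-1 : const 1ℤ ≈ 1#
    const-+ : ∀ a b → const (a ℤ.+ b) ≈ const a + const b
    const-* : ∀ a b → const (a ℤ.* b) ≈ const a * const b
    x : ℕ → Carrier
    ind : (P : Carrier → Set) → (∀ {f g} → f ≈ g → P f → P g) → (∀ c → P (const c)) →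
      (∀ j f → P f → P (x j * f)) → (∀ f g → P f → P g → P (f + g)) → ∀ f → P f
    ∂ : ℕ → Carrier → Carrier
    ∂-cong  : ∀ i {f g} → f ≈ g → ∂ i f ≈ ∂ i g
    ∂-+     : ∀ i f g → ∂ i (f + g) ≈ ∂ i f + ∂ i g
    ∂-const : ∀ i c → ∂ i (const c) ≈ 0#
    ∂-same  : ∀ i f → ∂ i (x i * f) ≈ f + x (suc i) * ∂ i f
    ∂-next  : ∀ i f → ∂ i (x (suc i) * f) ≈ - f + x i * ∂ i f
    ∂-far   : ∀ i j f → j ≢ i → j ≢ suc i → ∂ i (x j * f) ≈ x j * ∂ i f
    Q : ℕ → Carrier → Carrier
    Q-cong  : ∀ n {f g} → f ≈ g → Q n f ≈ Q n g
    Q-+     : ∀ n f g → Q n (f + g) ≈ Q n f + Q n g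
    Q-const : ∀ n c → Q n (const c) ≈ 0#
    Q-same  : ∀ n f → Q n (x n * f) ≈ f
    Q-diff  : ∀ n j f → j ≢ n → Q n (x j * f) ≈ x j * Q n f
    ρ : ℕ → Carrier → Carrier
    ρ-cong  : ∀ i {f g} → f ≈ g → ρ i f ≈ ρ i g
    ρ-+     : ∀ i f g → ρ i (f + g) ≈ ρ i f + ρ i g
    ρ-const : ∀ i c → ρ i (const c) ≈ const c
    ρ-same  : ∀ i f → ρ i (x i * f) ≈ 0#
    ρ-skip  : ∀ i j f → ρ i (x (skip i j) * f) ≈ x j * ρ i f
    ct : Carrier → ℤ
    ct-cong  : ∀ {f g} → f ≈ g → ct f ≡ ct g
    ct-+     : ∀ f g → ct (f + g) ≡ ct f ℤ.+ ct g
    ct-const : ∀ c → ct (const c) ≡ c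
    ct-x     : ∀ j f → ct (x j * f) ≡ 0ℤ

-- Permutations in one-line notation, the shift, inversions

s : ℕ → ℕ → ℕ
s zero    zero          = 1
s zero    (suc zero)    = 0
s zero    (suc (suc j)) = suc (suc j)
s (suc k) zero          = 0
s (suc k) (suc j)       = suc (s k j)

s-here : ∀ k → s k k ≡ suc k
s-here zero    = ≡.refl
s-here (suc k) = ≡.cong suc (s-here k)

s-next : ∀ k → s k (suc k) ≡ k
s-next zero    = ≡.refl
s-next (suc k) = ≡.cong suc (s-next k)

s-low : ∀ k j → j < k → s k j ≡ j
s-low (suc k) zero    _       = ≡.refl
s-low (suc k) (suc j) (s≤s h) = ≡.cong suc (s-low k j h)

s-high : ∀ k j → 2 ℕ.+ k ≤ j → s k j ≡ j
s-high zero    (suc (suc j)) _ = ≡.refl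
s-high zero    (suc zero)    (s≤s ())
s-high (suc k) (suc j)       (s≤s h) = ≡.cong suc (s-high k j h)

s-involutive : ∀ k j → s k (s k j) ≡ j
s-involutive zero    zero          = ≡.refl
s-involutive zero    (suc zero)    = ≡.refl
s-involutive zero    (suc (suc j)) = ≡.refl
s-involutive (suc k) zero          = ≡.refl
s-involutive (suc k) (suc j)       = ≡.cong suc (s-involutive k j)

Increasing : (ℕ → ℕ) → Set
Increasing p = ∀ k → p k < p (suc k)

Positive : (ℕ → ℕ) → Set
Positive p = ∀ j → 1 ≤ p j

-- p j is the value at the position j + 1, so that the identity is suc.
Perm : (ℕ → ℕ) → Set
Perm p = Positive p × ∃ λ N → ∀ j → N ≤ j → p j ≡ suc j

Perm-swap : ∀ {p} k → Perm p → Perm (p ∘ s k)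
Perm-swap {p} k (pos , N , fix) = pos ∘ s k , N ⊔ (2 ℕ.+ k) , λ j le →
  ≡.trans (≡.cong p (s-high k j (ℕₚ.m⊔n≤o⇒n≤o N (2 ℕ.+ k) le))) (fix j (ℕₚ.m⊔n≤o⇒m≤o N (2 ℕ.+ k) le))

Perm-increasing : ∀ {p} (P : Perm p) n → proj₁ (proj₂ P) ≤ n → ∀ j → n ≤ j → p j < p (suc j)
Perm-increasing (_ , N , fix) n N≤n j n≤j = ≡.subst₂ _<_ (≡.sym (fix j (ℕₚ.≤-trans N≤n n≤j)))
  (≡.sym (fix (suc j) (ℕₚ.m≤n⇒m≤1+n (ℕₚ.≤-trans N≤n n≤j)))) ℕₚ.≤-refl

-- Squeezed from both ends: `lower` climbs from `p 0 ≥ 1`, `upper` walks back from position `j + N`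
-- in the fixed tail, losing at least one per step.
increasing-id : ∀ {p} → Perm p → Increasing p → ∀ j → p j ≡ suc j
increasing-id {p} (pos , N , fix) inc j = ℕₚ.≤-antisym (upper N j (fix (j ℕ.+ N) (ℕₚ.m≤n+m N j))) (lower j)
  where
  lower : ∀ j → suc j ≤ p j
  lower zero    = pos 0
  lower (suc j) = ℕₚ.≤-trans (s≤s (lower j)) (inc j)
  upper : ∀ d j → p (j ℕ.+ d) ≡ suc (j ℕ.+ d) → p j ≤ suc j
  upper zero    j e = ℕₚ.≤-reflexive (≡.subst (λ i → p i ≡ suc i) (ℕₚ.+-identityʳ j) e)
  upper (suc d) j e = ℕ.s≤s⁻¹ (ℕₚ.≤-trans (inc j) (upper d (suc j) (≡.subst (λ i → p i ≡ suc i) (ℕₚ.+-suc j d) e)))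

γ : (ℕ → ℕ) → ℕ → ℕ
γ p zero    = 1
γ p (suc j) = suc (p j)

γ-increasing : ∀ {p} → Positive p → Increasing p → Increasing (γ p)
γ-increasing pos inc zero    = s≤s (pos 0)
γ-increasing pos inc (suc k) = s≤s (inc k)

γ-swap : ∀ p k → γ (p ∘ s k) ≗ γ p ∘ s (suc k)
γ-swap p k zero    = ≡.refl
γ-swap p k (suc j) = ≡.refl

-- The θ-sequence of `γ p` when η is that of `p`: the prepended value 1 has nothing smaller to its
-- right.
cons0 : (ℕ → ℕ) → ℕ → ℕ
cons0 η zero    = 0
cons0 η (suc m) = η m

NoInv : (ℕ → ℕ) → ℕ → Set
NoInv p m = ∀ j → m < j → p m < p j

NoInv-from : ∀ {p} n → (∀ j → n ≤ j → p j < p (suc j)) → NoInv p n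
NoInv-from {p} n inc (suc j) (s≤s n≤j) with ℕₚ.m≤n⇒m<n∨m≡n n≤j
... | inj₁ n<j    = ℕₚ.<-trans (NoInv-from n inc j n<j) (inc j n≤j)
... | inj₂ ≡.refl = inc j n≤j

-- When n is the last descent, the value that the swap moves to position n lies below `p n` and
-- below everything further right. `Sch-Top` needs this to read off an exponent after one divided
-- difference.
NoInv-swapped : ∀ {p} n → p (suc n) < p n → (∀ j → suc n ≤ j → p j < p (suc j)) → NoInv (p ∘ s n) n
NoInv-swapped {p} n d inc j n<j = ≡.subst (_< p (s n j)) (≡.cong p (≡.sym (s-here n))) (go (ℕₚ.m≤n⇒m<n∨m≡n n<j))
  where
  go : suc n < j ⊎ suc n ≡ j → p (suc n) < p (s n j)
  go (inj₁ lt)     = ≡.subst (λ i → p (suc n) < p i) (≡.sym (s-high n j lt)) (NoInv-from (suc n) inc j lt)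
  go (inj₂ ≡.refl) = ≡.subst (λ i → p (suc n) < p i) (≡.sym (s-next n)) d

s-above : ∀ n m j → m < n → m < j → m < s n j
s-above (suc n) zero    (suc j) _         _         = s≤s z≤n
s-above (suc n) (suc m) (suc j) (s≤s m<n) (s≤s m<j) = s≤s (s-above n m j m<n m<j)

NoInv-swap : ∀ {p} n m → m < n → NoInv p m → NoInv (p ∘ s n) m
NoInv-swap {p} n m m<n h j m<j = ≡.subst (_< p (s n j)) (≡.cong p (≡.sym (s-low n m m<n))) (h (s n j) (s-above n m j m<n m<j))

NoInv-swap⁻ : ∀ {p} n m → m < n → NoInv (p ∘ s n) m → NoInv p m
NoInv-swap⁻ {p} n m m<n h j m<j = ≡.subst₂ _<_ (≡.cong p (s-low n m m<n)) (≡.cong p (s-involutive n j)) (h (s n j) (s-above n m j m<n m<j))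

Injective : (ℕ → ℕ) → Set
Injective p = ∀ i j → p i ≡ p j → i ≡ j

s-injective : ∀ {p} k → Injective p → Injective (p ∘ s k)
s-injective k inj i j e = ≡.trans (≡.sym (s-involutive k i)) (≡.trans (≡.cong (s k) (inj _ _ e)) (s-involutive k j))

s-comm : ∀ k l j → suc k < l → s k (s l j) ≡ s l (s k j)
s-comm zero    (suc (suc l)) zero          _ = ≡.refl
s-comm zero    (suc (suc l)) (suc zero)    _ = ≡.refl
s-comm zero    (suc (suc l)) (suc (suc j)) _ = ≡.refl
s-comm zero    (suc zero)    j             (s≤s ())
s-comm (suc k) (suc l)       zero          _ = ≡.refl
s-comm (suc k) (suc l)       (suc j)       (s≤s h) = ≡.cong suc (s-comm k l j h)

s-braid : ∀ k j → s k (s (suc k) (s k j)) ≡ s (suc k) (s k (s (suc k) j))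
s-braid zero    zero                = ≡.refl
s-braid zero    (suc zero)          = ≡.refl
s-braid zero    (suc (suc zero))    = ≡.refl
s-braid zero    (suc (suc (suc j))) = ≡.refl
s-braid (suc k) zero                = ≡.refl
s-braid (suc k) (suc j)             = ≡.cong suc (s-braid k j)

-- θ-sequences and the excess of their partial sums over the index

Binary : (ℕ → ℕ) → Set
Binary ε = ∀ m → ε m ≡ 0 ⊎ ε m ≡ 1

-- For the θ-sequences of u and v, with positions counted from 0, this is λ_k(u) + λ_k(v).
total : (ε δ : ℕ → ℕ) → ℕ → ℕ
total ε δ zero    = 0
total ε δ (suc k) = total ε δ k ℕ.+ (ε k ℕ.+ δ k)

IsTheta : (ℕ → ℕ) → (ℕ → ℕ) → Set
IsTheta η p = Binary η × (∀ m → (η m ≡ 0 → NoInv p m) × (NoInv p m → η m ≡ 0))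

IsTheta-γ : ∀ {η p} → Positive p → IsTheta η p → IsTheta (cons0 η) (γ p)
IsTheta-γ {η} {p} pos (η₀₁ , h) = binary , equiv
  where
  binary : Binary (cons0 η)
  binary zero    = inj₁ ≡.refl
  binary (suc m) = η₀₁ m
  equiv : ∀ m → (cons0 η m ≡ 0 → NoInv (γ p) m) × (NoInv (γ p) m → cons0 η m ≡ 0)
  equiv zero    = (λ { _ (suc j) _ → s≤s (pos j) }) , λ _ → ≡.refl
  equiv (suc m) = (λ { e (suc j) (s≤s m<j) → s≤s (proj₁ (h m) e j m<j) }) , λ n → proj₂ (h m) (λ j m<j → ℕ.s≤s⁻¹ (n (suc j) (s≤s m<j)))

IsTheta-≗ : ∀ {η p q} → p ≗ q → IsTheta η p → IsTheta η q
IsTheta-≗ h (η₀₁ , e) = η₀₁ , λ m → (λ z j m<j → ≡.subst₂ _<_ (h m) (h j) (proj₁ (e m) z j m<j))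
  , λ n → proj₂ (e m) (λ j m<j → ≡.subst₂ _<_ (≡.sym (h m)) (≡.sym (h j)) (n j m<j))

cons0s : ℕ → (ℕ → ℕ) → ℕ → ℕ
cons0s zero    η = η
cons0s (suc k) η = cons0 (cons0s k η)

total-cons0 : ∀ ε δ j → total (cons0 ε) (cons0 δ) (suc j) ≡ total ε δ j
total-cons0 ε δ zero    = ≡.refl
total-cons0 ε δ (suc j) = ≡.cong (ℕ._+ (ε j ℕ.+ δ j)) (total-cons0 ε δ j)

total-cons0s : ∀ k ε δ j → total (cons0s k ε) (cons0s k δ) (k ℕ.+ j) ≡ total ε δ j
total-cons0s zero    ε δ j = ≡.refl
total-cons0s (suc k) ε δ j = ≡.trans (total-cons0 _ _ (k ℕ.+ j)) (total-cons0s k ε δ j)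

-- Each shift delays the partial sums by one position and so lowers the excess over the index by
-- one. The slack `d` varies in the induction because each shift hands it one unit of the bound.
total-cons0s-≤ : ∀ k d ε δ → (∀ j → total ε δ j ≤ j ℕ.+ (k ℕ.+ d)) → ∀ j → total (cons0s k ε) (cons0s k δ) j ≤ j ℕ.+ d
total-cons0s-≤ zero    d ε δ h j       = h j
total-cons0s-≤ (suc k) d ε δ h zero    = z≤n
total-cons0s-≤ (suc k) d ε δ h (suc j) = ≡.subst₂ _≤_ (≡.sym (total-cons0 _ _ j)) (ℕₚ.+-suc j d)
  (total-cons0s-≤ k (suc d) ε δ (λ i → ≡.subst (λ e → total ε δ i ≤ i ℕ.+ e) (≡.sym (ℕₚ.+-suc k d)) (h i)) j)

-- Increments are at most two, so a partial sum can pass from at most k to more than k + 1 only if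
-- it equals k and both indicators at k are 1. Before the first such jump the bound still holds.
first-excess : ∀ ε δ → Binary ε → Binary δ → ∀ n → n < total ε δ n →
  ∃ λ k → ε k ≡ 1 × δ k ≡ 1 × total ε δ k ≡ k × (∀ j → j ≤ k → total ε δ j ≤ j)
first-excess ε δ ε₀₁ δ₀₁ n excess = extract (go n)
  where
  Goal : Set
  Goal = ∃ λ k → ε k ≡ 1 × δ k ≡ 1 × total ε δ k ≡ k × (∀ j → j ≤ k → total ε δ j ≤ j)
  critical : ∀ {t e d n} → e ≡ 0 ⊎ e ≡ 1 → d ≡ 0 ⊎ d ≡ 1 → t ≤ n → suc n < t ℕ.+ (e ℕ.+ d) → e ≡ 1 × d ≡ 1 × t ≡ n
  critical {t} {n = n} (inj₁ ≡.refl) (inj₁ ≡.refl) t≤n lt = ⊥-elim (ℕₚ.<⇒≱ lt (≡.subst (_≤ suc n) (≡.sym (ℕₚ.+-identityʳ t)) (ℕₚ.m≤n⇒m≤1+n t≤n)))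
  critical {t} {n = n} (inj₁ ≡.refl) (inj₂ ≡.refl) t≤n lt = ⊥-elim (ℕₚ.<⇒≱ lt (≡.subst (_≤ suc n) (ℕₚ.+-comm 1 t) (s≤s t≤n)))
  critical {t} {n = n} (inj₂ ≡.refl) (inj₁ ≡.refl) t≤n lt = ⊥-elim (ℕₚ.<⇒≱ lt (≡.subst (_≤ suc n) (ℕₚ.+-comm 1 t) (s≤s t≤n)))
  critical {t} {n = n} (inj₂ ≡.refl) (inj₂ ≡.refl) t≤n lt = ≡.refl , ≡.refl
    , ℕₚ.≤-antisym t≤n (ℕ.s≤s⁻¹ (ℕ.s≤s⁻¹ (≡.subst (suc n <_) (ℕₚ.+-comm t 2) lt)))
  go : ∀ n → (∀ j → j ≤ n → total ε δ j ≤ j) ⊎ Goal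
  go zero = inj₁ (λ { .0 z≤n → z≤n })
  go (suc n) with go n
  ... | inj₂ g = inj₂ g
  ... | inj₁ h with total ε δ (suc n) ℕₚ.≤? suc n
  ... | no nle = inj₂ (n , proj₁ crit , proj₁ (proj₂ crit) , proj₂ (proj₂ crit) , h)
    where crit = critical (ε₀₁ n) (δ₀₁ n) (h n ℕₚ.≤-refl) (ℕₚ.≰⇒> nle)
  ... | yes le = inj₁ λ j j≤ → extended j (ℕₚ.m≤n⇒m<n∨m≡n j≤)
    where
    extended : ∀ j → j < suc n ⊎ j ≡ suc n → total ε δ j ≤ j
    extended j (inj₁ (s≤s j≤n)) = h j j≤n
    extended j (inj₂ ≡.refl)    = le
  extract : (∀ j → j ≤ n → total ε δ j ≤ j) ⊎ Goal → Goal
  extract (inj₁ h) = ⊥-elim (ℕₚ.<⇒≱ excess (h n ℕₚ.≤-refl))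
  extract (inj₂ g) = g

-- The excess at 0 is zero, so the maximum over a finite range is a natural number; `j′` is formed
-- only where the new excess is larger, and its truncated subtraction is then exact.
maximal-excess : ∀ (t : ℕ → ℕ) → t 0 ≡ 0 → ∀ M → ∃ λ j → (∀ i → i ≤ M → t i ≤ i ℕ.+ j) × ∃ λ i → t i ≡ i ℕ.+ j
maximal-excess t t0 zero = 0 , (λ { .0 z≤n → ℕₚ.≤-reflexive t0 }) , 0 , t0
maximal-excess t t0 (suc M) with maximal-excess t t0 M
... | j , h , i , e with t (suc M) ℕₚ.≤? suc M ℕ.+ j
... | yes le = j , (λ k k≤ → extended k (ℕₚ.m≤n⇒m<n∨m≡n k≤)) , i , e
  where
  extended : ∀ k → k < suc M ⊎ k ≡ suc M → t k ≤ k ℕ.+ j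
  extended k (inj₁ (s≤s k≤M)) = h k k≤M
  extended k (inj₂ ≡.refl)    = le
... | no nle = j′ , (λ k k≤ → extended k (ℕₚ.m≤n⇒m<n∨m≡n k≤)) , suc M , attained
  where
  j′ = t (suc M) ∸ suc M
  larger : suc M ℕ.+ j ≤ t (suc M)
  larger = ℕₚ.<⇒≤ (ℕₚ.≰⇒> nle)
  attained : t (suc M) ≡ suc M ℕ.+ j′
  attained = ≡.sym (ℕₚ.m+[n∸m]≡n (ℕₚ.≤-trans (ℕₚ.m≤m+n (suc M) j) larger))
  j≤j′ : j ≤ j′
  j≤j′ = ℕₚ.+-cancelˡ-≤ (suc M) _ _ (ℕₚ.≤-trans larger (ℕₚ.≤-reflexive attained))
  extended : ∀ k → k < suc M ⊎ k ≡ suc M → t k ≤ k ℕ.+ j′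
  extended k (inj₁ (s≤s k≤M)) = ℕₚ.≤-trans (h k k≤M) (ℕₚ.+-monoʳ-≤ k j≤j′)
  extended k (inj₂ ≡.refl)    = ℕₚ.≤-reflexive attained

Binary-≤1 : ∀ {η} → Binary η → ∀ m → η m ≤ 1
Binary-≤1 η₀₁ m with η₀₁ m
... | inj₁ e = ≡.subst (_≤ 1) (≡.sym e) z≤n
... | inj₂ e = ℕₚ.≤-reflexive e

-- Bounds the range in which the maximal excess has to be searched: from index `B + B` on the sum
-- cannot exceed the index.
total≤2B : ∀ {ε δ} → Binary ε → Binary δ → ∀ B → (∀ m → B ≤ m → ε m ≡ 0) → (∀ m → B ≤ m → δ m ≡ 0) → ∀ i → total ε δ i ≤ B ℕ.+ B
total≤2B {ε} {δ} ε₀₁ δ₀₁ B hε hδ zero    = z≤n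
total≤2B {ε} {δ} ε₀₁ δ₀₁ B hε hδ (suc i) with B ℕₚ.≤? i
... | yes B≤i rewrite hε i B≤i | hδ i B≤i | ℕₚ.+-identityʳ (total ε δ i) = total≤2B ε₀₁ δ₀₁ B hε hδ i
... | no B≰i = ℕₚ.≤-trans (double (suc i)) (ℕₚ.+-mono-≤ (ℕₚ.≰⇒> B≰i) (ℕₚ.≰⇒> B≰i))
  where
  double : ∀ i → total ε δ i ≤ i ℕ.+ i
  double zero    = z≤n
  double (suc i) = ≡.subst (total ε δ (suc i) ≤_) (≡.trans (ℕₚ.+-comm (i ℕ.+ i) 2) (≡.cong suc (≡.sym (ℕₚ.+-suc i i))))
    (ℕₚ.+-mono-≤ (double i) (ℕₚ.+-mono-≤ (Binary-≤1 ε₀₁ i) (Binary-≤1 δ₀₁ i)))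

-- Additive operators and the relations among divided differences

module Core (𝒞 : Calculus) where

  open Calculus 𝒞 public
  open CommutativeRing ring public hiding (zero; ring)
  open import Relation.Binary.Reasoning.Setoid setoid

  -‿homo : ∀ a → const (ℤ.- a) ≈ - const a
  -‿homo a = Algebra.Properties.Group.inverseˡ-unique +-group (const (ℤ.- a)) (const a)
    (trans (sym (const-+ (ℤ.- a) a)) (trans (reflexive (≡.cong const (ℤₚ.+-inverseˡ a))) const-0))

  private
    morphism : ℤ.+-*-rawRing -Raw-AlmostCommutative⟶ fromCommutativeRing ring
    morphism = record
      { ⟦_⟧ = const ; +-homo = const-+ ; *-homo = const-* ; -‿homo = -‿homo ; 0-homo = const-0 ; 1-homo = const-1 }

    decide : ∀ a b → Maybe (const a ≈ const b)
    decide a b with a ℤ.≟ b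
    ... | yes eq = just (reflexive (≡.cong const eq))
    ... | no  _  = nothing

  open Algebra.Solver.Ring ℤ.+-*-rawRing (fromCommutativeRing ring) morphism decide public
    using (solve; _:=_; _:+_; _:*_; _:-_; :-_; con)

  -- The ring solver takes its coefficients from ℤ through `const` and sees `const 0ℤ` where the
  -- ring has `0#`; many steps below convert between the two.
  ≈0 : ∀ {f} → f ≈ const 0ℤ → f ≈ 0#
  ≈0 h = trans h const-0

  record Additive (T : Carrier → Carrier) : Set where
    field
      ⟨_⟩cong : ∀ {f g} → f ≈ g → T f ≈ T g
      homo-+ : ∀ f g → T (f + g) ≈ T f + T g

    homo-0 : T 0# ≈ 0#
    homo-0 = begin
      T 0#                       ≈⟨ solve 1 (λ a → a := (a :+ a) :- a) refl (T 0#) ⟩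
      (T 0# + T 0#) - T 0#       ≈⟨ +-congʳ (homo-+ 0# 0#) ⟨
      T (0# + 0#) - T 0#         ≈⟨ +-congʳ (⟨_⟩cong (+-identityˡ 0#)) ⟩
      T 0# - T 0#                ≈⟨ -‿inverseʳ _ ⟩
      0# ∎

    homo-≈0 : ∀ {f} → f ≈ 0# → T f ≈ 0#
    homo-≈0 h = trans (⟨_⟩cong h) homo-0

    homo-neg : ∀ f → T (- f) ≈ - T f
    homo-neg f = Algebra.Properties.Group.inverseˡ-unique +-group (T (- f)) (T f)
      (trans (sym (homo-+ (- f) f)) (homo-≈0 (-‿inverseˡ f)))

    homo-- : ∀ f g → T (f - g) ≈ T f - T g
    homo-- f g = trans (homo-+ f (- g)) (+-congˡ (homo-neg g))

    homo-const : ∀ c f → T (const c * f) ≈ const c * T f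
    homo-const (+ zero)   f = trans (homo-≈0 (trans (*-congʳ const-0) (zeroˡ f))) (sym (trans (*-congʳ const-0) (zeroˡ _)))
    homo-const (+ suc n)  f = begin
      T (const (+ suc n) * f)     ≈⟨ ⟨_⟩cong (split f) ⟩
      T (f + const (+ n) * f)     ≈⟨ homo-+ f _ ⟩
      T f + T (const (+ n) * f)   ≈⟨ +-congˡ (homo-const (+ n) f) ⟩
      T f + const (+ n) * T f     ≈⟨ split (T f) ⟨
      const (+ suc n) * T f ∎
      where
      split : ∀ g → const (+ suc n) * g ≈ g + const (+ n) * g
      split g = begin
        const (+ suc n) * g                 ≈⟨ *-congʳ (const-+ 1ℤ (+ n)) ⟩
        (const 1ℤ + const (+ n)) * g        ≈⟨ solve 2 (λ a g → (con 1ℤ :+ a) :* g := g :+ a :* g) refl (const (+ n)) g ⟩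
        g + const (+ n) * g ∎
    homo-const -[1+ zero ] f = begin
      T (const -[1+ 0 ] * f)   ≈⟨ ⟨_⟩cong (solve 1 (λ g → con -[1+ 0 ] :* g := :- g) refl f) ⟩
      T (- f)                  ≈⟨ homo-neg f ⟩
      - T f                    ≈⟨ solve 1 (λ g → :- g := con -[1+ 0 ] :* g) refl (T f) ⟩
      const -[1+ 0 ] * T f ∎
    homo-const -[1+ suc n ] f = begin
      T (const -[1+ suc n ] * f)    ≈⟨ ⟨_⟩cong (split f) ⟩
      T (- f + const -[1+ n ] * f)  ≈⟨ homo-+ (- f) _ ⟩
      T (- f) + T (const -[1+ n ] * f) ≈⟨ +-cong (homo-neg f) (homo-const -[1+ n ] f) ⟩
      - T f + const -[1+ n ] * T f  ≈⟨ split (T f) ⟨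
      const -[1+ suc n ] * T f ∎
      where
      split : ∀ g → const -[1+ suc n ] * g ≈ - g + const -[1+ n ] * g
      split g = begin
        const -[1+ suc n ] * g                     ≈⟨ *-congʳ (const-+ -[1+ 0 ] -[1+ n ]) ⟩
        (const -[1+ 0 ] + const -[1+ n ]) * g      ≈⟨ solve 2 (λ a g → (con -[1+ 0 ] :+ a) :* g := :- g :+ a :* g) refl (const -[1+ n ]) g ⟩
        - g + const -[1+ n ] * g ∎

  open Additive public

  ∂-additive : ∀ i → Additive (∂ i)
  ∂-additive i = record { ⟨_⟩cong = ∂-cong i ; homo-+ = ∂-+ i }

  Q-additive : ∀ n → Additive (Q n)
  Q-additive n = record { ⟨_⟩cong = Q-cong n ; homo-+ = Q-+ n }

  ρ-additive : ∀ i → Additive (ρ i)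
  ρ-additive i = record { ⟨_⟩cong = ρ-cong i ; homo-+ = ρ-+ i }

  *-additive : ∀ a → Additive (a *_)
  *-additive a = record { ⟨_⟩cong = *-congˡ ; homo-+ = distribˡ a }

  id-additive : Additive (λ f → f)
  id-additive = record { ⟨_⟩cong = λ h → h ; homo-+ = λ _ _ → refl }

  ∘-additive : ∀ {S T} → Additive S → Additive T → Additive (λ f → S (T f))
  ∘-additive aS aT = record
    { ⟨_⟩cong = λ h → ⟨ aS ⟩cong (⟨ aT ⟩cong h)
    ; homo-+ = λ f g → trans (⟨ aS ⟩cong (homo-+ aT f g)) (homo-+ aS _ _) }

  +-additive : ∀ {S T} → Additive S → Additive T → Additive (λ f → S f + T f)
  +-additive {S} {T} aS aT = record
    { ⟨_⟩cong = λ h → +-cong (⟨ aS ⟩cong h) (⟨ aT ⟩cong h)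
    ; homo-+ = λ f g → trans (+-cong (homo-+ aS f g) (homo-+ aT f g))
        (solve 4 (λ a b c d → (a :+ b) :+ (c :+ d) := (a :+ c) :+ (b :+ d)) refl (S f) (S g) (T f) (T g)) }

  -- The pattern behind most operator identities below: `ind` reduces them to constants and to
  -- multiplication by one variable.
  additive-ext : ∀ {S T} → Additive S → Additive T → (∀ c → S (const c) ≈ T (const c)) →
    (∀ j f → S f ≈ T f → S (x j * f) ≈ T (x j * f)) → ∀ f → S f ≈ T f
  additive-ext {S} {T} aS aT hc hx = ind (λ f → S f ≈ T f)
    (λ h e → trans (⟨ aS ⟩cong (sym h)) (trans e (⟨ aT ⟩cong h))) hc hx
    (λ f g hf hg → trans (homo-+ aS f g) (trans (+-cong hf hg) (sym (homo-+ aT f g))))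

  -- The common shape of `∂-same`, `∂-next` and `∂-far`: the coefficient is ∂ i (x k), the target is
  -- the image of x k under the transposition of x i and x (i+1). About the target only its rough
  -- position is kept; it shows that operators at distant indices do not see it.
  record Rule (i k : ℕ) : Set where
    field
      coefficient : ℤ
      target : ℕ
      target-local : target ≡ k ⊎ (target ≡ i ⊎ target ≡ suc i)
      rule : ∀ f → ∂ i (x k * f) ≈ const coefficient * f + x target * ∂ i f

  open Rule public

  rule-same : ∀ i → Rule i i
  rule-same i = record { coefficient = 1ℤ ; target = suc i ; target-local = inj₂ (inj₂ ≡.refl)
    ; rule = λ f → trans (∂-same i f) (+-congʳ (solve 1 (λ g → g := con 1ℤ :* g) refl f)) }

  rule-next : ∀ i → Rule i (suc i)
  rule-next i = record { coefficient = -[1+ 0 ] ; target = i ; target-local = inj₂ (inj₁ ≡.refl)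
    ; rule = λ f → trans (∂-next i f) (+-congʳ (solve 1 (λ g → :- g := con -[1+ 0 ] :* g) refl f)) }

  rule-far : ∀ {i k} → k ≢ i → k ≢ suc i → Rule i k
  rule-far {i} {k} k≢i k≢si = record { coefficient = 0ℤ ; target = k ; target-local = inj₁ ≡.refl
    ; rule = λ f → trans (∂-far i k f k≢i k≢si) (solve 2 (λ g h → h := con 0ℤ :* g :+ h) refl f _) }

  ∂-rule : ∀ i k → Rule i k
  ∂-rule i k with k ℕ.≟ i | k ℕ.≟ suc i
  ... | yes ≡.refl | _          = rule-same k
  ... | no _       | yes ≡.refl = rule-next i
  ... | no k≢i     | no k≢si    = rule-far k≢i k≢si

  target-avoids : ∀ {i k m} (r : Rule i k) → m ≢ k → m ≢ i → m ≢ suc i → m ≢ target r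
  target-avoids r m≢k m≢i m≢si m≡t with target-local r
  ... | inj₁ e        = m≢k (≡.trans m≡t e)
  ... | inj₂ (inj₁ e) = m≢i (≡.trans m≡t e)
  ... | inj₂ (inj₂ e) = m≢si (≡.trans m≡t e)

  -- The twisted Leibniz rule ∂ i f · g + s i(f) · ∂ i g, with the transposed polynomial s i(f) = f
  -- - (x i - x (i+1)) ∂ i f eliminated: the interface has no action of transpositions on
  -- polynomials, and this form is symmetric in f and g.
  ∂-* : ∀ i f g → ∂ i (f * g) ≈ ∂ i f * g + f * ∂ i g - (x i - x (suc i)) * (∂ i f * ∂ i g)
  ∂-* i f g = ind P resp base step plus f
    where
    P : Carrier → Set
    P f = ∂ i (f * g) ≈ ∂ i f * g + f * ∂ i g - (x i - x (suc i)) * (∂ i f * ∂ i g)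
    resp : ∀ {f f′} → f ≈ f′ → P f → P f′
    resp h e = trans (∂-cong i (*-congʳ (sym h))) (trans e (+-cong (+-cong (*-congʳ (∂-cong i h)) (*-congʳ h))
      (-‿cong (*-congˡ (*-congʳ (∂-cong i h))))))
    base : ∀ c → P (const c)
    base c = begin
      ∂ i (const c * g)        ≈⟨ homo-const (∂-additive i) c g ⟩
      const c * ∂ i g          ≈⟨ solve 5 (λ c g d x y → c :* d := con 0ℤ :* g :+ c :* d :- (x :- y) :* (con 0ℤ :* d)) refl (const c) g (∂ i g) (x i) (x (suc i)) ⟩
      const 0ℤ * g + const c * ∂ i g - (x i - x (suc i)) * (const 0ℤ * ∂ i g)
        ≈⟨ +-cong (+-congʳ (*-congʳ zero′)) (-‿cong (*-congˡ (*-congʳ zero′))) ⟩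
      ∂ i (const c) * g + const c * ∂ i g - (x i - x (suc i)) * (∂ i (const c) * ∂ i g) ∎
      where
      zero′ : const 0ℤ ≈ ∂ i (const c)
      zero′ = trans const-0 (sym (∂-const i c))
    plus : ∀ f f′ → P f → P f′ → P (f + f′)
    plus f f′ e e′ = begin
      ∂ i ((f + f′) * g)            ≈⟨ ∂-cong i (distribʳ g f f′) ⟩
      ∂ i (f * g + f′ * g)          ≈⟨ ∂-+ i _ _ ⟩
      ∂ i (f * g) + ∂ i (f′ * g)    ≈⟨ +-cong e e′ ⟩
      _                             ≈⟨ solve 7 (λ a a′ f f′ g h z → (a :* g :+ f :* h :- z :* (a :* h)) :+ (a′ :* g :+ f′ :* h :- z :* (a′ :* h))
                                          := (a :+ a′) :* g :+ (f :+ f′) :* h :- z :* ((a :+ a′) :* h)) refl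
                                          (∂ i f) (∂ i f′) f f′ g (∂ i g) (x i - x (suc i)) ⟩
      _                             ≈⟨ +-cong (+-congʳ (*-congʳ (∂-+ i f f′))) (-‿cong (*-congˡ (*-congʳ (∂-+ i f f′)))) ⟨
      ∂ i (f + f′) * g + (f + f′) * ∂ i g - (x i - x (suc i)) * (∂ i (f + f′) * ∂ i g) ∎
    step : ∀ j f → P f → P (x j * f)
    step j f e with j ℕ.≟ i | j ℕ.≟ suc i
    ... | yes ≡.refl | _ = begin
      ∂ i (x i * f * g)                  ≈⟨ ∂-cong i (*-assoc _ _ _) ⟩
      ∂ i (x i * (f * g))                ≈⟨ ∂-same i _ ⟩
      f * g + x (suc i) * ∂ i (f * g)    ≈⟨ +-congˡ (*-congˡ e) ⟩
      _ ≈⟨ solve 6 (λ f g a b x y → f :* g :+ y :* (a :* g :+ f :* b :- (x :- y) :* (a :* b))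
              := (f :+ y :* a) :* g :+ x :* f :* b :- (x :- y) :* ((f :+ y :* a) :* b)) refl f g (∂ i f) (∂ i g) (x i) (x (suc i)) ⟩
      _ ≈⟨ +-cong (+-congʳ (*-congʳ (∂-same i f))) (-‿cong (*-congˡ (*-congʳ (∂-same i f)))) ⟨
      ∂ i (x i * f) * g + x i * f * ∂ i g - (x i - x (suc i)) * (∂ i (x i * f) * ∂ i g) ∎
    ... | no _ | yes ≡.refl = begin
      ∂ i (x (suc i) * f * g)            ≈⟨ ∂-cong i (*-assoc _ _ _) ⟩
      ∂ i (x (suc i) * (f * g))          ≈⟨ ∂-next i _ ⟩
      - (f * g) + x i * ∂ i (f * g)      ≈⟨ +-congˡ (*-congˡ e) ⟩
      _ ≈⟨ solve 6 (λ f g a b x y → :- (f :* g) :+ x :* (a :* g :+ f :* b :- (x :- y) :* (a :* b))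
              := (:- f :+ x :* a) :* g :+ y :* f :* b :- (x :- y) :* ((:- f :+ x :* a) :* b)) refl f g (∂ i f) (∂ i g) (x i) (x (suc i)) ⟩
      _ ≈⟨ +-cong (+-congʳ (*-congʳ (∂-next i f))) (-‿cong (*-congˡ (*-congʳ (∂-next i f)))) ⟨
      ∂ i (x (suc i) * f) * g + x (suc i) * f * ∂ i g - (x i - x (suc i)) * (∂ i (x (suc i) * f) * ∂ i g) ∎
    ... | no j≢i | no j≢si = begin
      ∂ i (x j * f * g)                  ≈⟨ ∂-cong i (*-assoc _ _ _) ⟩
      ∂ i (x j * (f * g))                ≈⟨ ∂-far i j _ j≢i j≢si ⟩
      x j * ∂ i (f * g)                  ≈⟨ *-congˡ e ⟩
      _ ≈⟨ solve 6 (λ f g a b z t → t :* (a :* g :+ f :* b :- z :* (a :* b))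
              := t :* a :* g :+ t :* f :* b :- z :* (t :* a :* b)) refl f g (∂ i f) (∂ i g) (x i - x (suc i)) (x j) ⟩
      _ ≈⟨ +-cong (+-congʳ (*-congʳ (∂-far i j f j≢i j≢si))) (-‿cong (*-congˡ (*-congʳ (∂-far i j f j≢i j≢si)))) ⟨
      ∂ i (x j * f) * g + x j * f * ∂ i g - (x i - x (suc i)) * (∂ i (x j * f) * ∂ i g) ∎

  ∂-const² : ∀ i j c → ∂ i (∂ j (const c)) ≈ 0#
  ∂-const² i j c = homo-≈0 (∂-additive i) (∂-const j c)

  expand₂ : ∀ {i j k} (r : Rule j k) (s : Rule i (target r)) f →
    ∂ i (∂ j (x k * f)) ≈ const (coefficient r) * ∂ i f + const (coefficient s) * ∂ j f + x (target s) * ∂ i (∂ j f)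
  expand₂ {i} {j} {k} r s f = begin
    ∂ i (∂ j (x k * f))                                               ≈⟨ ∂-cong i (rule r f) ⟩
    ∂ i (const (coefficient r) * f + x (target r) * ∂ j f)            ≈⟨ ∂-+ i _ _ ⟩
    ∂ i (const (coefficient r) * f) + ∂ i (x (target r) * ∂ j f)      ≈⟨ +-cong (homo-const (∂-additive i) _ f) (rule s _) ⟩
    const (coefficient r) * ∂ i f + (const (coefficient s) * ∂ j f + x (target s) * ∂ i (∂ j f)) ≈⟨ +-assoc _ _ _ ⟨
    _ ∎

  expand₃ : ∀ {i j l k} (r : Rule l k) (s : Rule j (target r)) (t : Rule i (target s)) f →
    ∂ i (∂ j (∂ l (x k * f))) ≈ const (coefficient r) * ∂ i (∂ j f) + const (coefficient s) * ∂ i (∂ l f)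
      + const (coefficient t) * ∂ j (∂ l f) + x (target t) * ∂ i (∂ j (∂ l f))
  expand₃ {i} {j} {l} {k} r s t f = begin
    ∂ i (∂ j (∂ l (x k * f)))  ≈⟨ ∂-cong i (expand₂ r s f) ⟩
    ∂ i (const (coefficient r) * ∂ j f + const (coefficient s) * ∂ l f + x (target s) * ∂ j (∂ l f))
      ≈⟨ trans (∂-+ i _ _) (+-congʳ (∂-+ i _ _)) ⟩
    ∂ i (const (coefficient r) * ∂ j f) + ∂ i (const (coefficient s) * ∂ l f) + ∂ i (x (target s) * ∂ j (∂ l f))
      ≈⟨ +-cong (+-cong (homo-const (∂-additive i) _ _) (homo-const (∂-additive i) _ _)) (rule t _) ⟩
    const (coefficient r) * ∂ i (∂ j f) + const (coefficient s) * ∂ i (∂ l f)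
      + (const (coefficient t) * ∂ j (∂ l f) + x (target t) * ∂ i (∂ j (∂ l f))) ≈⟨ +-assoc _ _ _ ⟨
    _ ∎

  -- On a factor x k the two passes contribute opposite coefficients, 1 and -1 or both 0, each in
  -- front of ∂ i f.
  ∂² : ∀ i f → ∂ i (∂ i f) ≈ 0#
  ∂² i f = ind (λ f → ∂ i (∂ i f) ≈ 0#) (λ h e → trans (⟨ ∂∂ ⟩cong (sym h)) e) (∂-const² i i) step
    (λ f g e e′ → trans (homo-+ ∂∂ f g) (trans (+-cong e e′) (+-identityˡ 0#))) f
    where
    ∂∂ = ∘-additive (∂-additive i) (∂-additive i)
    close : ∀ {k a t} f → ∂ i (∂ i f) ≈ 0# →
      ∂ i (∂ i (x k * f)) ≈ const a * ∂ i f + const (ℤ.- a) * ∂ i f + x t * ∂ i (∂ i f) → ∂ i (∂ i (x k * f)) ≈ 0#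
    close {k} {a} {t} f e h = begin
      _ ≈⟨ h ⟩
      const a * ∂ i f + const (ℤ.- a) * ∂ i f + x t * ∂ i (∂ i f) ≈⟨ +-cong (+-congˡ (*-congʳ (-‿homo a))) (*-congˡ e) ⟩
      const a * ∂ i f + - const a * ∂ i f + x t * 0#
        ≈⟨ +-cong (solve 2 (λ a d → a :* d :+ :- a :* d := con 0ℤ) refl (const a) (∂ i f)) (zeroʳ _) ⟩
      const 0ℤ + 0# ≈⟨ trans (+-identityʳ _) const-0 ⟩
      0# ∎
    step : ∀ k f → ∂ i (∂ i f) ≈ 0# → ∂ i (∂ i (x k * f)) ≈ 0#
    step k f e with k ℕ.≟ i | k ℕ.≟ suc i
    ... | yes ≡.refl | _          = close f e (expand₂ (rule-same i) (rule-next i) f)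
    ... | no _       | yes ≡.refl = close f e (expand₂ (rule-next i) (rule-same i) f)
    ... | no k≢i     | no k≢si    = close f e (expand₂ (rule-far k≢i k≢si) (rule-far k≢i k≢si) f)

  -- The induction step shared by the commutation lemmas: `T` is any additive operator for which x k
  -- and its image under the rule act as scalars.
  ∂-commute-step : ∀ {T} → Additive T → ∀ {i k} (r : Rule i k) f →
    (∀ g → T (x k * g) ≈ x k * T g) → (∀ g → T (x (target r) * g) ≈ x (target r) * T g) →
    ∂ i (T f) ≈ T (∂ i f) → ∂ i (T (x k * f)) ≈ T (∂ i (x k * f))
  ∂-commute-step {T} aT {i} {k} r f hk ht e = begin
    ∂ i (T (x k * f))                                          ≈⟨ ∂-cong i (hk f) ⟩
    ∂ i (x k * T f)                                            ≈⟨ rule r _ ⟩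
    const (coefficient r) * T f + x (target r) * ∂ i (T f)     ≈⟨ +-cong (sym (homo-const aT _ f)) (trans (*-congˡ e) (sym (ht _))) ⟩
    T (const (coefficient r) * f) + T (x (target r) * ∂ i f)   ≈⟨ homo-+ aT _ _ ⟨
    T (const (coefficient r) * f + x (target r) * ∂ i f)       ≈⟨ ⟨ aT ⟩cong (rule r f) ⟨
    T (∂ i (x k * f)) ∎

  ≢-up : ∀ {i j} → suc i < j → i ≢ j × suc i ≢ j × i ≢ suc j × suc i ≢ suc j
  ≢-up {i} {j} h = (λ e → ℕₚ.<⇒≢ (ℕₚ.<-trans (ℕₚ.n<1+n i) h) e) , (λ e → ℕₚ.<⇒≢ h e)
    , (λ e → ℕₚ.<⇒≢ (ℕₚ.<-trans (ℕₚ.n<1+n i) (ℕₚ.m<n⇒m<1+n h)) e) , (λ e → ℕₚ.<⇒≢ (ℕₚ.m<n⇒m<1+n h) e)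

  ∂-comm : ∀ i j f → suc i < j → ∂ i (∂ j f) ≈ ∂ j (∂ i f)
  ∂-comm i j f far = additive-ext (∘-additive (∂-additive i) (∂-additive j)) (∘-additive (∂-additive j) (∂-additive i))
    (λ c → trans (∂-const² i j c) (sym (∂-const² j i c))) step f
    where
    A = proj₁ (≢-up far)
    B = proj₁ (proj₂ (≢-up far))
    C = proj₁ (proj₂ (proj₂ (≢-up far)))
    D = proj₂ (proj₂ (proj₂ (≢-up far)))
    step : ∀ k f → ∂ i (∂ j f) ≈ ∂ j (∂ i f) → ∂ i (∂ j (x k * f)) ≈ ∂ j (∂ i (x k * f))
    step k f e with k ℕ.≟ j | k ℕ.≟ suc j
    ... | yes ≡.refl | _ = sym (∂-commute-step (∂-additive i) (rule-same j) f
            (λ g → ∂-far i j g (A ∘ ≡.sym) (B ∘ ≡.sym)) (λ g → ∂-far i (suc j) g (C ∘ ≡.sym) (D ∘ ≡.sym)) (sym e))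
    ... | no _ | yes ≡.refl = sym (∂-commute-step (∂-additive i) (rule-next j) f
            (λ g → ∂-far i (suc j) g (C ∘ ≡.sym) (D ∘ ≡.sym)) (λ g → ∂-far i j g (A ∘ ≡.sym) (B ∘ ≡.sym)) (sym e))
    ... | no k≢j | no k≢sj = ∂-commute-step (∂-additive j) r f (λ g → ∂-far j k g k≢j k≢sj)
            (λ g → ∂-far j (target r) g (λ t≡ → target-avoids r (k≢j ∘ ≡.sym) (A ∘ ≡.sym) (B ∘ ≡.sym) (≡.sym t≡))
                                        (λ t≡ → target-avoids r (k≢sj ∘ ≡.sym) (C ∘ ≡.sym) (D ∘ ≡.sym) (≡.sym t≡))) e
      where r = ∂-rule i k

  -- In both expansions the middle coefficient stands before a square, `∂ i (∂ i f)` or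
  -- `∂ j (∂ j f)`, which is zero; the two outer terms are the same on both sides, in exchanged
  -- order.
  ∂-braid : ∀ i f → ∂ i (∂ (suc i) (∂ i f)) ≈ ∂ (suc i) (∂ i (∂ (suc i) f))
  ∂-braid i f = additive-ext (∘-additive (∂-additive i) (∘-additive (∂-additive j) (∂-additive i)))
    (∘-additive (∂-additive j) (∘-additive (∂-additive i) (∂-additive j)))
    (λ c → trans (homo-≈0 (∂-additive i) (∂-const² j i c)) (sym (homo-≈0 (∂-additive j) (∂-const² i j c)))) step f
    where
    j = suc i
    i≢j : i ≢ j
    i≢j = ℕₚ.<⇒≢ ℕₚ.≤-refl
    i≢sj : i ≢ suc j
    i≢sj = ℕₚ.<⇒≢ (ℕₚ.m<n⇒m<1+n ℕₚ.≤-refl)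
    j≢sj : j ≢ suc j
    j≢sj = ℕₚ.<⇒≢ ℕₚ.≤-refl
    close : ∀ {k a b s s′ t} f → ∂ i (∂ j (∂ i f)) ≈ ∂ j (∂ i (∂ j f)) →
      ∂ i (∂ j (∂ i (x k * f))) ≈ const a * ∂ i (∂ j f) + const s * ∂ i (∂ i f) + const b * ∂ j (∂ i f) + x t * ∂ i (∂ j (∂ i f)) →
      ∂ j (∂ i (∂ j (x k * f))) ≈ const b * ∂ j (∂ i f) + const s′ * ∂ j (∂ j f) + const a * ∂ i (∂ j f) + x t * ∂ j (∂ i (∂ j f)) →
      ∂ i (∂ j (∂ i (x k * f))) ≈ ∂ j (∂ i (∂ j (x k * f)))
    close {k} {a} {b} {s} {s′} {t} f e hl hr = begin
      _ ≈⟨ hl ⟩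
      _ ≈⟨ +-cong (+-congʳ (+-congˡ (*-congˡ (trans (∂² i f) (sym const-0))))) (*-congˡ e) ⟩
      _ ≈⟨ solve 7 (λ a b s s′ p q r → a :* p :+ s :* con 0ℤ :+ b :* q :+ r := b :* q :+ s′ :* con 0ℤ :+ a :* p :+ r) refl
            (const a) (const b) (const s) (const s′) (∂ i (∂ j f)) (∂ j (∂ i f)) (x t * ∂ j (∂ i (∂ j f))) ⟩
      _ ≈⟨ +-congʳ (+-congʳ (+-congˡ (*-congˡ (trans (∂² j f) (sym const-0))))) ⟨
      _ ≈⟨ hr ⟨
      _ ∎
    step : ∀ k f → ∂ i (∂ j (∂ i f)) ≈ ∂ j (∂ i (∂ j f)) → ∂ i (∂ j (∂ i (x k * f))) ≈ ∂ j (∂ i (∂ j (x k * f)))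
    step k f e with k ℕ.≟ i | k ℕ.≟ j | k ℕ.≟ suc j
    ... | yes ≡.refl | _ | _ = close f e (expand₃ (rule-same i) (rule-same j) (rule-far (i≢sj ∘ ≡.sym) (j≢sj ∘ ≡.sym)) f)
            (expand₃ (rule-far i≢j i≢sj) (rule-same i) (rule-same j) f)
    ... | no _ | yes ≡.refl | _ = close f e (expand₃ (rule-next i) (rule-far i≢j i≢sj) (rule-same i) f)
            (expand₃ (rule-same j) (rule-far (i≢sj ∘ ≡.sym) (j≢sj ∘ ≡.sym)) (rule-next j) f)
    ... | no _ | no _ | yes ≡.refl = close f e (expand₃ (rule-far (i≢sj ∘ ≡.sym) (j≢sj ∘ ≡.sym)) (rule-next j) (rule-next i) f)
            (expand₃ (rule-next j) (rule-next i) (rule-far i≢j i≢sj) f)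
    ... | no k≢i | no k≢j | no k≢sj = close f e (expand₃ (rule-far k≢i k≢j) (rule-far k≢j k≢sj) (rule-far k≢i k≢j) f)
            (expand₃ (rule-far k≢j k≢sj) (rule-far k≢i k≢j) (rule-far k≢j k≢sj) f)

  -- Quotients by a variable and elimination of a variable

  Q-∂ : ∀ n i f → n ≢ i → n ≢ suc i → ∂ i (Q n f) ≈ Q n (∂ i f)
  Q-∂ n i f n≢i n≢si = additive-ext (∘-additive (∂-additive i) (Q-additive n)) (∘-additive (Q-additive n) (∂-additive i))
    (λ c → trans (homo-≈0 (∂-additive i) (Q-const n c)) (sym (homo-≈0 (Q-additive n) (∂-const i c)))) step f
    where
    step : ∀ k f → ∂ i (Q n f) ≈ Q n (∂ i f) → ∂ i (Q n (x k * f)) ≈ Q n (∂ i (x k * f))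
    step k f e with k ℕ.≟ n
    ... | yes ≡.refl = trans (∂-cong i (Q-same n f)) (sym (trans (Q-cong n (∂-far i n f n≢i n≢si)) (Q-same n _)))
    ... | no k≢n = ∂-commute-step (Q-additive n) r f (λ g → Q-diff n k g k≢n)
            (λ g → Q-diff n (target r) g (λ t≡ → target-avoids r (k≢n ∘ ≡.sym) n≢i n≢si (≡.sym t≡))) e
      where r = ∂-rule i k

  Q-comm : ∀ m n f → Q m (Q n f) ≈ Q n (Q m f)
  Q-comm m n f with m ℕ.≟ n
  ... | yes ≡.refl = refl
  ... | no m≢n = additive-ext (∘-additive (Q-additive m) (Q-additive n)) (∘-additive (Q-additive n) (Q-additive m))
    (λ c → trans (homo-≈0 (Q-additive m) (Q-const n c)) (sym (homo-≈0 (Q-additive n) (Q-const m c)))) step f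
    where
    step : ∀ k f → Q m (Q n f) ≈ Q n (Q m f) → Q m (Q n (x k * f)) ≈ Q n (Q m (x k * f))
    step k f e with k ℕ.≟ m | k ℕ.≟ n
    ... | yes ≡.refl | _ = trans (Q-cong m (Q-diff n k f m≢n)) (trans (Q-same m _) (Q-cong n (sym (Q-same m f))))
    ... | no k≢m | yes ≡.refl = trans (Q-cong m (Q-same n f)) (sym (trans (Q-cong n (Q-diff m n f k≢m)) (Q-same n _)))
    ... | no k≢m | no k≢n = trans (Q-cong m (Q-diff n k f k≢n)) (trans (Q-diff m k _ k≢m)
            (trans (*-congˡ e) (sym (trans (Q-cong n (Q-diff m k f k≢m)) (Q-diff n k _ k≢n)))))

  -- Here `f - x n * Q n f` is f with x n set to 0, so this is the product rule for a difference
  -- quotient at 0.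
  Q-* : ∀ n f g → Q n (f * g) ≈ Q n f * g + (f - x n * Q n f) * Q n g
  Q-* n f g = ind P resp base step plus f
    where
    P : Carrier → Set
    P f = Q n (f * g) ≈ Q n f * g + (f - x n * Q n f) * Q n g
    resp : ∀ {f f′} → f ≈ f′ → P f → P f′
    resp h e = trans (Q-cong n (*-congʳ (sym h))) (trans e (+-cong (*-congʳ (Q-cong n h))
      (*-congʳ (+-cong h (-‿cong (*-congˡ (Q-cong n h)))))))
    base : ∀ c → P (const c)
    base c = begin
      Q n (const c * g)    ≈⟨ homo-const (Q-additive n) c g ⟩
      const c * Q n g      ≈⟨ solve 4 (λ c g d x → c :* d := con 0ℤ :* g :+ (c :- x :* con 0ℤ) :* d) refl (const c) g (Q n g) (x n) ⟩
      const 0ℤ * g + (const c - x n * const 0ℤ) * Q n g ≈⟨ +-cong (*-congʳ zero′) (*-congʳ (+-congˡ (-‿cong (*-congˡ zero′)))) ⟩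
      Q n (const c) * g + (const c - x n * Q n (const c)) * Q n g ∎
      where
      zero′ : const 0ℤ ≈ Q n (const c)
      zero′ = trans const-0 (sym (Q-const n c))
    plus : ∀ f f′ → P f → P f′ → P (f + f′)
    plus f f′ e e′ = begin
      Q n ((f + f′) * g)          ≈⟨ Q-cong n (distribʳ g f f′) ⟩
      Q n (f * g + f′ * g)        ≈⟨ Q-+ n _ _ ⟩
      Q n (f * g) + Q n (f′ * g)  ≈⟨ +-cong e e′ ⟩
      _ ≈⟨ solve 7 (λ a a′ f f′ g h x → (a :* g :+ (f :- x :* a) :* h) :+ (a′ :* g :+ (f′ :- x :* a′) :* h)
             := (a :+ a′) :* g :+ (f :+ f′ :- x :* (a :+ a′)) :* h) refl (Q n f) (Q n f′) f f′ g (Q n g) (x n) ⟩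
      _ ≈⟨ +-cong (*-congʳ (Q-+ n f f′)) (*-congʳ (+-congˡ (-‿cong (*-congˡ (Q-+ n f f′))))) ⟨
      Q n (f + f′) * g + (f + f′ - x n * Q n (f + f′)) * Q n g ∎
    step : ∀ j f → P f → P (x j * f)
    step j f e with j ℕ.≟ n
    ... | yes ≡.refl = begin
      Q n (x n * f * g)     ≈⟨ Q-cong n (*-assoc _ _ _) ⟩
      Q n (x n * (f * g))   ≈⟨ Q-same n _ ⟩
      f * g                 ≈⟨ solve 4 (λ f g h x → f :* g := f :* g :+ (x :* f :- x :* f) :* h) refl f g (Q n g) (x n) ⟩
      f * g + (x n * f - x n * f) * Q n g ≈⟨ +-cong (*-congʳ (Q-same n f)) (*-congʳ (+-congˡ (-‿cong (*-congˡ (Q-same n f))))) ⟨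
      Q n (x n * f) * g + (x n * f - x n * Q n (x n * f)) * Q n g ∎
    ... | no j≢n = begin
      Q n (x j * f * g)     ≈⟨ Q-cong n (*-assoc _ _ _) ⟩
      Q n (x j * (f * g))   ≈⟨ Q-diff n j _ j≢n ⟩
      x j * Q n (f * g)     ≈⟨ *-congˡ e ⟩
      _ ≈⟨ solve 6 (λ f g a h x y → y :* (a :* g :+ (f :- x :* a) :* h) := y :* a :* g :+ (y :* f :- x :* (y :* a)) :* h)
             refl f g (Q n f) (Q n g) (x n) (x j) ⟩
      _ ≈⟨ +-cong (*-congʳ (Q-diff n j f j≢n)) (*-congʳ (+-congˡ (-‿cong (*-congˡ (Q-diff n j f j≢n))))) ⟨
      Q n (x j * f) * g + (x j * f - x n * Q n (x j * f)) * Q n g ∎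

  skip-view : ∀ i j → j ≡ i ⊎ ∃ λ k → j ≡ skip i k
  skip-view zero    zero    = inj₁ ≡.refl
  skip-view zero    (suc j) = inj₂ (j , ≡.refl)
  skip-view (suc i) zero    = inj₂ (0 , ≡.refl)
  skip-view (suc i) (suc j) with skip-view i j
  ... | inj₁ e       = inj₁ (≡.cong suc e)
  ... | inj₂ (k , e) = inj₂ (suc k , ≡.cong suc e)

  ρ-* : ∀ i f g → ρ i (f * g) ≈ ρ i f * ρ i g
  ρ-* i f g = additive-ext {λ f → ρ i (f * g)} {λ f → ρ i f * ρ i g}
    (record { ⟨_⟩cong = λ h → ρ-cong i (*-congʳ h)
            ; homo-+ = λ a b → trans (ρ-cong i (distribʳ g a b)) (ρ-+ i _ _) })
    (record { ⟨_⟩cong = λ h → *-congʳ (ρ-cong i h)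
            ; homo-+ = λ a b → trans (*-congʳ (ρ-+ i a b)) (distribʳ _ _ _) })
    (λ c → trans (homo-const (ρ-additive i) c g) (*-congʳ (sym (ρ-const i c)))) step f
    where
    step : ∀ j f → ρ i (f * g) ≈ ρ i f * ρ i g → ρ i (x j * f * g) ≈ ρ i (x j * f) * ρ i g
    step j f e with skip-view i j
    ... | inj₁ ≡.refl = trans (ρ-cong i (*-assoc _ _ _)) (trans (ρ-same i _)
            (sym (trans (*-congʳ (ρ-same i f)) (zeroˡ _))))
    ... | inj₂ (k , ≡.refl) = trans (ρ-cong i (*-assoc _ _ _)) (trans (ρ-skip i k _)
            (trans (*-congˡ e) (trans (sym (*-assoc _ _ _)) (*-congʳ (sym (ρ-skip i k f))))))

  ρ₀-∂ : ∀ i f → ρ 0 (∂ (suc i) f) ≈ ∂ i (ρ 0 f)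
  ρ₀-∂ i f = additive-ext (∘-additive (ρ-additive 0) (∂-additive (suc i))) (∘-additive (∂-additive i) (ρ-additive 0))
    (λ c → trans (homo-≈0 (ρ-additive 0) (∂-const _ c)) (sym (trans (∂-cong i (ρ-const 0 c)) (∂-const i c)))) step f
    where
    step : ∀ k f → ρ 0 (∂ (suc i) f) ≈ ∂ i (ρ 0 f) → ρ 0 (∂ (suc i) (x k * f)) ≈ ∂ i (ρ 0 (x k * f))
    step zero f e = trans (ρ-cong 0 (∂-far (suc i) 0 f (λ ()) (λ ()))) (trans (ρ-same 0 _)
      (sym (homo-≈0 (∂-additive i) (ρ-same 0 f))))
    step (suc k) f e with k ℕ.≟ i | k ℕ.≟ suc i
    ... | yes ≡.refl | _ = begin
      ρ 0 (∂ (suc i) (x (suc i) * f))              ≈⟨ ρ-cong 0 (∂-same (suc i) f) ⟩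
      ρ 0 (f + x (suc (suc i)) * ∂ (suc i) f)      ≈⟨ ρ-+ 0 _ _ ⟩
      ρ 0 f + ρ 0 (x (suc (suc i)) * ∂ (suc i) f)  ≈⟨ +-congˡ (trans (ρ-skip 0 (suc i) _) (*-congˡ e)) ⟩
      ρ 0 f + x (suc i) * ∂ i (ρ 0 f)              ≈⟨ ∂-same i _ ⟨
      ∂ i (x i * ρ 0 f)                            ≈⟨ ∂-cong i (ρ-skip 0 i f) ⟨
      ∂ i (ρ 0 (x (suc i) * f)) ∎
    ... | no _ | yes ≡.refl = begin
      ρ 0 (∂ (suc i) (x (suc (suc i)) * f))        ≈⟨ ρ-cong 0 (∂-next (suc i) f) ⟩
      ρ 0 (- f + x (suc i) * ∂ (suc i) f)          ≈⟨ ρ-+ 0 _ _ ⟩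
      ρ 0 (- f) + ρ 0 (x (suc i) * ∂ (suc i) f)    ≈⟨ +-cong (homo-neg (ρ-additive 0) f) (trans (ρ-skip 0 i _) (*-congˡ e)) ⟩
      - ρ 0 f + x i * ∂ i (ρ 0 f)                  ≈⟨ ∂-next i _ ⟨
      ∂ i (x (suc i) * ρ 0 f)                      ≈⟨ ∂-cong i (ρ-skip 0 (suc i) f) ⟨
      ∂ i (ρ 0 (x (suc (suc i)) * f)) ∎
    ... | no k≢i | no k≢si = begin
      ρ 0 (∂ (suc i) (x (suc k) * f))              ≈⟨ ρ-cong 0 (∂-far (suc i) (suc k) f (k≢i ∘ ℕₚ.suc-injective) (k≢si ∘ ℕₚ.suc-injective)) ⟩
      ρ 0 (x (suc k) * ∂ (suc i) f)                ≈⟨ ρ-skip 0 k _ ⟩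
      x k * ρ 0 (∂ (suc i) f)                      ≈⟨ *-congˡ e ⟩
      x k * ∂ i (ρ 0 f)                            ≈⟨ ∂-far i k _ k≢i k≢si ⟨
      ∂ i (x k * ρ 0 f)                            ≈⟨ ∂-cong i (ρ-skip 0 k f) ⟨
      ∂ i (ρ 0 (x (suc k) * f)) ∎

  ct-ρ₀ : ∀ f → ct (ρ 0 f) ≡ ct f
  ct-ρ₀ = ind (λ f → ct (ρ 0 f) ≡ ct f) (λ h e → ≡.trans (ct-cong (ρ-cong 0 (sym h))) (≡.trans e (ct-cong h)))
    (λ c → ct-cong (ρ-const 0 c)) step
    (λ f g e e′ → ≡.trans (ct-cong (ρ-+ 0 f g)) (≡.trans (ct-+ _ _) (≡.trans (≡.cong₂ ℤ._+_ e e′) (≡.sym (ct-+ f g)))))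
    where
    ct-0 : ct 0# ≡ 0ℤ
    ct-0 = ≡.trans (ct-cong (sym const-0)) (ct-const 0ℤ)
    step : ∀ k f → ct (ρ 0 f) ≡ ct f → ct (ρ 0 (x k * f)) ≡ ct (x k * f)
    step zero    f _ = ≡.trans (≡.trans (ct-cong (ρ-same 0 f)) ct-0) (≡.sym (ct-x 0 f))
    step (suc k) f _ = ≡.trans (≡.trans (ct-cong (ρ-skip 0 k f)) (ct-x k _)) (≡.sym (ct-x (suc k) f))

  -- Isobaric divided differences and the correction terms of E

  π : ℕ → Carrier → Carrier
  π i f = f + x (suc i) * ∂ i f

  π-additive : ∀ i → Additive (π i)
  π-additive i = +-additive id-additive (∘-additive (*-additive (x (suc i))) (∂-additive i))

  π-∂x : ∀ i f → π i f ≈ ∂ i (x i * f)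
  π-∂x i f = sym (∂-same i f)

  π-* : ∀ i f g → π i f * π i g ≈ π i (f * g) + x i * (x (suc i) * (∂ i f * ∂ i g))
  π-* i f g = begin
    π i f * π i g
      ≈⟨ solve 6 (λ f g a b x y → (f :+ y :* a) :* (g :+ y :* b)
           := f :* g :+ y :* (a :* g :+ f :* b :- (x :- y) :* (a :* b)) :+ x :* (y :* (a :* b))) refl f g (∂ i f) (∂ i g) (x i) (x (suc i)) ⟩
    f * g + x (suc i) * (∂ i f * g + f * ∂ i g - (x i - x (suc i)) * (∂ i f * ∂ i g)) + x i * (x (suc i) * (∂ i f * ∂ i g))
      ≈⟨ +-congʳ (+-congˡ (*-congˡ (∂-* i f g))) ⟨
    π i (f * g) + x i * (x (suc i) * (∂ i f * ∂ i g)) ∎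

  π-commute : ∀ {T} → Additive T → ∀ i → (∀ f → ∂ i (T f) ≈ T (∂ i f)) → (∀ f → T (x (suc i) * f) ≈ x (suc i) * T f) →
    ∀ f → π i (T f) ≈ T (π i f)
  π-commute aT i h hx f = trans (+-congˡ (trans (*-congˡ (h f)) (sym (hx _)))) (sym (homo-+ aT f _))

  π-∂-comm : ∀ i j f → suc i < j → ∂ i (π j f) ≈ π j (∂ i f)
  π-∂-comm i j f h = sym (π-commute (∂-additive i) j (λ g → sym (∂-comm i j g h))
    (λ g → ∂-far i (suc j) g (proj₁ (proj₂ (proj₂ (≢-up h))) ∘ ≡.sym) (proj₂ (proj₂ (proj₂ (≢-up h))) ∘ ≡.sym)) f)

  π-Q-comm : ∀ i n f → suc i < n → π i (Q n f) ≈ Q n (π i f)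
  π-Q-comm i n f h = π-commute (Q-additive n) i (λ g → Q-∂ n i g (proj₁ (≢-up h) ∘ ≡.sym) (proj₁ (proj₂ (≢-up h)) ∘ ≡.sym))
    (λ g → Q-diff n (suc i) g (proj₁ (proj₂ (≢-up h)))) f

  -- A finite stage of the infinite composite: on polynomials in x 0, ..., x (n-1) the later factors
  -- π n, π (n+1), ... act as the identity (`π-free`).
  E : ℕ → Carrier → Carrier
  E zero    f = f
  E (suc n) f = E n (π n f)

  E-additive : ∀ n → Additive (E n)
  E-additive zero    = id-additive
  E-additive (suc n) = ∘-additive (E-additive n) (π-additive n)

  -- The factors π i ∘ ⋯ ∘ π (i+m-1) of `E`. This recursion peels the outermost factor, that of `E`
  -- the innermost one; `E-tail` joins the two.
  tail : ℕ → ℕ → Carrier → Carrier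
  tail i zero    f = f
  tail i (suc m) f = π i (tail (suc i) m f)

  tail-additive : ∀ i m → Additive (tail i m)
  tail-additive i zero    = id-additive
  tail-additive i (suc m) = ∘-additive (π-additive i) (tail-additive (suc i) m)

  E-tail : ∀ i m f → E i (tail i m f) ≡ E (i ℕ.+ m) f
  E-tail i zero    f = ≡.cong (λ n → E n f) (≡.sym (ℕₚ.+-identityʳ i))
  E-tail i (suc m) f = ≡.trans (E-tail (suc i) m f) (≡.cong (λ n → E n f) (≡.sym (ℕₚ.+-suc i m)))

  tail-∂-comm : ∀ i j m f → suc i < j → ∂ i (tail j m f) ≈ tail j m (∂ i f)
  tail-∂-comm i j zero    f h = refl
  tail-∂-comm i j (suc m) f h = trans (π-∂-comm i j _ h) (⟨ π-additive j ⟩cong (tail-∂-comm i (suc j) m f (ℕₚ.m<n⇒m<1+n h)))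

  D : ℕ → Carrier → Carrier
  D zero    f = f
  D (suc k) f = D k (∂ k f)

  D-additive : ∀ k → Additive (D k)
  D-additive zero    = id-additive
  D-additive (suc k) = ∘-additive (D-additive k) (∂-additive k)

  D-x : ∀ k j f → k < j → D k (x j * f) ≈ x j * D k f
  D-x zero    j f h = refl
  D-x (suc k) j f h = trans (⟨ D-additive k ⟩cong (∂-far k j f (proj₁ (≢-up h) ∘ ≡.sym) (proj₁ (proj₂ (≢-up h)) ∘ ≡.sym)))
    (D-x k j _ (ℕₚ.<-trans (ℕₚ.n<1+n k) h))

  D-Q : ∀ k n f → k < n → D k (Q n f) ≈ Q n (D k f)
  D-Q zero    n f h = refl
  D-Q (suc k) n f h = trans (⟨ D-additive k ⟩cong (Q-∂ n k f (proj₁ (≢-up h) ∘ ≡.sym) (proj₁ (proj₂ (≢-up h)) ∘ ≡.sym)))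
    (D-Q k n _ (ℕₚ.<-trans (ℕₚ.n<1+n k) h))

  X : ℕ → Carrier
  X zero    = x 0
  X (suc i) = X i * x (suc i)

  -- Since π i (x (i+1) h) = x i x (i+1) ∂ i h, every isobaric operator turns into a plain ∂ and
  -- leaves a variable in front.
  E-x : ∀ i h → E i (x i * h) ≈ X i * D i h
  E-x zero    h = refl
  E-x (suc i) h = begin
    E i (π i (x (suc i) * h))                ≈⟨ ⟨ E-additive i ⟩cong shuffle ⟩
    E i (x i * (x (suc i) * ∂ i h))          ≈⟨ E-x i _ ⟩
    X i * D i (x (suc i) * ∂ i h)            ≈⟨ *-congˡ (D-x i (suc i) _ ℕₚ.≤-refl) ⟩
    X i * (x (suc i) * D i (∂ i h))          ≈⟨ *-assoc _ _ _ ⟨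
    X i * x (suc i) * D i (∂ i h) ∎
    where
    shuffle : π i (x (suc i) * h) ≈ x i * (x (suc i) * ∂ i h)
    shuffle = trans (+-congˡ (*-congˡ (∂-next i h)))
      (solve 4 (λ x y h d → y :* h :+ y :* (:- h :+ x :* d) := x :* (y :* d)) refl (x i) (x (suc i)) h (∂ i h))

  -- `Q j` is a left inverse of multiplication by x j, so variables cancel without an appeal to an
  -- integral domain.
  x-cancel : ∀ j f → x j * f ≈ 0# → f ≈ 0#
  x-cancel j f h = trans (sym (Q-same j f)) (homo-≈0 (Q-additive j) h)

  X-cancel : ∀ i f → X i * f ≈ 0# → f ≈ 0#
  X-cancel zero    f h = x-cancel 0 f h
  X-cancel (suc i) f h = x-cancel (suc i) f (X-cancel i _ (trans (sym (*-assoc _ _ _)) h))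

  -- For f = 𝔖_w this says that w m < w j whenever m < j ≤ k and ε m = 0.
  C : ℕ → (ℕ → ℕ) → Carrier → Set
  C zero    ε f = ⊤
  C (suc k) ε f = (ε k ≡ 0 → ∂ k f ≈ 0#) × C k ε f × C k ε (∂ k f)

  C-cong : ∀ k {ε f g} → f ≈ g → C k ε f → C k ε g
  C-cong zero    h _           = tt
  C-cong (suc k) h (z , c , d) = (λ e → trans (∂-cong k (sym h)) (z e)) , C-cong k h c , C-cong k (∂-cong k h) d

  C-0 : ∀ k {ε} → C k ε 0#
  C-0 zero    = tt
  C-0 (suc k) = (λ _ → homo-0 (∂-additive k)) , C-0 k , C-cong k (sym (homo-0 (∂-additive k))) (C-0 k)

  C-+ : ∀ k {ε f g} → C k ε f → C k ε g → C k ε (f + g)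
  C-+ zero    _ _ = tt
  C-+ (suc k) (z , c , d) (z′ , c′ , d′) = (λ e → trans (∂-+ k _ _) (trans (+-cong (z e) (z′ e)) (+-identityˡ 0#)))
    , C-+ k c c′ , C-cong k (sym (∂-+ k _ _)) (C-+ k d d′)

  -- Tails, multiplication by distant variables and the extraction of coefficients all preserve `C`
  -- for this one reason.
  C-map : ∀ {T} → Additive T → ∀ k {ε} → (∀ m f → m < k → ∂ m (T f) ≈ T (∂ m f)) → ∀ {f} → C k ε f → C k ε (T f)
  C-map aT zero    h _ = tt
  C-map aT (suc k) h (z , c , d) = (λ e → trans (h k _ ℕₚ.≤-refl) (homo-≈0 aT (z e)))
    , C-map aT k (λ m f m<k → h m f (ℕₚ.m<n⇒m<1+n m<k)) c
    , C-cong k (sym (h k _ ℕₚ.≤-refl)) (C-map aT k (λ m f m<k → h m f (ℕₚ.m<n⇒m<1+n m<k)) d)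

  C-down : ∀ i m {ε f} → C (i ℕ.+ m) ε f → C i ε f
  C-down i zero    {ε} {f} c = ≡.subst (λ n → C n ε f) (ℕₚ.+-identityʳ i) c
  C-down i (suc m) {ε} {f} c = C-down i m (proj₁ (proj₂ (≡.subst (λ n → C n ε f) (ℕₚ.+-suc i m) c)))

  -- Descends through ∂ i (tail (i+1) f) = tail (i+2) (∂ i f) + x (i+2) ∂ i (∂ (i+1) (tail (i+2) f)).
  C-tail : ∀ m i {ε f} → C (i ℕ.+ suc m) ε f →
    (ε i ≡ 0 → ∂ i (tail (suc i) m f) ≈ 0#) × C i ε (∂ i (tail (suc i) m f))
  C-tail zero    i {ε} {f} c with ≡.subst (λ n → C n ε f) (≡.trans (ℕₚ.+-suc i 0) (≡.cong suc (ℕₚ.+-identityʳ i))) c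
  ... | z , _ , d = z , d
  C-tail (suc m) i {ε} {f} c = (λ e → trans unfold (trans (+-cong (homo-≈0 (tail-additive (2 ℕ.+ i) m) (proj₁ base e))
                                   (trans (*-congˡ (proj₁ (proj₂ ih) e)) (zeroʳ _))) (+-identityˡ 0#)))
    , C-cong i (sym unfold) (C-+ i
        (C-map (tail-additive (2 ℕ.+ i) m) i (λ k g k<i → tail-∂-comm k (2 ℕ.+ i) m g (s≤s (ℕₚ.m<n⇒m<1+n k<i))) (proj₂ (proj₂ base)))
        (C-map (*-additive (x (2 ℕ.+ i))) i (λ k g k<i → ∂-far k (2 ℕ.+ i) g (far k k<i) (far′ k k<i)) (proj₂ (proj₂ (proj₂ ih)))))
    where
    far : ∀ k → k < i → 2 ℕ.+ i ≢ k
    far k k<i e = ℕₚ.<⇒≢ (ℕₚ.m<n⇒m<1+n (ℕₚ.m<n⇒m<1+n k<i)) (≡.sym e)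
    far′ : ∀ k → k < i → 2 ℕ.+ i ≢ suc k
    far′ k k<i e = ℕₚ.<⇒≢ (s≤s (ℕₚ.m<n⇒m<1+n k<i)) (≡.sym e)
    G = tail (2 ℕ.+ i) m f
    base : C (suc i) ε f
    base = C-down (suc i) (suc m) (≡.subst (λ n → C n ε f) (ℕₚ.+-suc i (suc m)) c)
    ih : (ε (suc i) ≡ 0 → ∂ (suc i) G ≈ 0#) × C (suc i) ε (∂ (suc i) G)
    ih = C-tail m (suc i) (≡.subst (λ n → C n ε f) (ℕₚ.+-suc i (suc m)) c)
    unfold : ∂ i (π (suc i) G) ≈ tail (2 ℕ.+ i) m (∂ i f) + x (2 ℕ.+ i) * ∂ i (∂ (suc i) G)
    unfold = trans (∂-+ i _ _) (+-cong (tail-∂-comm i (2 ℕ.+ i) m f ℕₚ.≤-refl)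
      (∂-far i (2 ℕ.+ i) _ (ℕₚ.<⇒≢ (ℕₚ.m<n⇒m<1+n ℕₚ.≤-refl) ∘ ≡.sym) (ℕₚ.<⇒≢ ℕₚ.≤-refl ∘ ≡.sym)))

  -- Powers of a variable under D: vanishing and the critical case

  x^ : ℕ → ℕ → Carrier → Carrier
  x^ k zero    f = f
  x^ k (suc d) f = x k * x^ k d f

  x^-additive : ∀ k d → Additive (x^ k d)
  x^-additive k zero    = id-additive
  x^-additive k (suc d) = ∘-additive (*-additive (x k)) (x^-additive k d)

  x^-suc : ∀ k d f → x^ k d (x k * f) ≈ x^ k (suc d) f
  x^-suc k zero    f = refl
  x^-suc k (suc d) f = *-congˡ (x^-suc k d f)

  x^-x : ∀ k d j f → x^ k d (x j * f) ≈ x j * x^ k d f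
  x^-x k zero    j f = refl
  x^-x k (suc d) j f = trans (*-congˡ (x^-x k d j f))
    (solve 3 (λ a b c → a :* (b :* c) := b :* (a :* c)) refl (x k) (x j) (x^ k d f))

  D-x^ : ∀ k s d h → D k (x^ k s (x^ (suc k) d h)) ≈ x^ (suc k) d (D k (x^ k s h))
  D-x^ k s zero    h = refl
  D-x^ k s (suc d) h = trans (⟨ D-additive k ⟩cong (x^-x k s (suc k) _))
    (trans (D-x k (suc k) _ ℕₚ.≤-refl) (*-congˡ (D-x^ k s d h)))

  -- The terms of ∂ k (x (k+1)^d h) = x k^d ∂ k h - ∑ x k^e x (k+1)^(d-1-e) h with e < d - 1 are killed by D k.
  D-∂-top : ∀ k d s h → (∀ e → s ≤ e → e < s ℕ.+ d → D k (x^ k e h) ≈ 0#) →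
    D k (x^ k s (∂ k (x^ (suc k) (suc d) h))) ≈ D k (x^ k (s ℕ.+ suc d) (∂ k h)) - D k (x^ k (s ℕ.+ d) h)
  D-∂-top k d s h v = trans peel (finish d v)
    where
    H = x^ (suc k) d h
    Dx = ∘-additive (D-additive k) (x^-additive k s)
    peel : D k (x^ k s (∂ k (x^ (suc k) (suc d) h))) ≈ - x^ (suc k) d (D k (x^ k s h)) + D k (x^ k (suc s) (∂ k H))
    peel = begin
      D k (x^ k s (∂ k (x (suc k) * H)))               ≈⟨ ⟨ Dx ⟩cong (∂-next k H) ⟩
      D k (x^ k s (- H + x k * ∂ k H))                 ≈⟨ homo-+ Dx _ _ ⟩
      D k (x^ k s (- H)) + D k (x^ k s (x k * ∂ k H))  ≈⟨ +-cong (trans (homo-neg Dx H) (-‿cong (D-x^ k s d h))) (⟨ D-additive k ⟩cong (x^-suc k s _)) ⟩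
      - x^ (suc k) d (D k (x^ k s h)) + D k (x^ k (suc s) (∂ k H)) ∎
    finish : ∀ d → (∀ e → s ≤ e → e < s ℕ.+ d → D k (x^ k e h) ≈ 0#) →
      - x^ (suc k) d (D k (x^ k s h)) + D k (x^ k (suc s) (∂ k (x^ (suc k) d h)))
      ≈ D k (x^ k (s ℕ.+ suc d) (∂ k h)) - D k (x^ k (s ℕ.+ d) h)
    finish zero    v rewrite ℕₚ.+-identityʳ s | ℕₚ.+-comm s 1 = +-comm _ _
    finish (suc d) v = begin
      - x^ (suc k) (suc d) (D k (x^ k s h)) + D k (x^ k (suc s) (∂ k (x^ (suc k) (suc d) h)))
        ≈⟨ +-cong (trans (-‿cong (homo-≈0 (x^-additive (suc k) (suc d)) (v s ℕₚ.≤-refl (ℕₚ.m<m+n s (s≤s z≤n))))) neg0) (D-∂-top k d (suc s) h v′) ⟩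
      0# + (D k (x^ k (suc s ℕ.+ suc d) (∂ k h)) - D k (x^ k (suc s ℕ.+ d) h)) ≈⟨ +-identityˡ _ ⟩
      D k (x^ k (suc s ℕ.+ suc d) (∂ k h)) - D k (x^ k (suc s ℕ.+ d) h)
        ≡⟨ ≡.cong₂ (λ a b → D k (x^ k a (∂ k h)) - D k (x^ k b h)) (≡.sym (ℕₚ.+-suc s (suc d))) (≡.sym (ℕₚ.+-suc s d)) ⟩
      D k (x^ k (s ℕ.+ suc (suc d)) (∂ k h)) - D k (x^ k (s ℕ.+ suc d) h) ∎
      where
      neg0 : - 0# ≈ 0#
      neg0 = trans (sym (+-identityˡ _)) (-‿inverseʳ 0#)
      v′ : ∀ e → suc s ≤ e → e < suc s ℕ.+ d → D k (x^ k e h) ≈ 0#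
      v′ e s<e e< = v e (ℕₚ.<⇒≤ s<e) (≡.subst (e <_) (≡.sym (ℕₚ.+-suc s d)) e<)

  -- One hypothesis more than in `D-∂-top` with s = 0: the power d - 1, which survives there with a
  -- minus sign, is killed as well.
  D-∂-vanish : ∀ k d h → (∀ e → e < d → D k (x^ k e h) ≈ 0#) → D k (∂ k (x^ (suc k) d h)) ≈ D k (x^ k d (∂ k h))
  D-∂-vanish k zero    h v = refl
  D-∂-vanish k (suc d) h v = trans (D-∂-top k d 0 h (λ e _ e<d → v e (ℕₚ.m<n⇒m<1+n e<d)))
    (trans (+-congˡ (trans (-‿cong (trans (v d ℕₚ.≤-refl) (sym const-0))) (solve 0 (:- con 0ℤ := con 0ℤ) refl)))
      (trans (+-congˡ const-0) (+-identityʳ _)))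

  D-x^-∂-* : ∀ k d a b → D k (x^ k d (∂ k (a * b))) ≈ D k (x^ k d (∂ k a * b)) + D k (x^ k d (a * ∂ k b))
    - (D k (x^ k (suc d) (∂ k a * ∂ k b)) - x (suc k) * D k (x^ k d (∂ k a * ∂ k b)))
  D-x^-∂-* k d a b = begin
    D k (x^ k d (∂ k (a * b)))   ≈⟨ ⟨ Dx ⟩cong (∂-* k a b) ⟩
    D k (x^ k d (∂ k a * b + a * ∂ k b - (x k - x (suc k)) * p)) ≈⟨ trans (homo-- Dx _ _) (+-congʳ (homo-+ Dx _ _)) ⟩
    D k (x^ k d (∂ k a * b)) + D k (x^ k d (a * ∂ k b)) - D k (x^ k d ((x k - x (suc k)) * p))
      ≈⟨ +-congˡ (-‿cong (begin
           D k (x^ k d ((x k - x (suc k)) * p)) ≈⟨ ⟨ Dx ⟩cong (solve 3 (λ a b c → (a :- b) :* c := a :* c :- b :* c) refl (x k) (x (suc k)) p) ⟩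
           D k (x^ k d (x k * p - x (suc k) * p)) ≈⟨ homo-- Dx _ _ ⟩
           D k (x^ k d (x k * p)) - D k (x^ k d (x (suc k) * p))
             ≈⟨ +-cong (⟨ D-additive k ⟩cong (x^-suc k d p)) (-‿cong (trans (⟨ D-additive k ⟩cong (x^-x k d (suc k) p)) (D-x k (suc k) _ ℕₚ.≤-refl))) ⟩
           D k (x^ k (suc d) p) - x (suc k) * D k (x^ k d p) ∎)) ⟩
    _ ∎
    where
    Dx = ∘-additive (D-additive k) (x^-additive k d)
    p = ∂ k a * ∂ k b

  *≈0ˡ : ∀ {a b} → a ≈ 0# → a * b ≈ 0#
  *≈0ˡ h = trans (*-congʳ h) (zeroˡ _)

  *≈0ʳ : ∀ {a b} → b ≈ 0# → a * b ≈ 0#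
  *≈0ʳ h = trans (*-congˡ h) (zeroʳ _)

  pick : ℕ → Carrier → Carrier → Carrier
  pick zero    d f = f
  pick (suc _) d f = d

  -- The composite ∂ 0 ⋯ ∂ (k-1) with the factors at η m = 0 left out; larger indices act first.
  Ds : ℕ → (ℕ → ℕ) → Carrier → Carrier
  Ds zero    η f = f
  Ds (suc k) η f = Ds k η (pick (η k) (∂ k f) f)

  infix 4 _≈±_
  -- In the critical case only nonvanishing matters, so the sign is not tracked.
  _≈±_ : Carrier → Carrier → Set
  f ≈± g = f ≈ g ⊎ f ≈ - g

  ≈±-trans : ∀ {f g h} → f ≈ g → g ≈± h → f ≈± h
  ≈±-trans e (inj₁ e′) = inj₁ (trans e e′)
  ≈±-trans e (inj₂ e′) = inj₂ (trans e e′)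

  ≈±-neg : ∀ {f g h} → f ≈ - g → g ≈± h → f ≈± h
  ≈±-neg e (inj₁ e′) = inj₂ (trans e (-‿cong e′))
  ≈±-neg e (inj₂ e′) = inj₁ (trans e (trans (-‿cong e′) (solve 1 (λ a → :- (:- a) := a) refl _)))

  module _ (ε δ : ℕ → ℕ) (ε₀₁ : Binary ε) (δ₀₁ : Binary δ) where

    private
      Λ : ℕ → ℕ
      Λ = total ε δ

    -- A budget argument: passing from k + 1 to k, the indicators at k release `ε k + δ k` units. A
    -- derivative of a or b takes one unit and survives only where its indicator is 1; the Leibniz
    -- term with both derivatives and an extra x k takes two.
    D-vanish : ∀ k d {a b} → C k ε a → C k δ b → d ℕ.+ Λ k < k → D k (x^ k d (a * b)) ≈ 0#
    D-vanish (suc k) d {a} {b} (za , ca , da) (zb , cb , db) h = begin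
      D k (∂ k (x^ (suc k) d (a * b)))    ≈⟨ D-∂-vanish k d (a * b) lower ⟩
      D k (x^ k d (∂ k (a * b)))          ≈⟨ D-x^-∂-* k d a b ⟩
      _ ≈⟨ +-cong (+-cong t₁ t₂) (-‿cong (+-cong t₃ (-‿cong (trans (*-congˡ t₄) (zeroʳ _))))) ⟩
      0# + 0# - (0# - 0#)                 ≈⟨ solve 1 (λ z → z :+ z :- (z :- z) := z :+ z) refl 0# ⟩
      0# + 0#                             ≈⟨ +-identityˡ 0# ⟩
      0# ∎
      where
      Dx : ∀ d → Additive (λ f → D k (x^ k d f))
      Dx d = ∘-additive (D-additive k) (x^-additive k d)
      h′ : d ℕ.+ Λ k ℕ.+ (ε k ℕ.+ δ k) < suc k
      h′ = ≡.subst (_< suc k) (≡.sym (ℕₚ.+-assoc d (Λ k) _)) h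
      room : ∀ {c} → c ≤ ε k ℕ.+ δ k → c ℕ.+ (d ℕ.+ Λ k) ≤ k
      room {c} c≤ = ℕ.s≤s⁻¹ (ℕₚ.≤-<-trans (≡.subst (_≤ d ℕ.+ Λ k ℕ.+ (ε k ℕ.+ δ k)) (ℕₚ.+-comm _ c) (ℕₚ.+-monoʳ-≤ (d ℕ.+ Λ k) c≤)) h′)
      lower : ∀ e → e < d → D k (x^ k e (a * b)) ≈ 0#
      lower e e<d = D-vanish k e ca cb (ℕₚ.<-≤-trans (ℕₚ.+-monoˡ-< (Λ k) e<d) (room z≤n))
      t₁ : D k (x^ k d (∂ k a * b)) ≈ 0#
      t₁ with ε₀₁ k
      ... | inj₁ e = homo-≈0 (Dx d) (*≈0ˡ (za e))
      ... | inj₂ e = D-vanish k d da cb (room (ℕₚ.≤-trans (ℕₚ.≤-reflexive (≡.sym e)) (ℕₚ.m≤m+n _ _)))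
      t₂ : D k (x^ k d (a * ∂ k b)) ≈ 0#
      t₂ with δ₀₁ k
      ... | inj₁ e = homo-≈0 (Dx d) (*≈0ʳ (zb e))
      ... | inj₂ e = D-vanish k d ca db (room (ℕₚ.≤-trans (ℕₚ.≤-reflexive (≡.sym e)) (ℕₚ.m≤n+m _ (ε k))))
      t₃ : D k (x^ k (suc d) (∂ k a * ∂ k b)) ≈ 0#
      t₃ with ε₀₁ k | δ₀₁ k
      ... | inj₁ e | _      = homo-≈0 (Dx (suc d)) (*≈0ˡ (za e))
      ... | inj₂ _ | inj₁ e = homo-≈0 (Dx (suc d)) (*≈0ʳ (zb e))
      ... | inj₂ e | inj₂ e′ = D-vanish k (suc d) da db (room (ℕₚ.≤-reflexive (≡.cong₂ ℕ._+_ (≡.sym e) (≡.sym e′))))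
      t₄ : D k (x^ k d (∂ k a * ∂ k b)) ≈ 0#
      t₄ with ε₀₁ k
      ... | inj₁ e = homo-≈0 (Dx d) (*≈0ˡ (za e))
      ... | inj₂ e = D-vanish k d da db (room (ℕₚ.≤-trans (ℕₚ.≤-reflexive (≡.sym e)) (ℕₚ.m≤m+n _ _)))

    -- The error is X i x (i+1) D i (∂ i F ∂ i G). If both indicators at i are 1, the bound at i + 1
    -- reads Λ i + 2 ≤ i + 1, and `D-vanish` applies with d = 0; otherwise one factor is already
    -- zero by `C-tail`.
    tail-step : ∀ i m f g → C (i ℕ.+ suc m) ε f → C (i ℕ.+ suc m) δ g → Λ (suc i) ≤ suc i →
      E i (tail i (suc m) f * tail i (suc m) g) ≈ E (suc i) (tail (suc i) m f * tail (suc i) m g)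
    tail-step i m f g cf cg bound = begin
      E i (π i F * π i G)                                        ≈⟨ ⟨ E-additive i ⟩cong (π-* i F G) ⟩
      E i (π i (F * G) + x i * (x (suc i) * (∂ i F * ∂ i G)))    ≈⟨ homo-+ (E-additive i) _ _ ⟩
      E i (π i (F * G)) + E i (x i * (x (suc i) * (∂ i F * ∂ i G))) ≈⟨ +-congˡ (trans (E-x i _)
                                                                       (*≈0ʳ (trans (D-x i (suc i) _ ℕₚ.≤-refl) (*≈0ʳ vanish)))) ⟩
      E (suc i) (F * G) + 0#                                     ≈⟨ +-identityʳ _ ⟩
      E (suc i) (F * G) ∎
      where
      F = tail (suc i) m f
      G = tail (suc i) m g
      vanish : D i (∂ i F * ∂ i G) ≈ 0#
      vanish with ε₀₁ i | δ₀₁ i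
      ... | inj₁ e | _      = homo-≈0 (D-additive i) (*≈0ˡ (proj₁ (C-tail m i cf) e))
      ... | inj₂ _ | inj₁ e = homo-≈0 (D-additive i) (*≈0ʳ (proj₁ (C-tail m i cg) e))
      ... | inj₂ e | inj₂ e′ = D-vanish i 0 (proj₂ (C-tail m i cf)) (proj₂ (C-tail m i cg))
            (ℕ.s≤s⁻¹ (≡.subst (_≤ suc i) (≡.trans (≡.cong₂ (λ p q → Λ i ℕ.+ (p ℕ.+ q)) e e′) (ℕₚ.+-comm (Λ i) 2)) bound))

    tail-chain : ∀ n i m f g → i ℕ.+ m ≡ n → C n ε f → C n δ g → (∀ j → j ≤ i → Λ j ≤ j) →
      E n f * E n g ≈ E i (tail i m f * tail i m g)
    tail-chain n zero    m f g ≡.refl cf cg _ = *-cong (reflexive (≡.sym (E-tail 0 m f))) (reflexive (≡.sym (E-tail 0 m g)))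
    tail-chain n (suc i) m f g eq cf cg bound =
      trans (tail-chain n i (suc m) f g eq′ cf cg (λ j j≤i → bound j (ℕₚ.m≤n⇒m≤1+n j≤i)))
        (tail-step i m f g (≡.subst (λ k → C k ε f) (≡.sym eq′) cf) (≡.subst (λ k → C k δ g) (≡.sym eq′) cg) (bound (suc i) ℕₚ.≤-refl))
      where
      eq′ : i ℕ.+ suc m ≡ n
      eq′ = ≡.trans (ℕₚ.+-suc i m) eq

    E-multiplicative : ∀ n f g → C n ε f → C n δ g → (∀ j → j ≤ n → Λ j ≤ j) → E n f * E n g ≈ E n (f * g)
    E-multiplicative n f g = tail-chain n n 0 f g (ℕₚ.+-identityʳ n)

    -- The budget of `D-vanish` is exactly used up, so one term survives at each k. Both indicators
    -- 0: ∂ k (a b) = 0 and the last correction term of `D-∂-top` remains, with one power less. One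
    -- of them 1: the term differentiating that factor. Both 1: the term x k ∂ k a ∂ k b, with a
    -- minus sign.
    D-top : ∀ k d {a b} → C k ε a → C k δ b → d ℕ.+ Λ k ≡ k → (∀ j → j ≤ k → Λ j ≤ j) →
      D k (x^ k d (a * b)) ≈± Ds k ε a * Ds k δ b
    D-top zero    zero _ _ _ _ = inj₁ refl
    D-top (suc k) d {a} {b} (za , ca , da) (zb , cb , db) h bound = cases (ε₀₁ k) (δ₀₁ k)
      where
      Dx : ∀ d → Additive (λ f → D k (x^ k d f))
      Dx d = ∘-additive (D-additive k) (x^-additive k d)
      bound′ : ∀ j → j ≤ k → Λ j ≤ j
      bound′ j j≤k = bound j (ℕₚ.m≤n⇒m≤1+n j≤k)
      sum-at : ∀ {p q} → ε k ≡ p → δ k ≡ q → p ℕ.+ q ℕ.+ (d ℕ.+ Λ k) ≡ suc k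
      sum-at e e′ = ≡.trans (≡.cong₂ (λ p q → p ℕ.+ q ℕ.+ (d ℕ.+ Λ k)) (≡.sym e) (≡.sym e′))
        (≡.trans (ℕₚ.+-comm (ε k ℕ.+ δ k) _) (≡.trans (ℕₚ.+-assoc d (Λ k) _) h))
      lower : d ℕ.+ Λ k ≤ k → ∀ e → e < d → D k (x^ k e (a * b)) ≈ 0#
      lower room e e<d = D-vanish k e ca cb (ℕₚ.<-≤-trans (ℕₚ.+-monoˡ-< (Λ k) e<d) room)
      z : ∀ {f} → f ≈ 0# → f ≈ const 0ℤ
      z h = trans h (sym const-0)
      Result : ℕ → ℕ → Set
      Result p q = D k (∂ k (x^ (suc k) d (a * b))) ≈± Ds k ε (pick p (∂ k a) a) * Ds k δ (pick q (∂ k b) b)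
      cases : ε k ≡ 0 ⊎ ε k ≡ 1 → δ k ≡ 0 ⊎ δ k ≡ 1 → Result (ε k) (δ k)
      cases (inj₁ e) (inj₁ e′) = ≡.subst₂ Result (≡.sym e) (≡.sym e′) (drop d (sum-at e e′))
        where
        drop : ∀ d → d ℕ.+ Λ k ≡ suc k → D k (∂ k (x^ (suc k) d (a * b))) ≈± Ds k ε a * Ds k δ b
        -- With d = 0 the equation would read Λ k = k + 1, against the bound at k.
        drop zero    h = ⊥-elim (ℕₚ.<⇒≱ ℕₚ.≤-refl (≡.subst (_≤ k) h (bound′ k ℕₚ.≤-refl)))
        drop (suc d) h = ≈±-neg (begin
          D k (∂ k (x^ (suc k) (suc d) (a * b))) ≈⟨ D-∂-top k d 0 (a * b) (λ e _ e<d → D-vanish k e ca cb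
                                                      (≡.subst (e ℕ.+ Λ k <_) (ℕₚ.suc-injective h) (ℕₚ.+-monoˡ-< (Λ k) e<d))) ⟩
          D k (x^ k (suc d) (∂ k (a * b))) - D k (x^ k d (a * b)) ≈⟨ +-congʳ (homo-≈0 (Dx (suc d)) flat) ⟩
          0# - D k (x^ k d (a * b)) ≈⟨ +-identityˡ _ ⟩
          - D k (x^ k d (a * b)) ∎)
          (D-top k d ca cb (ℕₚ.suc-injective h) bound′)
          where
          flat : ∂ k (a * b) ≈ 0#
          flat = trans (∂-* k a b) (trans (+-cong (+-cong (*-congʳ (z (za e))) (*-congˡ (z (zb e′)))) (-‿cong (*-congˡ (*-congʳ (z (za e))))))
            (≈0 (solve 4 (λ a b c d → con 0ℤ :* b :+ a :* con 0ℤ :- c :* (con 0ℤ :* d) := con 0ℤ) refl a b (x k - x (suc k)) (∂ k b))))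
      cases (inj₂ e) (inj₁ e′) = ≡.subst₂ Result (≡.sym e) (≡.sym e′) (≈±-trans (trans (D-∂-vanish k d (a * b) (lower (ℕₚ.≤-reflexive h′))) (begin
          D k (x^ k d (∂ k (a * b))) ≈⟨ D-x^-∂-* k d a b ⟩
          _ ≈⟨ +-cong (+-congˡ (z (homo-≈0 (Dx d) (*≈0ʳ (zb e′))))) (-‿cong (+-cong (z (homo-≈0 (Dx (suc d)) (*≈0ʳ (zb e′))))
                 (-‿cong (*-congˡ (z (homo-≈0 (Dx d) (*≈0ʳ (zb e′)))))))) ⟩
          _ ≈⟨ solve 2 (λ t y → t :+ con 0ℤ :- (con 0ℤ :- y :* con 0ℤ) := t) refl _ (x (suc k)) ⟩
          D k (x^ k d (∂ k a * b)) ∎)) (D-top k d da cb h′ bound′))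
        where h′ = ℕₚ.suc-injective (sum-at e e′)
      cases (inj₁ e) (inj₂ e′) = ≡.subst₂ Result (≡.sym e) (≡.sym e′) (≈±-trans (trans (D-∂-vanish k d (a * b) (lower (ℕₚ.≤-reflexive h′))) (begin
          D k (x^ k d (∂ k (a * b))) ≈⟨ D-x^-∂-* k d a b ⟩
          _ ≈⟨ +-cong (+-congʳ (z (homo-≈0 (Dx d) (*≈0ˡ (za e))))) (-‿cong (+-cong (z (homo-≈0 (Dx (suc d)) (*≈0ˡ (za e))))
                 (-‿cong (*-congˡ (z (homo-≈0 (Dx d) (*≈0ˡ (za e)))))))) ⟩
          _ ≈⟨ solve 2 (λ t y → con 0ℤ :+ t :- (con 0ℤ :- y :* con 0ℤ) := t) refl _ (x (suc k)) ⟩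
          D k (x^ k d (a * ∂ k b)) ∎)) (D-top k d ca db h′ bound′))
        where h′ = ℕₚ.suc-injective (sum-at e e′)
      cases (inj₂ e) (inj₂ e′) = ≡.subst₂ Result (≡.sym e) (≡.sym e′) (≈±-neg (trans (D-∂-vanish k d (a * b) (lower (ℕₚ.<⇒≤ h″))) (begin
          D k (x^ k d (∂ k (a * b))) ≈⟨ D-x^-∂-* k d a b ⟩
          _ ≈⟨ +-cong (+-cong (z (D-vanish k d da cb h″)) (z (D-vanish k d ca db h″))) (-‿cong (+-congˡ (-‿cong (*-congˡ (z (D-vanish k d da db h″)))))) ⟩
          _ ≈⟨ solve 2 (λ t y → con 0ℤ :+ con 0ℤ :- (t :- y :* con 0ℤ) := :- t) refl _ (x (suc k)) ⟩
          - D k (x^ k (suc d) (∂ k a * ∂ k b)) ∎)) (D-top k (suc d) da db h′ bound′))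
        where
        h′ : suc d ℕ.+ Λ k ≡ k
        h′ = ℕₚ.suc-injective (sum-at e e′)
        h″ : d ℕ.+ Λ k < k
        h″ = ℕₚ.≤-reflexive h′

  -- Leading coefficients in one variable and their iteration

  Free : ℕ → Carrier → Set
  Free n f = ∀ m → n ≤ m → Q m f ≈ 0#

  Free-* : ∀ n {f g} → Free n f → Free n g → Free n (f * g)
  Free-* n {f} {g} hf hg m n≤m = trans (Q-* m f g) (trans (+-cong (*≈0ˡ (hf m n≤m)) (*≈0ʳ (hg m n≤m))) (+-identityˡ 0#))

  Free-mono : ∀ {m n f} → m ≤ n → Free m f → Free n f
  Free-mono m≤n h k n≤k = h k (ℕₚ.≤-trans m≤n n≤k)

  -- For general f the correction terms are obtained by writing f = f|_{x (n+1) = 0} + x (n+1) Q (n+1) f.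
  ∂-via-Q : ∀ n f → ∂ n f ≈ π n (Q n f - x (suc n) * Q n (Q (suc n) f)) + (x n * ∂ n (Q (suc n) f) - Q (suc n) f)
  ∂-via-Q n f = additive-ext (∂-additive n) RHS-additive base step f
    where
    n′ = suc n
    n≢n′ : n ≢ n′
    n≢n′ = ℕₚ.<⇒≢ ℕₚ.≤-refl
    negated : ∀ {T} → Additive T → Additive (λ f → - T f)
    negated {T} aT = record { ⟨_⟩cong = λ h → -‿cong (⟨ aT ⟩cong h)
      ; homo-+ = λ f g → trans (-‿cong (homo-+ aT f g)) (solve 2 (λ a b → :- (a :+ b) := :- a :+ :- b) refl (T f) (T g)) }
    RHS : Carrier → Carrier
    RHS f = π n (Q n f - x n′ * Q n (Q n′ f)) + (x n * ∂ n (Q n′ f) - Q n′ f)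
    RHS-additive : Additive RHS
    RHS-additive = +-additive
      (∘-additive (π-additive n) (+-additive (Q-additive n) (negated (∘-additive (*-additive (x n′)) (∘-additive (Q-additive n) (Q-additive n′))))))
      (+-additive (∘-additive (*-additive (x n)) (∘-additive (∂-additive n) (Q-additive n′))) (negated (Q-additive n′)))
    vanish : ∀ f → Q n f ≈ 0# → Q n′ f ≈ 0# → RHS f ≈ 0#
    vanish f h h′ = begin
      RHS f ≈⟨ +-cong (homo-≈0 (π-additive n) (trans (+-cong h (-‿cong (*≈0ʳ (homo-≈0 (Q-additive n) h′)))) (-‿inverseʳ 0#)))
                      (+-cong (*≈0ʳ (homo-≈0 (∂-additive n) h′)) (-‿cong h′)) ⟩
      0# + (0# - 0#) ≈⟨ trans (+-identityˡ _) (-‿inverseʳ 0#) ⟩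
      0# ∎
    base : ∀ c → ∂ n (const c) ≈ RHS (const c)
    base c = trans (∂-const n c) (sym (vanish (const c) (Q-const n c) (Q-const n′ c)))
    step : ∀ j f → ∂ n f ≈ RHS f → ∂ n (x j * f) ≈ RHS (x j * f)
    step j f e with j ℕ.≟ n | j ℕ.≟ n′
    ... | yes ≡.refl | _ = begin
      ∂ n (x n * f)   ≈⟨ ∂-same n f ⟩
      f + x n′ * ∂ n f ≈⟨ solve 6 (λ f g q d x y → f :+ y :* g
                            := (f :- y :* q :+ y :* (g :- (:- q :+ x :* d))) :+ (x :* (q :+ y :* d) :- x :* q)) refl f (∂ n f) q (∂ n q) (x n) (x n′) ⟩
      (f - x n′ * q + x n′ * (∂ n f - (- q + x n * ∂ n q))) + (x n * (q + x n′ * ∂ n q) - x n * q)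
        ≈⟨ +-cong (+-congˡ (*-congˡ (trans (+-congˡ (-‿cong (sym (∂-next n q)))) (sym (homo-- (∂-additive n) f _)))))
                  (+-congʳ (*-congˡ (sym (∂-same n q)))) ⟩
      π n (f - x n′ * q) + (x n * ∂ n (x n * q) - x n * q)
        ≈⟨ +-cong (⟨ π-additive n ⟩cong (+-cong (sym (Q-same n f)) (-‿cong (*-congˡ (trans (sym (Q-same n q)) (Q-cong n Q′)))))) (+-cong (*-congˡ (∂-cong n Q′)) (-‿cong Q′)) ⟩
      RHS (x n * f) ∎
      where
      q = Q n′ f
      Q′ : x n * q ≈ Q n′ (x n * f)
      Q′ = sym (Q-diff n′ n f n≢n′)
    ... | no _ | yes ≡.refl = begin
      ∂ n (x n′ * f)         ≈⟨ ∂-next n f ⟩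
      - f + x n * ∂ n f      ≈⟨ solve 2 (λ f d → :- f :+ d := con 0ℤ :+ (d :- f)) refl f (x n * ∂ n f) ⟩
      const 0ℤ + (x n * ∂ n f - f) ≈⟨ +-cong (trans const-0 (sym (homo-≈0 (π-additive n) zero′))) (+-cong (*-congˡ (∂-cong n (sym (Q-same n′ f)))) (-‿cong (sym (Q-same n′ f)))) ⟩
      RHS (x n′ * f) ∎
      where
      zero′ : Q n (x n′ * f) - x n′ * Q n (Q n′ (x n′ * f)) ≈ 0#
      zero′ = trans (+-cong (Q-diff n n′ f (n≢n′ ∘ ≡.sym)) (-‿cong (*-congˡ (Q-cong n (Q-same n′ f))))) (-‿inverseʳ _)
    ... | no j≢n | no j≢n′ = begin
      ∂ n (x j * f)      ≈⟨ ∂-far n j f j≢n j≢n′ ⟩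
      x j * ∂ n f        ≈⟨ *-congˡ e ⟩
      x j * RHS f        ≈⟨ distribˡ (x j) _ _ ⟩
      x j * π n A + x j * (x n * ∂ n (Q n′ f) - Q n′ f)
        ≈⟨ +-cong (solve 4 (λ z a y e → z :* (a :+ y :* e) := z :* a :+ y :* (z :* e)) refl (x j) A (x n′) (∂ n A))
                  (solve 4 (λ z x d p → z :* (x :* d :- p) := x :* (z :* d) :- z :* p) refl (x j) (x n) (∂ n (Q n′ f)) (Q n′ f)) ⟩
      (x j * A + x n′ * (x j * ∂ n A)) + (x n * (x j * ∂ n (Q n′ f)) - x j * Q n′ f)
        ≈⟨ +-cong (+-congˡ (*-congˡ (sym (∂-far n j A j≢n j≢n′)))) (+-congʳ (*-congˡ (sym (∂-far n j _ j≢n j≢n′)))) ⟩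
      π n (x j * A) + (x n * ∂ n (x j * Q n′ f) - x j * Q n′ f)
        ≈⟨ +-cong (⟨ π-additive n ⟩cong inner) (+-cong (*-congˡ (∂-cong n (sym (Q-diff n′ j f j≢n′)))) (-‿cong (sym (Q-diff n′ j f j≢n′)))) ⟩
      RHS (x j * f) ∎
      where
      A = Q n f - x n′ * Q n (Q n′ f)
      inner : x j * A ≈ Q n (x j * f) - x n′ * Q n (Q n′ (x j * f))
      inner = begin
        x j * A ≈⟨ solve 4 (λ z a y c → z :* (a :- y :* c) := z :* a :- y :* (z :* c)) refl (x j) (Q n f) (x n′) (Q n (Q n′ f)) ⟩
        x j * Q n f - x n′ * (x j * Q n (Q n′ f))
          ≈⟨ +-cong (sym (Q-diff n j f j≢n)) (-‿cong (*-congˡ (trans (sym (Q-diff n j _ j≢n)) (Q-cong n (sym (Q-diff n′ j f j≢n′)))))) ⟩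
        _ ∎

  -- In f = f₀ + x n Q n f the part f₀ involves neither x n nor x (n+1) and is killed, while ∂ n (x
  -- n g) = π n g. The induction `ind` cannot be confined to polynomials without x (n+1), hence the
  -- detour through the unrestricted `∂-via-Q`.
  ∂-Q : ∀ n f → Q (suc n) f ≈ 0# → ∂ n f ≈ π n (Q n f)
  ∂-Q n f h = begin
    ∂ n f ≈⟨ ∂-via-Q n f ⟩
    _ ≈⟨ +-cong (⟨ π-additive n ⟩cong (+-congˡ (-‿cong (*≈0ʳ (homo-≈0 (Q-additive n) h))))) (+-cong (*≈0ʳ (homo-≈0 (∂-additive n) h)) (-‿cong h)) ⟩
    π n (Q n f - 0#) + (0# - 0#) ≈⟨ +-cong (⟨ π-additive n ⟩cong minus0) (-‿inverseʳ 0#) ⟩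
    π n (Q n f) + 0# ≈⟨ +-identityʳ _ ⟩
    π n (Q n f) ∎
    where
    minus0 : ∀ {a} → a - 0# ≈ a
    minus0 = trans (+-congˡ (trans (sym (+-identityˡ _)) (-‿inverseʳ 0#))) (+-identityʳ _)

  ∂-free : ∀ n f → Q n f ≈ 0# → Q (suc n) f ≈ 0# → ∂ n f ≈ 0#
  ∂-free n f h h′ = trans (∂-Q n f h′) (homo-≈0 (π-additive n) h)

  π-free : ∀ n f → Q n f ≈ 0# → Q (suc n) f ≈ 0# → π n f ≈ f
  π-free n f h h′ = trans (+-congˡ (*≈0ʳ (∂-free n f h h′))) (+-identityʳ f)

  Q-π : ∀ n f → Q (suc n) f ≈ 0# → Q (suc n) (π n f) ≈ ∂ n f
  Q-π n f h = trans (Q-+ (suc n) f _) (trans (+-cong h (Q-same (suc n) _)) (+-identityˡ _))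

  -- For f without x (n+1) the quotient of `π n f` by x (n+1) is ∂ n f. It vanishes with `π n f`,
  -- and then π n f = f.
  π-injective : ∀ n f → Q (suc n) f ≈ 0# → π n f ≈ 0# → f ≈ 0#
  π-injective n f h e = begin
    f            ≈⟨ +-identityʳ f ⟨
    f + 0#       ≈⟨ +-congˡ (*≈0ʳ (trans (sym (Q-π n f h)) (homo-≈0 (Q-additive (suc n)) e))) ⟨
    π n f        ≈⟨ e ⟩
    0# ∎

  Q^ : ℕ → ℕ → Carrier → Carrier
  Q^ n zero    f = f
  Q^ n (suc b) f = Q^ n b (Q n f)

  Q^-additive : ∀ n b → Additive (Q^ n b)
  Q^-additive n zero    = id-additive
  Q^-additive n (suc b) = ∘-additive (Q^-additive n b) (Q-additive n)

  Q^-comm : ∀ {T} → Additive T → ∀ n → (∀ f → T (Q n f) ≈ Q n (T f)) → ∀ b f → T (Q^ n b f) ≈ Q^ n b (T f)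
  Q^-comm aT n h zero    f = refl
  Q^-comm aT n h (suc b) f = trans (Q^-comm aT n h b (Q n f)) (⟨ Q^-additive n b ⟩cong (h f))

  -- LT n b f a: f has degree ≤ b in x n, and a is its coefficient at x n ^ b.
  LT : ℕ → ℕ → Carrier → Carrier → Set
  LT n b f a = Q^ n b f ≈ a × Q^ n (suc b) f ≈ 0#

  LT-map : ∀ {T} → Additive T → ∀ n → (∀ f → T (Q n f) ≈ Q n (T f)) → ∀ b {f a} → LT n b f a → LT n b (T f) (T a)
  LT-map aT n h b (e , z) = trans (sym (Q^-comm aT n h b _)) (⟨ aT ⟩cong e)
    , trans (sym (Q^-comm aT n h (suc b) _)) (homo-≈0 aT z)

  LT-free : ∀ n b {f a} → LT n b f a → Q n a ≈ 0#
  LT-free n b {f} (e , z) = trans (Q-cong n (sym e)) (trans (Q^-comm (Q-additive n) n (λ _ → refl) b f) z)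

  LT-Free : ∀ n b {f a} → LT n b f a → Free (suc n) f → Free n a
  LT-Free n b {f} {a} lt free m n≤m with m ℕ.≟ n
  ... | yes ≡.refl = LT-free n b lt
  ... | no m≢n = trans (Q-cong m (sym (proj₁ lt))) (trans (Q^-comm (Q-additive m) n (Q-comm m n) b f)
          (homo-≈0 (Q^-additive n b) (free m (ℕₚ.≤∧≢⇒< n≤m (m≢n ∘ ≡.sym)))))

  Q^-free* : ∀ n b f g → Q n f ≈ 0# → Q^ n b (f * g) ≈ f * Q^ n b g
  Q^-free* n zero    f g h = refl
  Q^-free* n (suc b) f g h = trans (⟨ Q^-additive n b ⟩cong pull) (Q^-free* n b f (Q n g) h)
    where
    pull : Q n (f * g) ≈ f * Q n g
    pull = trans (Q-* n f g) (trans (+-cong (*≈0ˡ h) (*-congʳ (trans (+-congˡ (-‿cong (trans (*-congˡ (trans h (sym const-0))) refl)))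
      (solve 2 (λ f x → f :- x :* con 0ℤ := f) refl f (x n))))) (+-identityˡ _))

  -- Induction on the degree of f: with κ = f at x n = 0 one has f g = κ g + x n (Q n f · g), and κ
  -- g has too small a degree in x n to reach the top.
  LT-* : ∀ n b b′ {f g a a′} → LT n b f a → LT n b′ g a′ → LT n (b ℕ.+ b′) (f * g) (a * a′)
  LT-* n zero b′ {f} {g} (e , z) (e′ , z′) =
    trans (Q^-free* n b′ f g z) (*-cong e e′) , trans (Q^-free* n (suc b′) f g z) (*≈0ʳ z′)
  LT-* n (suc b) b′ {f} {g} {a} {a′} lt lt′ with LT-* n b b′ {Q n f} {g} {a} {a′} lt lt′
  ... | e , z = trans (reduce (b ℕ.+ b′)) (trans (+-congʳ (*≈0ʳ (beyond b))) (trans (+-identityˡ _) e))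
              , trans (reduce (suc b ℕ.+ b′)) (trans (+-congʳ (*≈0ʳ (beyond (suc b)))) (trans (+-identityˡ _) z))
    where
    κ = f - x n * Q n f
    free : Q n κ ≈ 0#
    free = trans (homo-- (Q-additive n) f _) (trans (+-congˡ (-‿cong (Q-same n _))) (-‿inverseʳ _))
    beyond : ∀ c → Q^ n (suc c ℕ.+ b′) g ≈ 0#
    beyond zero    = proj₂ lt′
    beyond (suc c) = trans (sym (Q^-comm (Q-additive n) n (λ _ → refl) (suc c ℕ.+ b′) g)) (homo-≈0 (Q-additive n) (beyond c))
    reduce : ∀ c → Q^ n (suc c) (f * g) ≈ κ * Q^ n (suc c) g + Q^ n c (Q n f * g)
    reduce c = begin
      Q^ n (suc c) (f * g)
        ≈⟨ ⟨ Q^-additive n (suc c) ⟩cong (solve 4 (λ f g q x → f :* g := (f :- x :* q) :* g :+ x :* (q :* g)) refl f g (Q n f) (x n)) ⟩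
      Q^ n (suc c) (κ * g + x n * (Q n f * g)) ≈⟨ homo-+ (Q^-additive n (suc c)) _ _ ⟩
      Q^ n (suc c) (κ * g) + Q^ n (suc c) (x n * (Q n f * g)) ≈⟨ +-cong (Q^-free* n (suc c) κ g free) (⟨ Q^-additive n c ⟩cong (Q-same n _)) ⟩
      κ * Q^ n (suc c) g + Q^ n c (Q n f * g) ∎

  Q^-free : ∀ m n b f → Q m f ≈ 0# → Q m (Q^ n b f) ≈ 0#
  Q^-free m n b f h = trans (Q^-comm (Q-additive m) n (Q-comm m n) b f) (homo-≈0 (Q^-additive n b) h)

  Q^-π : ∀ n b f → Q (suc n) f ≈ 0# → Q^ (suc n) b (π n f) ≈ π n (Q^ n b f)
  Q^-π n zero    f h = refl
  Q^-π n (suc b) f h = trans (⟨ Q^-additive (suc n) b ⟩cong (trans (Q-π n f h) (∂-Q n f h)))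
    (Q^-π n b (Q n f) (trans (Q-comm (suc n) n f) (homo-≈0 (Q-additive n) h)))

  -- π n sends x n ^ b to the sum of all monomials of degree b in x n and x (n+1), whose highest
  -- term in x (n+1) is x (n+1) ^ b.
  LT-π : ∀ n b {f a} → Q (suc n) f ≈ 0# → LT n b f a → LT (suc n) b (π n f) a
  LT-π n b {f} {a} h lt@(e , z) =
    trans (Q^-π n b f h) (trans (⟨ π-additive n ⟩cong e) (π-free n a (LT-free n b lt) (trans (Q-cong (suc n) (sym e)) (Q^-free (suc n) n b f h))))
    , trans (Q^-π n (suc b) f h) (homo-≈0 (π-additive n) z)

  LT-∂ : ∀ n b {f a} → Q (suc n) f ≈ 0# → LT n (suc b) f a → LT (suc n) b (∂ n f) a
  LT-∂ n b {f} {a} h lt = trans (⟨ Q^-additive (suc n) b ⟩cong (∂-Q n f h)) (proj₁ top)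
    , trans (⟨ Q^-additive (suc n) (suc b) ⟩cong (∂-Q n f h)) (proj₂ top)
    where
    top : LT (suc n) b (π n (Q n f)) a
    top = LT-π n b {Q n f} {a} (trans (Q-comm (suc n) n f) (homo-≈0 (Q-additive n) h)) lt

  E-Q : ∀ n m f → n < m → E n (Q m f) ≈ Q m (E n f)
  E-Q zero    m f h = refl
  E-Q (suc n) m f h = trans (⟨ E-additive n ⟩cong (π-Q-comm n m f h)) (E-Q n m _ (ℕₚ.<-trans (ℕₚ.n<1+n n) h))

  -- Comparing top coefficients in x (n+1).
  E-multiplicative-top : ∀ n b b′ {f g a a′} → Free (suc n) f → Free (suc n) g → LT n b f a → LT n b′ g a′ →
    E (suc n) f * E (suc n) g ≈ E (suc n) (f * g) → E n a * E n a′ ≈ E n (a * a′)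
  E-multiplicative-top n b b′ {f} {g} {a} {a′} ff fg lt lt′ h = begin
    E n a * E n a′                                          ≈⟨ proj₁ (LT-* (suc n) b b′ (lift b ff lt) (lift b′ fg lt′)) ⟨
    Q^ (suc n) (b ℕ.+ b′) (E (suc n) f * E (suc n) g)       ≈⟨ ⟨ Q^-additive (suc n) (b ℕ.+ b′) ⟩cong h ⟩
    Q^ (suc n) (b ℕ.+ b′) (E (suc n) (f * g))               ≈⟨ proj₁ (lift (b ℕ.+ b′) (Free-* (suc n) ff fg) (LT-* n b b′ lt lt′)) ⟩
    E n (a * a′) ∎
    where
    lift : ∀ b {f a} → Free (suc n) f → LT n b f a → LT (suc n) b (E (suc n) f) (E n a)
    lift b free lt = LT-map (E-additive n) (suc n) (λ f → E-Q n (suc n) f ℕₚ.≤-refl) b (LT-π n b (free (suc n) ℕₚ.≤-refl) lt)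

  -- In `LT` the exponent is only an upper bound of the degree, so a and hence c may be 0; with c ≠
  -- 0 the relation certifies f ≠ 0, by `Lead-0`.
  Lead : ℕ → Carrier → ℤ → Set
  Lead zero    f c = f ≈ const c
  Lead (suc n) f c = Σ ℕ λ b → Σ Carrier λ a → LT n b f a × Lead n a c

  Lead-cong : ∀ n {f g c} → f ≈ g → Lead n f c → Lead n g c
  Lead-cong zero    h e = trans (sym h) e
  Lead-cong (suc n) h (b , a , (e , z) , l) =
    b , a , (trans (⟨ Q^-additive n b ⟩cong (sym h)) e , trans (⟨ Q^-additive n (suc b) ⟩cong (sym h)) z) , l

  Lead-* : ∀ n {f g c d} → Lead n f c → Lead n g d → Lead n (f * g) (c ℤ.* d)
  Lead-* zero    {c = c} {d} e e′ = trans (*-cong e e′) (sym (const-* c d))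
  Lead-* (suc n) (b , a , lt , l) (b′ , a′ , lt′ , l′) = b ℕ.+ b′ , a * a′ , LT-* n b b′ lt lt′ , Lead-* n l l′

  ct-0 : ct 0# ≡ 0ℤ
  ct-0 = ≡.trans (ct-cong (sym const-0)) (ct-const 0ℤ)

  Lead-0 : ∀ n {f c} → Lead n f c → f ≈ 0# → c ≡ 0ℤ
  Lead-0 zero    {f} {c} e h = ≡.trans (≡.sym (ct-const c)) (≡.trans (ct-cong (trans (sym e) h)) ct-0)
  Lead-0 (suc n) (b , a , (e , _) , l) h = Lead-0 n l (trans (sym e) (homo-≈0 (Q^-additive n b) h))

  -- The reverse lexicographically leading term of f ∈ ℤ[x 0, …, x (n-1)] is c x^b with b m = 0 iff Z m.
  Top : ℕ → (ℕ → Set) → Carrier → ℤ → Set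
  Top zero    Z f c = f ≈ const c
  Top (suc n) Z f c = Σ ℕ λ b → Σ Carrier λ a → LT n b f a × (b ≡ 0 → Z n) × (Z n → b ≡ 0) × Top n Z a c

  Ds-additive : ∀ k η → Additive (Ds k η)
  Ds-additive zero    η = id-additive
  Ds-additive (suc k) η with η k
  ... | zero  = Ds-additive k η
  ... | suc _ = ∘-additive (Ds-additive k η) (∂-additive k)

  Ds-Q : ∀ k η n f → k < n → Ds k η (Q n f) ≈ Q n (Ds k η f)
  Ds-Q zero    η n f h = refl
  Ds-Q (suc k) η n f h with η k
  ... | zero  = Ds-Q k η n f (ℕₚ.<-trans (ℕₚ.n<1+n k) h)
  ... | suc _ = trans (⟨ Ds-additive k η ⟩cong (Q-∂ n k f (proj₁ (≢-up h) ∘ ≡.sym) (proj₁ (proj₂ (≢-up h)) ∘ ≡.sym)))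
                  (Ds-Q k η n _ (ℕₚ.<-trans (ℕₚ.n<1+n k) h))

  -- In `Top` the exponent of x m is positive exactly when η m ≠ 0, so `Ds` applies ∂ m exactly
  -- where there is a power to lower. Such a ∂ m moves the leading power into x (m+1), one less, and
  -- keeps the coefficient; hence the k + 1 variables of the result.
  Lead-Ds : ∀ k η {f c} → Top k (λ m → η m ≡ 0) f c → Free k f → Lead (suc k) (Ds k η f) c
  Lead-Ds zero    η {f} e free = 0 , f , (refl , free 0 z≤n) , e
  Lead-Ds (suc k) η {f} (b , a , lt , i , j , t) free with η k
  Lead-Ds (suc k) η {f} (b , a , lt , i , j , t) free | zero with b | j ≡.refl | lt
  ... | .0 | ≡.refl | lt₀ = 0 , Ds k η f , (refl , trans (sym (Ds-Q k η (suc k) f ℕₚ.≤-refl)) (homo-≈0 (Ds-additive k η) (free (suc k) ℕₚ.≤-refl)))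
          , Lead-cong (suc k) (⟨ Ds-additive k η ⟩cong (sym (proj₁ lt₀))) (Lead-Ds k η t (LT-Free k 0 lt₀ free))
  Lead-Ds (suc k) η {f} (zero , a , lt , i , j , t) free | suc _ with i ≡.refl
  ... | ()
  Lead-Ds (suc k) η {f} (suc b , a , lt , i , j , t) free | suc _ =
    b , Ds k η a , LT-map (Ds-additive k η) (suc k) (λ f → Ds-Q k η (suc k) f ℕₚ.≤-refl) b (LT-∂ k b (free (suc k) ℕₚ.≤-refl) lt)
    , Lead-Ds k η t (LT-Free k (suc b) lt free)

  -- For positive b the leading coefficient of f in x n is also that of ∂ n f in x (n+1), and
  -- `C (suc n)` includes `C n` for ∂ n f; for b = 0 it is f itself.
  C-LT : ∀ n b {ε f a} → Free (suc n) f → C (suc n) ε f → LT n b f a → C n ε a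
  C-LT n zero    free (_ , c , _) (e , _) = C-cong n e c
  C-LT n (suc b) {ε} {f} {a} free (_ , _ , d) lt = C-cong n (proj₁ (LT-∂ n b (free (suc n) ℕₚ.≤-refl) lt))
    (C-map (Q^-additive (suc n) b) n (λ m g m<n → Q^-comm (∂-additive m) (suc n)
      (λ h → Q-∂ (suc n) m h (ℕₚ.<⇒≢ (ℕₚ.m<n⇒m<1+n m<n) ∘ ≡.sym) (ℕₚ.<⇒≢ (s≤s m<n) ∘ ≡.sym)) b g) d)

  -- Truncating f and g to leading coefficients leaves k + 1 variables, where only one correction term survives.
  E-not-multiplicative : ∀ ε δ → Binary ε → Binary δ → ∀ k → ε k ≡ 1 → δ k ≡ 1 → total ε δ k ≡ k → (∀ j → j ≤ k → total ε δ j ≤ j) →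
    ∀ m {f g c d} → Free (suc k ℕ.+ m) f → Free (suc k ℕ.+ m) g → C (suc k ℕ.+ m) ε f → C (suc k ℕ.+ m) δ g →
    Top (suc k ℕ.+ m) (λ j → ε j ≡ 0) f c → Top (suc k ℕ.+ m) (λ j → δ j ≡ 0) g d →
    E (suc k ℕ.+ m) f * E (suc k ℕ.+ m) g ≈ E (suc k ℕ.+ m) (f * g) → c ℤ.* d ≡ 0ℤ
  E-not-multiplicative ε δ ε₀₁ δ₀₁ k εk δk tot bound (suc m) ff fg cf cg tf tg h
    rewrite ℕₚ.+-suc k m with tf | tg
  ... | b , a , lt , _ , _ , ta | b′ , a′ , lt′ , _ , _ , ta′ =
    E-not-multiplicative ε δ ε₀₁ δ₀₁ k εk δk tot bound m (LT-Free _ b lt ff) (LT-Free _ b′ lt′ fg)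
      (C-LT _ b ff cf lt) (C-LT _ b′ fg cg lt′) ta ta′ (E-multiplicative-top _ b b′ ff fg lt lt′ h)
  E-not-multiplicative ε δ ε₀₁ δ₀₁ k εk δk tot bound zero {f} {g} ff fg cf cg tf tg h rewrite ℕₚ.+-identityʳ k with tf | tg
  -- Since ε k = δ k = 1, both leading exponents in x k are positive.
  ... | zero  , _ , _ , i , _ | _ = ⊥-elim (ℕₚ.0≢1+n (≡.trans (≡.sym (i ≡.refl)) εk))
  ... | suc b , _ | zero , _ , _ , i , _ = ⊥-elim (ℕₚ.0≢1+n (≡.trans (≡.sym (i ≡.refl)) δk))
  ... | suc b , a , lt , _ , _ , ta | suc b′ , a′ , lt′ , _ , _ , ta′ = Lead-0 (suc k)
          (Lead-* (suc k) (Lead-Ds k ε ta (LT-Free k (suc b) lt ff)) (Lead-Ds k δ ta′ (LT-Free k (suc b′) lt′ fg))) product≈0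
    where
    -- All earlier corrections vanish by `tail-chain`, and in k + 1 variables there are no later
    -- ones.
    correction : E k (x k * (x (suc k) * (∂ k f * ∂ k g))) ≈ 0#
    correction = begin
      t                                        ≈⟨ solve 2 (λ a t → t := (a :+ t) :- a) refl (E (suc k) (f * g)) t ⟩
      (E (suc k) (f * g) + t) - E (suc k) (f * g) ≈⟨ +-congʳ (homo-+ (E-additive k) _ _) ⟨
      E k (π k (f * g) + x k * (x (suc k) * (∂ k f * ∂ k g))) - E (suc k) (f * g) ≈⟨ +-congʳ (⟨ E-additive k ⟩cong (π-* k f g)) ⟨
      E k (π k f * π k g) - E (suc k) (f * g) ≈⟨ +-congʳ (tail-chain ε δ ε₀₁ δ₀₁ (suc k) k 1 f g (ℕₚ.+-comm k 1) cf cg bound) ⟨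
      E (suc k) f * E (suc k) g - E (suc k) (f * g) ≈⟨ +-congʳ h ⟩
      E (suc k) (f * g) - E (suc k) (f * g) ≈⟨ -‿inverseʳ _ ⟩
      0# ∎
      where t = E k (x k * (x (suc k) * (∂ k f * ∂ k g)))
    D≈0 : D k (∂ k f * ∂ k g) ≈ 0#
    D≈0 = x-cancel (suc k) _ (trans (sym (D-x k (suc k) _ ℕₚ.≤-refl)) (X-cancel k _ (trans (sym (E-x k _)) correction)))
    -- `D k` commutes with quotients by x (k+1), so it may be applied to the leading coefficient
    -- `a * a′` of `∂ k f * ∂ k g` in that variable; the result is the critical term of `D-top` with
    -- d = 0.
    lt* : LT (suc k) (b ℕ.+ b′) (∂ k f * ∂ k g) (a * a′)
    lt* = LT-* (suc k) b b′ (LT-∂ k b (ff (suc k) ℕₚ.≤-refl) lt) (LT-∂ k b′ (fg (suc k) ℕₚ.≤-refl) lt′)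
    Daa′ : D k (a * a′) ≈ 0#
    Daa′ = begin
      D k (a * a′)                                      ≈⟨ ⟨ D-additive k ⟩cong (proj₁ lt*) ⟨
      D k (Q^ (suc k) (b ℕ.+ b′) (∂ k f * ∂ k g))       ≈⟨ Q^-comm (D-additive k) (suc k) (λ f → D-Q k (suc k) f ℕₚ.≤-refl) (b ℕ.+ b′) _ ⟩
      Q^ (suc k) (b ℕ.+ b′) (D k (∂ k f * ∂ k g))       ≈⟨ homo-≈0 (Q^-additive (suc k) (b ℕ.+ b′)) D≈0 ⟩
      0# ∎
    ≈±-0 : ∀ {p q} → p ≈ 0# → p ≈± q → q ≈ 0#
    ≈±-0 h (inj₁ e) = trans (sym e) h
    ≈±-0 h (inj₂ e) = trans (solve 1 (λ t → t := :- (:- t)) refl _) (trans (-‿cong (trans (sym e) h))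
                        (trans (sym (+-identityˡ _)) (-‿inverseʳ 0#)))
    product≈0 : Ds k ε a * Ds k δ a′ ≈ 0#
    product≈0 = ≈±-0 Daa′ (D-top ε δ ε₀₁ δ₀₁ k 0 (C-LT k (suc b) ff cf lt) (C-LT k (suc b′) fg cg lt′) tot bound)

  -- Finite support, constants, and the stable operator Γ

  skip-< : ∀ i j → j < i → skip i j ≡ j
  skip-< (suc i) zero    _       = ≡.refl
  skip-< (suc i) (suc j) (s≤s h) = ≡.cong suc (skip-< i j h)

  Bounded : ℕ → Carrier → Set
  Bounded N f = Free N f × (∀ n → N ≤ n → ρ n f ≈ f)

  bounded : ∀ f → ∃ λ N → Bounded N f
  bounded = ind (λ f → ∃ λ N → Bounded N f)
    (λ h (N , q , r) → N , (λ m N≤m → trans (Q-cong m (sym h)) (q m N≤m)) , λ n N≤n → trans (ρ-cong n (sym h)) (trans (r n N≤n) h))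
    (λ c → 0 , (λ m _ → Q-const m c) , λ n _ → ρ-const n c)
    (λ j f (N , q , r) → suc j ⊔ N
       , (λ m le → trans (Q-diff m j f (ℕₚ.<⇒≢ (ℕₚ.m⊔n≤o⇒m≤o (suc j) N le))) (*≈0ʳ (q m (ℕₚ.m⊔n≤o⇒n≤o (suc j) N le))))
       , λ n le → trans (≡.subst (λ i → ρ n (x i * f) ≈ x j * ρ n f) (skip-< n j (ℕₚ.m⊔n≤o⇒m≤o (suc j) N le)) (ρ-skip n j f))
                   (*-congˡ (r n (ℕₚ.m⊔n≤o⇒n≤o (suc j) N le))))
    (λ f g (N , q , r) (N′ , q′ , r′) → N ⊔ N′
       , (λ m le → trans (Q-+ m f g) (trans (+-cong (q m (ℕₚ.m⊔n≤o⇒m≤o N N′ le)) (q′ m (ℕₚ.m⊔n≤o⇒n≤o N N′ le))) (+-identityˡ 0#)))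
       , λ n le → trans (ρ-+ n f g) (+-cong (r n (ℕₚ.m⊔n≤o⇒m≤o N N′ le)) (r′ n (ℕₚ.m⊔n≤o⇒n≤o N N′ le))))

  -- Only finitely many variables occur. For the last one, x N, ∂ N f = π N (Q N f), so
  -- `π-injective` removes x N; this repeats down to n.
  free-descend : ∀ n f → (∀ m → n ≤ m → ∂ m f ≈ 0#) → Free n f
  free-descend n f flat = go (proj₁ (bounded f)) (proj₁ (proj₂ (bounded f)))
    where
    go : ∀ N → Free N f → Free n f
    go zero    free = Free-mono z≤n free
    go (suc N) free with n ℕₚ.≤? N
    ... | no n≰N  = Free-mono (ℕₚ.≰⇒> n≰N) free
    ... | yes n≤N = go N λ m N≤m → at m N≤m (m ℕ.≟ N)
      where
      free-N : Q N f ≈ 0#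
      free-N = π-injective N (Q N f) (trans (Q-comm (suc N) N f) (homo-≈0 (Q-additive N) (free (suc N) ℕₚ.≤-refl)))
        (trans (sym (∂-Q N f (free (suc N) ℕₚ.≤-refl))) (flat N n≤N))
      at : ∀ m → N ≤ m → _ → Q m f ≈ 0#
      at m N≤m (yes ≡.refl) = free-N
      at m N≤m (no m≢N)     = free m (ℕₚ.≤∧≢⇒< N≤m (m≢N ∘ ≡.sym))

  -- The substitution x 0, …, x (N-1) ↦ 0.
  annul : ℕ → Carrier → Carrier
  annul zero    f = f
  annul (suc N) f = annul N (f - x N * Q N f)

  annul-additive : ∀ N → Additive (annul N)
  annul-additive zero    = id-additive
  annul-additive (suc N) = ∘-additive (annul-additive N) record
    { ⟨_⟩cong = λ h → +-cong h (-‿cong (*-congˡ (Q-cong N h)))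
    ; homo-+ = λ f g → trans (+-congˡ (-‿cong (*-congˡ (Q-+ N f g))))
        (solve 5 (λ f g a b x → f :+ g :- x :* (a :+ b) := (f :- x :* a) :+ (g :- x :* b)) refl f g (Q N f) (Q N g) (x N)) }

  annul-free : ∀ N f → Free 0 f → annul N f ≈ f
  annul-free zero    f h = refl
  annul-free (suc N) f h = trans (⟨ annul-additive N ⟩cong (trans (+-congˡ (-‿cong (*-congˡ (trans (h N z≤n) (sym const-0)))))
    (solve 2 (λ f x → f :- x :* con 0ℤ := f) refl f (x N)))) (annul-free N f h)

  annul-x : ∀ N j f → j < N → annul N (x j * f) ≈ 0#
  annul-x (suc N) j f j<N with j ℕ.≟ N
  ... | yes ≡.refl = homo-≈0 (annul-additive N) (trans (+-congˡ (-‿cong (*-congˡ (Q-same N f)))) (-‿inverseʳ _))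
  ... | no j≢N = trans (⟨ annul-additive N ⟩cong (trans (+-congˡ (-‿cong (*-congˡ (Q-diff N j f j≢N))))
          (solve 4 (λ y f q x → y :* f :- x :* (y :* q) := y :* (f :- x :* q)) refl (x j) f (Q N f) (x N))))
        (annul-x N j _ (ℕₚ.≤∧≢⇒< (ℕ.s≤s⁻¹ j<N) j≢N))

  annul-ct : ∀ f → ∃ λ N → ∀ M → N ≤ M → annul M f ≈ const (ct f)
  annul-ct = ind (λ f → ∃ λ N → ∀ M → N ≤ M → annul M f ≈ const (ct f))
    (λ h (N , e) → N , λ M le → trans (⟨ annul-additive M ⟩cong (sym h)) (trans (e M le) (reflexive (≡.cong const (ct-cong h)))))
    (λ c → 0 , λ M _ → trans (annul-free M _ (λ m _ → Q-const m c)) (reflexive (≡.cong const (≡.sym (ct-const c)))))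
    (λ j f _ → suc j , λ M le → trans (annul-x M j f le) (trans (sym const-0) (reflexive (≡.cong const (≡.sym (ct-x j f))))))
    (λ f g (N , e) (N′ , e′) → N ⊔ N′ , λ M le → trans (homo-+ (annul-additive M) f g)
      (trans (+-cong (e M (ℕₚ.m⊔n≤o⇒m≤o N N′ le)) (e′ M (ℕₚ.m⊔n≤o⇒n≤o N N′ le)))
        (trans (sym (const-+ _ _)) (reflexive (≡.cong const (≡.sym (ct-+ f g)))))))

  -- `ct` is known only through its values on sums, constants and multiples of variables. `annul N`
  -- links it to f: it fixes an f without variables and equals `const (ct f)` for large N.
  flat⇒const : ∀ f → (∀ k → ∂ k f ≈ 0#) → f ≈ const (ct f)
  flat⇒const f flat with annul-ct f
  ... | N , e = trans (sym (annul-free N f (free-descend 0 f (λ m _ → flat m)))) (e N ℕₚ.≤-refl)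

  E-stable : ∀ n d f → Free n f → E (d ℕ.+ n) f ≈ E n f
  E-stable n zero    f free = refl
  E-stable n (suc d) f free = trans (⟨ E-additive (d ℕ.+ n) ⟩cong
    (π-free (d ℕ.+ n) f (free _ (ℕₚ.m≤n+m n d)) (free _ (ℕₚ.m≤n⇒m≤1+n (ℕₚ.m≤n+m n d))))) (E-stable n d f free)

  E-mono : ∀ {n N f} → n ≤ N → Free n f → E N f ≈ E n f
  E-mono {n} {N} {f} n≤N free = ≡.subst (λ M → E M f ≈ E n f) (ℕₚ.m∸n+n≡m n≤N) (E-stable n (N ℕ.∸ n) f free)

  -- `gap` is ρ i applied to f - s i(f) = (x i - x (i+1)) ∂ i f: under ρ i the transposed polynomial
  -- s i(f) becomes ρ (i+1) f, while x i and x (i+1) become 0 and x i. Telescoping this over the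
  -- factors of `E` shows that ρ 0 undoes it.
  ρ-π : ∀ i f → ρ i (π i f) ≈ ρ (suc i) f
  ρ-π i f = trans (ρ-+ i f _) (trans (+-congˡ (trans (skipped i _) (gap f)))
    (solve 2 (λ a b → a :+ (b :- a) := b) refl (ρ i f) (ρ (suc i) f)))
    where
    skip-≤ : ∀ i → skip i i ≡ suc i
    skip-≤ zero    = ≡.refl
    skip-≤ (suc i) = ≡.cong suc (skip-≤ i)
    skipped : ∀ i f → ρ i (x (suc i) * f) ≈ x i * ρ i f
    skipped i f = ≡.subst (λ j → ρ i (x j * f) ≈ x i * ρ i f) (skip-≤ i) (ρ-skip i i f)
    skip-keep : ∀ i → skip (suc i) i ≡ i
    skip-keep i = skip-< (suc i) i ℕₚ.≤-refl
    kept : ∀ f → ρ (suc i) (x i * f) ≈ x i * ρ (suc i) f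
    kept f = ≡.subst (λ j → ρ (suc i) (x j * f) ≈ x i * ρ (suc i) f) (skip-keep i) (ρ-skip (suc i) i f)
    skip-agree : ∀ i k → skip (suc i) k ≢ i → skip (suc i) k ≡ skip i k
    skip-agree zero    zero    h = ⊥-elim (h ≡.refl)
    skip-agree zero    (suc k) h = ≡.refl
    skip-agree (suc i) zero    h = ≡.refl
    skip-agree (suc i) (suc k) h = ≡.cong suc (skip-agree i k (h ∘ ≡.cong suc))
    difference : Additive (λ f → ρ (suc i) f - ρ i f)
    difference = record
      { ⟨_⟩cong = λ h → +-cong (ρ-cong _ h) (-‿cong (ρ-cong _ h))
      ; homo-+ = λ f g → trans (+-cong (ρ-+ _ f g) (-‿cong (ρ-+ _ f g)))
          (solve 4 (λ a b c d → a :+ b :- (c :+ d) := (a :- c) :+ (b :- d)) refl (ρ (suc i) f) (ρ (suc i) g) (ρ i f) (ρ i g)) }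
    step : ∀ j f → x i * ρ i (∂ i f) ≈ ρ (suc i) f - ρ i f → x i * ρ i (∂ i (x j * f)) ≈ ρ (suc i) (x j * f) - ρ i (x j * f)
    step j f e with j ℕ.≟ i | j ℕ.≟ suc i
    ... | yes ≡.refl | _ = begin
      x i * ρ i (∂ i (x i * f))                 ≈⟨ *-congˡ (trans (ρ-cong i (∂-same i f)) (trans (ρ-+ i f _) (+-congˡ (trans (skipped i _) e)))) ⟩
      x i * (ρ i f + (ρ (suc i) f - ρ i f))     ≈⟨ solve 3 (λ x a b → x :* (a :+ (b :- a)) := x :* b :- con 0ℤ) refl (x i) (ρ i f) (ρ (suc i) f) ⟩
      x i * ρ (suc i) f - const 0ℤ              ≈⟨ +-cong (sym (kept f)) (-‿cong (trans const-0 (sym (ρ-same i f)))) ⟩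
      ρ (suc i) (x i * f) - ρ i (x i * f) ∎
    ... | no _ | yes ≡.refl = begin
      x i * ρ i (∂ i (x (suc i) * f))           ≈⟨ *-congˡ (trans (ρ-cong i (∂-next i f)) (trans (ρ-+ i _ _)
                                                    (+-cong (homo-neg (ρ-additive i) f) (trans (ρ-same i _) (sym const-0))))) ⟩
      x i * (- ρ i f + const 0ℤ)                ≈⟨ solve 2 (λ x a → x :* (:- a :+ con 0ℤ) := con 0ℤ :- x :* a) refl (x i) (ρ i f) ⟩
      const 0ℤ - x i * ρ i f                    ≈⟨ +-cong (trans const-0 (sym (ρ-same (suc i) f))) (-‿cong (sym (skipped i f))) ⟩
      ρ (suc i) (x (suc i) * f) - ρ i (x (suc i) * f) ∎
    ... | no j≢i | no j≢si with skip-view (suc i) j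
    ... | inj₁ e′ = ⊥-elim (j≢si e′)
    ... | inj₂ (k , ≡.refl) = begin
      x i * ρ i (∂ i (x j * f))                 ≈⟨ *-congˡ (trans (ρ-cong i (∂-far i j f j≢i j≢si)) (at _)) ⟩
      x i * (x k * ρ i (∂ i f))                 ≈⟨ solve 3 (λ a b c → a :* (b :* c) := b :* (a :* c)) refl (x i) (x k) (ρ i (∂ i f)) ⟩
      x k * (x i * ρ i (∂ i f))                 ≈⟨ *-congˡ e ⟩
      x k * (ρ (suc i) f - ρ i f)               ≈⟨ solve 3 (λ x a b → x :* (a :- b) := x :* a :- x :* b) refl (x k) (ρ (suc i) f) (ρ i f) ⟩
      x k * ρ (suc i) f - x k * ρ i f           ≈⟨ +-cong (sym (ρ-skip (suc i) k f)) (-‿cong (sym (at f))) ⟩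
      ρ (suc i) (x j * f) - ρ i (x j * f) ∎
      where
      at : ∀ g → ρ i (x (skip (suc i) k) * g) ≈ x k * ρ i g
      at g = ≡.subst (λ l → ρ i (x l * g) ≈ x k * ρ i g) (≡.sym (skip-agree i k j≢i)) (ρ-skip i k g)
    gap : ∀ f → x i * ρ i (∂ i f) ≈ ρ (suc i) f - ρ i f
    gap = additive-ext (∘-additive (*-additive (x i)) (∘-additive (ρ-additive i) (∂-additive i))) difference
      (λ c → trans (*≈0ʳ (homo-≈0 (ρ-additive i) (∂-const i c))) (sym (trans (+-cong (ρ-const _ c) (-‿cong (ρ-const _ c))) (-‿inverseʳ _)))) step

  ρ-tail : ∀ m i f → ρ i (tail i m f) ≈ ρ (i ℕ.+ m) f
  ρ-tail zero    i f = reflexive (≡.cong (λ n → ρ n f) (≡.sym (ℕₚ.+-identityʳ i)))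
  ρ-tail (suc m) i f = trans (ρ-π i _) (trans (ρ-tail m (suc i) f) (reflexive (≡.cong (λ n → ρ n f) (≡.sym (ℕₚ.+-suc i m)))))

  -- π k π (k+1) h = ∂ k ∂ (k+1) (x k x (k+1) h). By the braid relation an outer ∂ (k+1) becomes an
  -- inner ∂ k, which passes the symmetric factor x k x (k+1). Factors π of smaller index commute
  -- with the outer operator, those of larger index with ∂ k.
  ∂-tail : ∀ d k m f → ∂ (suc (d ℕ.+ k)) (tail k (d ℕ.+ (2 ℕ.+ m)) f) ≈ tail k (d ℕ.+ (2 ℕ.+ m)) (∂ (d ℕ.+ k) f)
  ∂-tail zero k m f = begin
    ∂ (suc k) (π k (π (suc k) H))                             ≈⟨ ∂-cong (suc k) (π²-as-∂² H) ⟩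
    ∂ (suc k) (∂ k (∂ (suc k) (x k * (x (suc k) * H))))       ≈⟨ ∂-braid k _ ⟨
    ∂ k (∂ (suc k) (∂ k (x k * (x (suc k) * H))))             ≈⟨ ∂-cong k (∂-cong (suc k) (sym-mult H)) ⟩
    ∂ k (∂ (suc k) (x k * (x (suc k) * ∂ k H)))               ≈⟨ π²-as-∂² (∂ k H) ⟨
    π k (π (suc k) (∂ k H))                                   ≈⟨ ⟨ ∘-additive (π-additive k) (π-additive (suc k)) ⟩cong (tail-∂-comm k (2 ℕ.+ k) m f ℕₚ.≤-refl) ⟩
    π k (π (suc k) (tail (2 ℕ.+ k) m (∂ k f))) ∎
    where
    H = tail (2 ℕ.+ k) m f
    k≢sk : k ≢ suc k
    k≢sk = ℕₚ.<⇒≢ ℕₚ.≤-refl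
    k≢ssk : k ≢ suc (suc k)
    k≢ssk = ℕₚ.<⇒≢ (ℕₚ.m<n⇒m<1+n ℕₚ.≤-refl)
    π²-as-∂² : ∀ h → π k (π (suc k) h) ≈ ∂ k (∂ (suc k) (x k * (x (suc k) * h)))
    π²-as-∂² h = trans (π-∂x k _) (∂-cong k (trans (*-congˡ (π-∂x (suc k) h)) (sym (∂-far (suc k) k _ k≢sk k≢ssk))))
    sym-mult : ∀ h → ∂ k (x k * (x (suc k) * h)) ≈ x k * (x (suc k) * ∂ k h)
    sym-mult h = trans (∂-same k _) (trans (+-congˡ (*-congˡ (∂-next k h)))
      (solve 4 (λ x y h d → y :* h :+ y :* (:- h :+ x :* d) := x :* (y :* d)) refl (x k) (x (suc k)) h (∂ k h)))
  ∂-tail (suc d) k m f = trans (sym (π-commute (∂-additive (2 ℕ.+ (d ℕ.+ k))) k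
      (λ g → ∂-comm k (2 ℕ.+ (d ℕ.+ k)) g lt) (λ g → ∂-far _ (suc k) g (ℕₚ.<⇒≢ lt) (ℕₚ.<⇒≢ (ℕₚ.m<n⇒m<1+n lt))) _))
    (⟨ π-additive k ⟩cong (≡.subst (λ e → ∂ (suc e) (tail (suc k) (d ℕ.+ (2 ℕ.+ m)) f) ≈ tail (suc k) (d ℕ.+ (2 ℕ.+ m)) (∂ e f))
      (ℕₚ.+-suc d k) (∂-tail d (suc k) m f)))
    where
    lt : suc k < 2 ℕ.+ (d ℕ.+ k)
    lt = s≤s (s≤s (ℕₚ.m≤n+m k d))

  E-tail₀ : ∀ n f → E n f ≈ tail 0 n f
  E-tail₀ n f = reflexive (≡.sym (E-tail 0 n f))

  ∂-E : ∀ k n f → suc k < n → ∂ (suc k) (E n f) ≈ E n (∂ k f)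
  ∂-E k n f h = ≡.subst (λ N → ∂ (suc k) (E N f) ≈ E N (∂ k f)) split
    (trans (∂-cong (suc k) (E-tail₀ N f)) (trans core (sym (E-tail₀ N _))))
    where
    m = n ℕ.∸ (2 ℕ.+ k)
    N = k ℕ.+ (2 ℕ.+ m)
    split : N ≡ n
    split = ≡.trans (≡.sym (ℕₚ.+-assoc k 2 m)) (≡.trans (≡.cong (ℕ._+ m) (ℕₚ.+-comm k 2)) (ℕₚ.m+[n∸m]≡n h))
    core : ∂ (suc k) (tail 0 N f) ≈ tail 0 N (∂ k f)
    core = ≡.subst (λ e → ∂ (suc e) (tail 0 N f) ≈ tail 0 N (∂ e f)) (ℕₚ.+-identityʳ k) (∂-tail k 0 m f)

  -- The outermost factor is π 0 g = ∂ 0 (x 0 g), and ∂ 0 squares to zero.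
  ∂₀-E : ∀ n f → ∂ 0 (E (suc n) f) ≈ 0#
  ∂₀-E n f = trans (∂-cong 0 (trans (E-tail₀ (suc n) f) (π-∂x 0 _))) (∂² 0 _)

  ct-E : ∀ n f → ct (E n f) ≡ ct f
  ct-E zero    f = ≡.refl
  ct-E (suc n) f = ≡.trans (ct-E n (π n f)) (≡.trans (ct-+ f _) (≡.trans (≡.cong (λ t → ct f ℤ.+ t) (ct-x (suc n) _)) (ℤₚ.+-identityʳ _)))

  size : Carrier → ℕ
  size f = proj₁ (bounded f)

  size-free : ∀ f → Free (size f) f
  size-free f = proj₁ (proj₂ (bounded f))

  -- The stable value of `E n f`. Since `size` need not respect `≈`, each property is proved at a
  -- common larger n.
  Γ : Carrier → Carrier
  Γ f = E (size f) f

  Γ-E : ∀ n f → size f ≤ n → Γ f ≈ E n f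
  Γ-E n f le = sym (E-mono le (size-free f))

  Γ-cong : ∀ {f g} → f ≈ g → Γ f ≈ Γ g
  Γ-cong {f} {g} h = trans (Γ-E N f (ℕₚ.m≤m⊔n _ _)) (trans (⟨ E-additive N ⟩cong h) (sym (Γ-E N g (ℕₚ.m≤n⊔m _ _))))
    where N = size f ⊔ size g

  Γ-additive : Additive Γ
  Γ-additive = record { ⟨_⟩cong = Γ-cong ; homo-+ = λ f g → let N = size f ⊔ size g ⊔ size (f + g) in
    trans (Γ-E N (f + g) (ℕₚ.m≤n⊔m _ _)) (trans (homo-+ (E-additive N) f g) (sym
      (+-cong (Γ-E N f (ℕₚ.≤-trans (ℕₚ.m≤m⊔n _ _) (ℕₚ.m≤m⊔n (size f ⊔ size g) _)))
              (Γ-E N g (ℕₚ.≤-trans (ℕₚ.m≤n⊔m (size f) _) (ℕₚ.m≤m⊔n (size f ⊔ size g) _)))))) }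

  ∂-Γ : ∀ k f → ∂ (suc k) (Γ f) ≈ Γ (∂ k f)
  ∂-Γ k f = trans (∂-cong (suc k) (Γ-E N f (ℕₚ.≤-trans (ℕₚ.m≤m⊔n _ _) (ℕₚ.m≤n⊔m (2 ℕ.+ k) _))))
    (trans (∂-E k N f (ℕₚ.m≤m⊔n (2 ℕ.+ k) (size f ⊔ size (∂ k f)))) (sym (Γ-E N (∂ k f) (ℕₚ.≤-trans (ℕₚ.m≤n⊔m (size f) _) (ℕₚ.m≤n⊔m (2 ℕ.+ k) _)))))
    where N = (2 ℕ.+ k) ⊔ (size f ⊔ size (∂ k f))

  ∂₀-Γ : ∀ f → ∂ 0 (Γ f) ≈ 0#
  ∂₀-Γ f = trans (∂-cong 0 (Γ-E (suc (size f)) f (ℕₚ.n≤1+n _))) (∂₀-E (size f) f)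

  ρ₀-Γ : ∀ f → ρ 0 (Γ f) ≈ f
  ρ₀-Γ f = trans (ρ-cong 0 (E-tail₀ (size f) f)) (trans (ρ-tail (size f) 0 f) (proj₂ (proj₂ (bounded f)) _ ℕₚ.≤-refl))

  ct-Γ : ∀ f → ct (Γ f) ≡ ct f
  ct-Γ f = ct-E (size f) f

  -- Schubert polynomials by their divided differences

  -- f is c times the Schubert polynomial of p, characterised by its divided differences and its constant term.
  data Sch (c : ℤ) (p : ℕ → ℕ) (f : Carrier) : Set where
    sch : (∀ k → p k ≢ p (suc k)) →
          ((Increasing p × ct f ≡ c) ⊎ (∃ λ k → p (suc k) < p k × ct f ≡ 0ℤ)) →
          (∀ k → p k < p (suc k) → ∂ k f ≈ 0#) →
          (∀ k → p (suc k) < p k → Sch c (p ∘ s k) (∂ k f)) →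
          Sch c p f

  Sch-cong : ∀ {c p f g} → f ≈ g → Sch c p f → Sch c p g
  Sch-cong {c} {p} {f} {g} h (sch distinct constant flat step) = sch distinct (constant′ constant)
    (λ k a → trans (∂-cong k (sym h)) (flat k a)) (λ k d → Sch-cong (∂-cong k h) (step k d))
    where
    constant′ : _ → (Increasing p × ct g ≡ c) ⊎ (∃ λ k → p (suc k) < p k × ct g ≡ 0ℤ)
    constant′ (inj₁ (i , e))     = inj₁ (i , ≡.trans (ct-cong (sym h)) e)
    constant′ (inj₂ (k , d , e)) = inj₂ (k , d , ≡.trans (ct-cong (sym h)) e)

  Sch-≗ : ∀ {c p q f} → p ≗ q → Sch c p f → Sch c q f
  Sch-≗ {c} {p} {q} {f} h (sch distinct constant flat step) = sch
    (λ k e → distinct k (≡.trans (h k) (≡.trans e (≡.sym (h (suc k)))))) (constant′ constant)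
    (λ k a → flat k (≡.subst₂ _<_ (≡.sym (h k)) (≡.sym (h (suc k))) a))
    (λ k d → Sch-≗ (h ∘ s k) (step k (≡.subst₂ _<_ (≡.sym (h (suc k))) (≡.sym (h k)) d)))
    where
    constant′ : _ → (Increasing q × ct f ≡ c) ⊎ (∃ λ k → q (suc k) < q k × ct f ≡ 0ℤ)
    constant′ (inj₁ (i , e))     = inj₁ ((λ k → ≡.subst₂ _<_ (h k) (h (suc k)) (i k)) , e)
    constant′ (inj₂ (k , d , e)) = inj₂ (k , ≡.subst₂ _<_ (h (suc k)) (h k) d , e)

  -- By induction all divided differences of `f - g` vanish, so it is constant, and its constant
  -- term is settled by `p`.
  Sch-unique : ∀ {c p f g} → Sch c p f → Sch c p g → f ≈ g
  Sch-unique {c} {p} {f} {g} (sch distinct constant flat step) (sch _ constant′ flat′ step′) = begin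
    f                       ≈⟨ solve 2 (λ f g → f := g :+ (f :- g)) refl f g ⟩
    g + (f - g)             ≈⟨ +-congˡ (flat⇒const (f - g) same) ⟩
    g + const (ct (f - g))  ≈⟨ +-congˡ (reflexive (≡.cong const (≡.trans (ct-+ f (- g)) (≡.trans (≡.cong₂ ℤ._+_ (ct-same constant constant′) ct-neg) (ℤₚ.+-inverseʳ (ct g)))))) ⟩
    g + const 0ℤ            ≈⟨ solve 1 (λ g → g :+ con 0ℤ := g) refl g ⟩
    g ∎
    where
    same : ∀ k → ∂ k (f - g) ≈ 0#
    same k with ℕₚ.<-cmp (p k) (p (suc k))
    ... | tri< a _ _ = trans (homo-- (∂-additive k) f g) (trans (+-cong (flat k a) (-‿cong (flat′ k a))) (-‿inverseʳ 0#))
    ... | tri≈ _ e _ = ⊥-elim (distinct k e)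
    ... | tri> _ _ d = trans (homo-- (∂-additive k) f g) (trans (+-congʳ (Sch-unique (step k d) (step′ k d))) (-‿inverseʳ _))
    ct-neg : ct (- g) ≡ ℤ.- ct g
    ct-neg = ℤₚ.i-j≡0⇒i≡j _ _ (≡.trans (≡.cong (λ t → ct (- g) ℤ.+ t) (ℤₚ.neg-involutive (ct g)))
      (≡.trans (≡.sym (ct-+ (- g) g)) (≡.trans (ct-cong (-‿inverseˡ g)) ct-0)))
    Constant : Carrier → Set
    Constant h = (Increasing p × ct h ≡ c) ⊎ (∃ λ k → p (suc k) < p k × ct h ≡ 0ℤ)
    ct-same : Constant f → Constant g → ct f ≡ ct g
    ct-same (inj₁ (_ , e))     (inj₁ (_ , e′))     = ≡.trans e (≡.sym e′)
    ct-same (inj₁ (i , _))     (inj₂ (k , d , _))  = ⊥-elim (ℕₚ.<-asym (i k) d)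
    ct-same (inj₂ (k , d , _)) (inj₁ (i , _))      = ⊥-elim (ℕₚ.<-asym (i k) d)
    ct-same (inj₂ (_ , _ , e)) (inj₂ (_ , _ , e′)) = ≡.trans e (≡.sym e′)

  -- `∂-Γ`, `∂₀-Γ` and `ct-Γ` answer the clauses of `Sch`; the descents of `γ p` are those of p
  -- moved by one, and position 0 is an ascent because p is positive.
  Sch-Γ : ∀ {c p f} → Positive p → Sch c p f → Sch c (γ p) (Γ f)
  Sch-Γ {c} {p} {f} pos (sch distinct constant flat step) = sch distinct′ (constant′ constant) flat′ step′
    where
    distinct′ : ∀ k → γ p k ≢ γ p (suc k)
    distinct′ zero    e = ℕₚ.<⇒≢ (pos 0) (ℕₚ.suc-injective e)
    distinct′ (suc k) e = distinct k (ℕₚ.suc-injective e)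
    constant′ : _ → (Increasing (γ p) × ct (Γ f) ≡ c) ⊎ (∃ λ k → γ p (suc k) < γ p k × ct (Γ f) ≡ 0ℤ)
    constant′ (inj₁ (i , e))     = inj₁ (γ-increasing pos i , ≡.trans (ct-Γ f) e)
    constant′ (inj₂ (k , d , e)) = inj₂ (suc k , s≤s d , ≡.trans (ct-Γ f) e)
    flat′ : ∀ k → γ p k < γ p (suc k) → ∂ k (Γ f) ≈ 0#
    flat′ zero    _       = ∂₀-Γ f
    flat′ (suc k) (s≤s a) = trans (∂-Γ k f) (homo-≈0 Γ-additive (flat k a))
    step′ : ∀ k → γ p (suc k) < γ p k → Sch c (γ p ∘ s k) (∂ k (Γ f))
    step′ zero    (s≤s d) = ⊥-elim (ℕₚ.<⇒≱ d z≤n)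
    step′ (suc k) (s≤s d) = Sch-cong (sym (∂-Γ k f)) (Sch-≗ (γ-swap p k) (Sch-Γ (pos ∘ s k) (step k d)))

  -- The range `j ≤ k` is what the induction preserves: at a descent, `s k` brings the value of
  -- position k + 1 into position k, and the hypothesis at level k + 1 covers that position.
  Sch-C : ∀ k {c p f ε} → Sch c p f → (∀ m → m < k → ε m ≡ 0 → ∀ j → m < j → j ≤ k → p m < p j) → C k ε f
  Sch-C zero    _ _ = tt
  Sch-C (suc k) {c} {p} {f} {ε} S@(sch distinct _ flat step) h =
    (λ e → flat k (h k ℕₚ.≤-refl e (suc k) ℕₚ.≤-refl ℕₚ.≤-refl))
    , Sch-C k S (λ m m<k e j m<j j≤k → h m (ℕₚ.m<n⇒m<1+n m<k) e j m<j (ℕₚ.m≤n⇒m≤1+n j≤k))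
    , last
    where
    last : C k ε (∂ k f)
    last with ℕₚ.<-cmp (p k) (p (suc k))
    ... | tri< a _ _ = C-cong k (sym (flat k a)) (C-0 k)
    ... | tri≈ _ e _ = ⊥-elim (distinct k e)
    ... | tri> _ _ d = Sch-C k (step k d) λ m m<k e j m<j j≤k →
            ≡.subst (_< p (s k j)) (≡.cong p (≡.sym (s-low k m m<k))) (go m m<k e j m<j j≤k (j ℕ.≟ k))
      where
      go : ∀ m → m < k → ε m ≡ 0 → ∀ j → m < j → j ≤ k → _ → p m < p (s k j)
      go m m<k e j m<j j≤k (yes ≡.refl) = ≡.subst (λ i → p m < p i) (≡.sym (s-here k))
        (h m (ℕₚ.m<n⇒m<1+n m<k) e (suc k) (ℕₚ.m<n⇒m<1+n m<k) ℕₚ.≤-refl)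
      go m m<k e j m<j j≤k (no j≢k) = ≡.subst (λ i → p m < p i) (≡.sym (s-low k j (ℕₚ.≤∧≢⇒< j≤k j≢k)))
        (h m (ℕₚ.m<n⇒m<1+n m<k) e j m<j (ℕₚ.m≤n⇒m≤1+n j≤k))

  Top-map : ∀ n {Z Z′ f c} → (∀ m → m < n → (Z m → Z′ m) × (Z′ m → Z m)) → Top n Z f c → Top n Z′ f c
  Top-map zero    h t = t
  Top-map (suc n) h (b , a , lt , i , j , t) = b , a , lt , proj₁ (h n ℕₚ.≤-refl) ∘ i , j ∘ proj₂ (h n ℕₚ.≤-refl)
    , Top-map n (λ m m<n → h m (ℕₚ.m<n⇒m<1+n m<n)) t

  -- Converse of `LT-∂`: the difference of the true coefficient and a is free of x (n+1) and killed
  -- by π n, hence zero. Here a has to be free of x n, so that π n fixes it.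
  LT-from-∂ : ∀ n b {f a} → Q (suc n) f ≈ 0# → LT (suc n) b (∂ n f) a → Q n a ≈ 0# → LT n (suc b) f a
  LT-from-∂ n b {f} {a} free lt@(e , z) free-a =
    trans (solve 2 (λ h a → h := a :+ (h :- a)) refl h a) (trans (+-congˡ (π-injective n (h - a)
      (trans (homo-- (Q-additive (suc n)) h a) (trans (+-cong (free-h (suc b)) (-‿cong free-a′)) (-‿inverseʳ 0#)))
      (trans (homo-- (π-additive n) h a) (trans (+-cong (trans (shift b) e) (-‿cong (π-free n a free-a free-a′))) (-‿inverseʳ a))))) (+-identityʳ a))
    , π-injective n _ (free-h (suc (suc b))) (trans (shift (suc b)) z)
    where
    h = Q^ n (suc b) f
    free-a′ : Q (suc n) a ≈ 0#
    free-a′ = LT-free (suc n) b lt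
    free-h : ∀ c → Q (suc n) (Q^ n c f) ≈ 0#
    free-h c = Q^-free (suc n) n c f free
    shift : ∀ c → π n (Q^ n (suc c) f) ≈ Q^ (suc n) c (∂ n f)
    shift c = trans (sym (Q^-π n c (Q n f) (Q^-free (suc n) n 1 f free))) (⟨ Q^-additive (suc n) c ⟩cong (sym (∂-Q n f free)))

  -- If n is an ascent, x n does not occur. If n is the last descent, ∂ n f belongs to `p ∘ s n`,
  -- where position n has no inversion; by induction its leading coefficient in x (n+1) has exponent
  -- 0 in x n, so the leading exponent of x n in f is one more than that of x (n+1) in ∂ n f.
  -- Whether smaller positions carry inversions is unaffected by the swap.
  Sch-Top : ∀ {c p f} → Sch c p f → ∀ n → (∀ j → n ≤ j → p j < p (suc j)) → Free n f × Top n (NoInv p) f c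
  Sch-Top {c} {p} {f} (sch distinct constant flat step) = go
    where
    go : ∀ n → (∀ j → n ≤ j → p j < p (suc j)) → Free n f × Top n (NoInv p) f c
    go zero inc = free-descend 0 f (λ m _ → all-flat m) , value constant
      where
      all-flat : ∀ k → ∂ k f ≈ 0#
      all-flat k = flat k (inc k z≤n)
      value : _ → f ≈ const c
      value (inj₁ (_ , e))     = trans (flat⇒const f all-flat) (reflexive (≡.cong const e))
      value (inj₂ (k , d , _)) = ⊥-elim (ℕₚ.<-asym d (inc k z≤n))
    go (suc n) inc with ℕₚ.<-cmp (p n) (p (suc n))
    ... | tri< a _ _ = extend (go n inc′)
      where
      inc′ : ∀ j → n ≤ j → p j < p (suc j)
      inc′ j n≤j with ℕₚ.m≤n⇒m<n∨m≡n n≤j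
      ... | inj₁ n<j    = inc j n<j
      ... | inj₂ ≡.refl = a
      extend : Free n f × Top n (NoInv p) f c → Free (suc n) f × Top (suc n) (NoInv p) f c
      extend (free , top) = Free-mono (ℕₚ.n≤1+n n) free , 0 , f , (refl , free n ℕₚ.≤-refl)
        , (λ _ → NoInv-from n inc′) , (λ _ → ≡.refl) , top
    ... | tri≈ _ e _ = ⊥-elim (distinct n e)
    ... | tri> _ _ d = free , assemble (proj₂ (Sch-Top (step n d) (2 ℕ.+ n) inc′))
      where
      free : Free (suc n) f
      free = free-descend (suc n) f (λ m le → flat m (inc m le))
      inc′ : ∀ j → 2 ℕ.+ n ≤ j → p (s n j) < p (s n (suc j))
      inc′ j le = ≡.subst₂ (λ a b → p a < p b) (≡.sym (s-high n j le)) (≡.sym (s-high n (suc j) (ℕₚ.m≤n⇒m≤1+n le))) (inc j (ℕₚ.<⇒≤ le))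
      assemble : Top (2 ℕ.+ n) (NoInv (p ∘ s n)) (∂ n f) c → Top (suc n) (NoInv p) f c
      assemble (b , a , lt , _ , _ , b₀ , a₀ , lt₀ , _ , j₀ , t) = finish b₀ lt₀ (j₀ (NoInv-swapped n d inc))
        where
        finish : ∀ b₀ → LT n b₀ a a₀ → b₀ ≡ 0 → Top (suc n) (NoInv p) f c
        finish .0 (e₀ , z₀) ≡.refl = suc b , a₀ , (trans (proj₁ lt′) e₀ , proj₂ lt′) , (λ ())
            , (λ h → ⊥-elim (ℕₚ.<-asym d (h (suc n) ℕₚ.≤-refl)))
            , Top-map n (λ m m<n → NoInv-swap⁻ n m m<n , NoInv-swap n m m<n) t
          where
          lt′ : LT n (suc b) f a
          lt′ = LT-from-∂ n b (free (suc n) ℕₚ.≤-refl) lt z₀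

  Sch-0 : ∀ {p f} → Sch 0ℤ p f → f ≈ 0#
  Sch-0 {p} {f} (sch distinct constant flat step) = trans (flat⇒const f all-flat) (trans (reflexive (≡.cong const (zero′ constant))) const-0)
    where
    all-flat : ∀ k → ∂ k f ≈ 0#
    all-flat k with ℕₚ.<-cmp (p k) (p (suc k))
    ... | tri< a _ _ = flat k a
    ... | tri≈ _ e _ = ⊥-elim (distinct k e)
    ... | tri> _ _ d = Sch-0 (step k d)
    zero′ : _ → ct f ≡ 0ℤ
    zero′ (inj₁ (_ , e))     = e
    zero′ (inj₂ (_ , _ , e)) = e

  Top⇒Lead : ∀ n {Z f c} → Top n Z f c → Lead n f c
  Top⇒Lead zero    t = t
  Top⇒Lead (suc n) (b , a , lt , _ , _ , t) = b , a , lt , Top⇒Lead n t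

  Q^-beyond : ∀ n b d f → Q^ n (suc b) f ≈ 0# → Q^ n (suc b ℕ.+ d) f ≈ 0#
  Q^-beyond n zero    d f h = homo-≈0 (Q^-additive n d) h
  Q^-beyond n (suc b) d f h = Q^-beyond n b d (Q n f) h

  -- Different exponents would put one of the two coefficients beyond the degree and make it zero.
  Lead-unique : ∀ n {f g c d} → f ≈ g → Lead n f c → Lead n g d → c ≢ 0ℤ → d ≢ 0ℤ → c ≡ d
  Lead-unique zero {c = c} {d} h e e′ _ _ = ≡.trans (≡.sym (ct-const c)) (≡.trans (ct-cong (trans (sym e) (trans h e′))) (ct-const d))
  Lead-unique (suc n) {f} {g} h (b , a , (e , z) , l) (b′ , a′ , (e′ , z′) , l′) c≢0 d≢0 with ℕₚ.<-cmp b b′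
  ... | tri≈ _ ≡.refl _ = Lead-unique n (trans (sym e) (trans (⟨ Q^-additive n b ⟩cong h) e′)) l l′ c≢0 d≢0
  ... | tri< lt _ _ = ⊥-elim (d≢0 (Lead-0 n l′ (trans (sym e′) (trans (⟨ Q^-additive n b′ ⟩cong (sym h))
          (≡.subst (λ i → Q^ n i f ≈ 0#) (ℕₚ.m+[n∸m]≡n lt) (Q^-beyond n b (b′ ℕ.∸ suc b) f z))))))
  ... | tri> _ _ gt = ⊥-elim (c≢0 (Lead-0 n l (trans (sym e) (trans (⟨ Q^-additive n b ⟩cong h)
          (≡.subst (λ i → Q^ n i g ≈ 0#) (ℕₚ.m+[n∸m]≡n gt) (Q^-beyond n b′ (b ℕ.∸ suc b′) g z′))))))

  -- Reduced words and the functionals dual to Schubert polynomials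

  data Reduced : (ℕ → ℕ) → List ℕ → Set where
    done : ∀ {p} → Increasing p → Reduced p []
    swap : ∀ {p k ks} → p (suc k) < p k → Reduced (p ∘ s k) ks → Reduced p (k ∷ ks)

  Reduced-≗ : ∀ {p q ks} → p ≗ q → Reduced p ks → Reduced q ks
  Reduced-≗ h (done i)   = done (λ k → ≡.subst₂ _<_ (h k) (h (suc k)) (i k))
  Reduced-≗ h (swap {k = k} d r) = swap (≡.subst₂ _<_ (h (suc k)) (h k) d) (Reduced-≗ (h ∘ s k) r)

  Reduced-γ : ∀ {p ks} → Positive p → Reduced p ks → Reduced (γ p) (map suc ks)
  Reduced-γ pos (done i)   = done (γ-increasing pos i)
  Reduced-γ {p} pos (swap {k = k} d r) = swap (s≤s d) (Reduced-≗ (γ-swap p k) (Reduced-γ (pos ∘ s k) r))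

  Sch-reduced : ∀ {c p f} → Sch c p f → ∃ λ ks → Reduced p ks
  Sch-reduced (sch _ (inj₁ (i , _)) _ _)        = [] , done i
  Sch-reduced (sch _ (inj₂ (k , d , _)) _ step) = k ∷ proj₁ (Sch-reduced (step k d)) , swap d (proj₂ (Sch-reduced (step k d)))

  ∂∗ : List ℕ → Carrier → Carrier
  ∂∗ []       f = f
  ∂∗ (k ∷ ks) f = ∂∗ ks (∂ k f)

  ∂∗-additive : ∀ ks → Additive (∂∗ ks)
  ∂∗-additive []       = id-additive
  ∂∗-additive (k ∷ ks) = ∘-additive (∂∗-additive ks) (∂-additive k)

  -- For a reduced word ks of q this reads off the coefficient of the Schubert polynomial of q
  -- (`κ-same`, `κ-diff`).
  κ : List ℕ → Carrier → ℤ
  κ ks f = ct (∂∗ ks f)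

  κ-cong : ∀ ks {f g} → f ≈ g → κ ks f ≡ κ ks g
  κ-cong ks h = ct-cong (⟨ ∂∗-additive ks ⟩cong h)

  κ-0 : ∀ ks {f} → f ≈ 0# → κ ks f ≡ 0ℤ
  κ-0 ks h = ≡.trans (ct-cong (homo-≈0 (∂∗-additive ks) h)) ct-0

  κ-+ : ∀ ks f g → κ ks (f + g) ≡ κ ks f ℤ.+ κ ks g
  κ-+ ks f g = ≡.trans (ct-cong (homo-+ (∂∗-additive ks) f g)) (ct-+ _ _)

  κ-same : ∀ {c p q f ks} → p ≗ q → Sch c p f → Reduced q ks → κ ks f ≡ c
  κ-same h (sch _ (inj₁ (_ , e)) _ _) (done i) = e
  κ-same h (sch _ (inj₂ (k , d , _)) _ _) (done i) = ⊥-elim (ℕₚ.<-asym d (≡.subst₂ _<_ (≡.sym (h k)) (≡.sym (h (suc k))) (i k)))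
  κ-same h (sch _ _ _ step) (swap {k = k} d r) = κ-same (h ∘ s k) (step k (≡.subst₂ _<_ (≡.sym (h (suc k))) (≡.sym (h k)) d)) r

  -- At a letter k either p ascends and ∂ k kills f, or p and q are both swapped and stay different.
  -- Once the word is used up, q is the identity, so p is not, and the constant term is zero.
  κ-diff : ∀ {c p q f ks} → Perm p → Perm q → ¬ (p ≗ q) → Sch c p f → Reduced q ks → κ ks f ≡ 0ℤ
  κ-diff Pp Pq h (sch _ (inj₁ (i , _)) _ _) (done i′) =
    ⊥-elim (h (λ j → ≡.trans (increasing-id Pp i j) (≡.sym (increasing-id Pq i′ j))))
  κ-diff Pp Pq h (sch _ (inj₂ (_ , _ , e)) _ _) (done _) = e
  κ-diff {c} {p} {q} {f} Pp Pq h (sch distinct _ flat step) (swap {k = k} {ks} d r) with ℕₚ.<-cmp (p k) (p (suc k))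
  ... | tri< a _ _ = κ-0 ks (flat k a)
  ... | tri≈ _ e _ = ⊥-elim (distinct k e)
  ... | tri> _ _ d′ = κ-diff (Perm-swap k Pp) (Perm-swap k Pq)
          (λ e → h (λ j → ≡.trans (≡.cong p (≡.sym (s-involutive k j))) (≡.trans (e (s k j)) (≡.cong q (s-involutive k j))))) (step k d′) r

  κ-ρ : ∀ ks F → κ (map suc ks) F ≡ κ ks (ρ 0 F)
  κ-ρ ks F = ≡.trans (≡.sym (ct-ρ₀ _)) (ct-cong (go ks F))
    where
    go : ∀ ks F → ρ 0 (∂∗ (map suc ks) F) ≈ ∂∗ ks (ρ 0 F)
    go []       F = refl
    go (k ∷ ks) F = trans (go ks (∂ (suc k) F)) (⟨ ∂∗-additive ks ⟩cong (ρ₀-∂ k F))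

  -- Letters other than 0 leave the value at position 0 alone and pass through Γ. That value has to
  -- become 1, so a letter 0 occurs, and there `∂₀-Γ` gives zero.
  κ-Γ : ∀ {p ks} → Perm p → p 0 ≢ 1 → Reduced p ks → ∀ h → κ ks (Γ h) ≡ 0ℤ
  κ-Γ P p0 (done i) h = ⊥-elim (p0 (increasing-id P i 0))
  κ-Γ P p0 (swap {k = zero} {ks} d r) h = κ-0 ks (∂₀-Γ h)
  κ-Γ P p0 (swap {k = suc k} {ks} d r) h = ≡.trans (κ-cong ks (∂-Γ k h)) (κ-Γ (Perm-swap (suc k) P) p0 r (∂ k h))

  -- Multiplicativity of Γ on a pair of Schubert polynomials

  module _ {p q ε δ : ℕ → ℕ} {f g : Carrier} (Pp : Perm p) (Pq : Perm q) (Sp : Sch 1ℤ p f) (Sq : Sch 1ℤ q g) (Θp : IsTheta ε p) (Θq : IsTheta δ q) where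

    private
      Sch-C′ : ∀ n {p f η} → Sch 1ℤ p f → IsTheta η p → C n η f
      Sch-C′ n S Θ = Sch-C n S (λ m _ e j m<j _ → proj₁ (proj₂ Θ m) e j m<j)

      large : ℕ → ℕ
      large k = k ⊔ (size f ⊔ size g ⊔ size (f * g) ⊔ (proj₁ (proj₂ Pp) ⊔ proj₁ (proj₂ Pq)))

      toE : ∀ n → size f ⊔ size g ⊔ size (f * g) ≤ n → Γ f * Γ g ≈ E n f * E n g × Γ (f * g) ≈ E n (f * g)
      toE n le = *-cong (Γ-E n f (ℕₚ.≤-trans (ℕₚ.≤-trans (ℕₚ.m≤m⊔n (size f) (size g)) (ℕₚ.m≤m⊔n (size f ⊔ size g) (size (f * g)))) le))
                        (Γ-E n g (ℕₚ.≤-trans (ℕₚ.≤-trans (ℕₚ.m≤n⊔m (size f) (size g)) (ℕₚ.m≤m⊔n (size f ⊔ size g) (size (f * g)))) le))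
               , Γ-E n (f * g) (ℕₚ.≤-trans (ℕₚ.m≤n⊔m (size f ⊔ size g) (size (f * g))) le)

    Γ-multiplicative : (∀ j → total ε δ j ≤ j) → Γ f * Γ g ≈ Γ (f * g)
    Γ-multiplicative bound = trans (proj₁ e) (trans (E-multiplicative ε δ (proj₁ Θp) (proj₁ Θq) n f g (Sch-C′ n Sp Θp) (Sch-C′ n Sq Θq)
      (λ j _ → bound j)) (sym (proj₂ e)))
      where
      n = size f ⊔ size g ⊔ size (f * g)
      e = toE n ℕₚ.≤-refl

    Γ-not-multiplicative : ∀ k → ε k ≡ 1 → δ k ≡ 1 → total ε δ k ≡ k → (∀ j → j ≤ k → total ε δ j ≤ j) → ¬ (Γ f * Γ g ≈ Γ (f * g))
    Γ-not-multiplicative k εk δk tot bound h = contra (≡.subst (λ n → Free n f × Free n g × C n ε f × C n δ g × Top n (λ j → ε j ≡ 0) f 1ℤ × Top n (λ j → δ j ≡ 0) g 1ℤ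
         × E n f * E n g ≈ E n (f * g)) (≡.sym split)
         ( proj₁ tp , proj₁ tq , Sch-C′ n Sp Θp , Sch-C′ n Sq Θq , Top-map n (λ m _ → proj₂ (proj₂ Θp m) , proj₁ (proj₂ Θp m)) (proj₂ tp)
         , Top-map n (λ m _ → proj₂ (proj₂ Θq m) , proj₁ (proj₂ Θq m)) (proj₂ tq)
         , trans (sym (proj₁ e)) (trans h (proj₂ e))))
      where
      n = large (suc k)
      rest = size f ⊔ size g ⊔ size (f * g) ⊔ (proj₁ (proj₂ Pp) ⊔ proj₁ (proj₂ Pq))
      rest≤n : rest ≤ n
      rest≤n = ℕₚ.m≤n⊔m (suc k) rest
      e = toE n (ℕₚ.≤-trans (ℕₚ.m≤m⊔n (size f ⊔ size g ⊔ size (f * g)) (proj₁ (proj₂ Pp) ⊔ proj₁ (proj₂ Pq))) rest≤n)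
      windows≤n : proj₁ (proj₂ Pp) ⊔ proj₁ (proj₂ Pq) ≤ n
      windows≤n = ℕₚ.≤-trans (ℕₚ.m≤n⊔m (size f ⊔ size g ⊔ size (f * g)) (proj₁ (proj₂ Pp) ⊔ proj₁ (proj₂ Pq))) rest≤n
      tp = Sch-Top Sp n (Perm-increasing Pp n (ℕₚ.m⊔n≤o⇒m≤o (proj₁ (proj₂ Pp)) (proj₁ (proj₂ Pq)) windows≤n))
      tq = Sch-Top Sq n (Perm-increasing Pq n (ℕₚ.m⊔n≤o⇒n≤o (proj₁ (proj₂ Pp)) (proj₁ (proj₂ Pq)) windows≤n))
      m = n ℕ.∸ suc k
      split : suc k ℕ.+ m ≡ n
      split = ℕₚ.m+[n∸m]≡n (ℕₚ.m≤m⊔n (suc k) rest)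
      contra : Free (suc k ℕ.+ m) f × Free (suc k ℕ.+ m) g × C (suc k ℕ.+ m) ε f × C (suc k ℕ.+ m) δ g
        × Top (suc k ℕ.+ m) (λ j → ε j ≡ 0) f 1ℤ × Top (suc k ℕ.+ m) (λ j → δ j ≡ 0) g 1ℤ
        × E (suc k ℕ.+ m) f * E (suc k ℕ.+ m) g ≈ E (suc k ℕ.+ m) (f * g) → ⊥
      contra (ff , fg , cf , cg , tf , tg , eq) = impossible (E-not-multiplicative ε δ (proj₁ Θp) (proj₁ Θq) k εk δk tot bound m {f} {g} ff fg cf cg tf tg eq)
        where
        impossible : 1ℤ ℤ.* 1ℤ ≡ 0ℤ → ⊥
        impossible ()

-- The calculus realised on lists of terms

module Polynomials where

  open ≡ using (refl; sym; trans; cong; cong₂; subst; module ≡-Reasoning)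

  infix 4 _∼_
  record _∼_ (a b : Mono) : Set where
    constructor mk∼
    field at : ∀ k → get0 a k ≡ get0 b k
  open _∼_ public

  ≡ᵇ-sound : ∀ a b → (a ≡ᵇ b) ≡ true → a ≡ b
  ≡ᵇ-sound zero    zero    _ = refl
  ≡ᵇ-sound (suc a) (suc b) h = cong suc (≡ᵇ-sound a b h)

  ≡ᵇ-refl : ∀ a → (a ≡ᵇ a) ≡ true
  ≡ᵇ-refl zero    = refl
  ≡ᵇ-refl (suc a) = ≡ᵇ-refl a

  ∧-split : ∀ a {b} → (a ∧ b) ≡ true → a ≡ true × b ≡ true
  ∧-split true h = refl , h

  eqMon-sound : ∀ a b → eqMon a b ≡ true → a ∼ b
  eqMon-sound []       []       h .at k       = refl
  eqMon-sound []       (b ∷ bs) h .at zero    = sym (≡ᵇ-sound b 0 (proj₁ (∧-split _ h)))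
  eqMon-sound []       (b ∷ bs) h .at (suc k) = at (eqMon-sound [] bs (proj₂ (∧-split (b ≡ᵇ 0) h))) k
  eqMon-sound (a ∷ as) []       h .at zero    = ≡ᵇ-sound a 0 (proj₁ (∧-split _ h))
  eqMon-sound (a ∷ as) []       h .at (suc k) = at (eqMon-sound as [] (proj₂ (∧-split (a ≡ᵇ 0) h))) k
  eqMon-sound (a ∷ as) (b ∷ bs) h .at zero    = ≡ᵇ-sound a b (proj₁ (∧-split _ h))
  eqMon-sound (a ∷ as) (b ∷ bs) h .at (suc k) = at (eqMon-sound as bs (proj₂ (∧-split (a ≡ᵇ b) h))) k

  eqMon-complete : ∀ a b → a ∼ b → eqMon a b ≡ true
  eqMon-complete []       []       h = refl
  eqMon-complete []       (b ∷ bs) h rewrite sym (at h 0) = eqMon-complete [] bs (mk∼ λ k → at h (suc k))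
  eqMon-complete (a ∷ as) []       h rewrite at h 0 = eqMon-complete as [] (mk∼ λ k → at h (suc k))
  eqMon-complete (a ∷ as) (b ∷ bs) h rewrite at h 0 | ≡ᵇ-refl b = eqMon-complete as bs (mk∼ λ k → at h (suc k))

  indicator : Mono → Mono → ℤ
  indicator m e = if eqMon e m then 1ℤ else 0ℤ

  Resp : (Mono → ℤ) → Set
  Resp φ = ∀ {a b} → a ∼ b → φ a ≡ φ b

  indicator-resp : ∀ m → Resp (indicator m)
  indicator-resp m {a} {b} a∼b with eqMon a m in p | eqMon b m in q
  ... | true  | true  = refl
  ... | false | false = refl
  ... | true  | false with trans (sym q) (eqMon-complete b m (mk∼ λ k → trans (sym (at a∼b k)) (at (eqMon-sound a m p) k)))
  ...   | ()
  indicator-resp m {a} {b} a∼b | false | true with trans (sym p) (eqMon-complete a m (mk∼ λ k → trans (at a∼b k) (at (eqMon-sound b m q) k)))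
  ...   | ()

  ⟨_,_⟩ : (Mono → ℤ) → Poly → ℤ
  ⟨ φ , [] ⟩          = 0ℤ
  ⟨ φ , (c , e) ∷ p ⟩ = c ℤ.* φ e ℤ.+ ⟨ φ , p ⟩

  -- Polynomials are compared by pairing with all functionals on monomials; this makes the ring
  -- laws bilinear bookkeeping.
  infix 4 _≋_
  record _≋_ (p q : Poly) : Set where
    constructor mk≋
    field pair : ∀ φ → Resp φ → ⟨ φ , p ⟩ ≡ ⟨ φ , q ⟩
  open _≋_ public

  pair-cong : ∀ {φ ψ} → (∀ e → φ e ≡ ψ e) → ∀ p → ⟨ φ , p ⟩ ≡ ⟨ ψ , p ⟩
  pair-cong h []            = refl
  pair-cong h ((c , e) ∷ p) = cong₂ (λ a b → c ℤ.* a ℤ.+ b) (h e) (pair-cong h p)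

  pair-++ : ∀ φ p q → ⟨ φ , p ++ q ⟩ ≡ ⟨ φ , p ⟩ ℤ.+ ⟨ φ , q ⟩
  pair-++ φ []            q = sym (ℤₚ.+-identityˡ _)
  pair-++ φ ((c , e) ∷ p) q = trans (cong (λ t → c ℤ.* φ e ℤ.+ t) (pair-++ φ p q)) (sym (ℤₚ.+-assoc (c ℤ.* φ e) _ _))

  pair-scale : ∀ φ c p → ⟨ φ , scaleP c p ⟩ ≡ c ℤ.* ⟨ φ , p ⟩
  pair-scale φ c []            = sym (ℤₚ.*-zeroʳ c)
  pair-scale φ c ((d , e) ∷ p) = trans (cong (λ t → c ℤ.* d ℤ.* φ e ℤ.+ t) (pair-scale φ c p)) (lemma c d (φ e) ⟨ φ , p ⟩)
    where
    lemma : ∀ c d x y → c ℤ.* d ℤ.* x ℤ.+ c ℤ.* y ≡ c ℤ.* (d ℤ.* x ℤ.+ y)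
    lemma = solve-∀

  pair-+ : ∀ φ ψ p → ⟨ (λ e → φ e ℤ.+ ψ e) , p ⟩ ≡ ⟨ φ , p ⟩ ℤ.+ ⟨ ψ , p ⟩
  pair-+ φ ψ []            = refl
  pair-+ φ ψ ((c , e) ∷ p) = trans (cong (λ t → c ℤ.* (φ e ℤ.+ ψ e) ℤ.+ t) (pair-+ φ ψ p)) (lemma c (φ e) (ψ e) _ _)
    where
    lemma : ∀ c a b x y → c ℤ.* (a ℤ.+ b) ℤ.+ (x ℤ.+ y) ≡ c ℤ.* a ℤ.+ x ℤ.+ (c ℤ.* b ℤ.+ y)
    lemma = solve-∀

  pair-* : ∀ φ k p → ⟨ (λ e → k ℤ.* φ e) , p ⟩ ≡ k ℤ.* ⟨ φ , p ⟩
  pair-* φ k []            = sym (ℤₚ.*-zeroʳ k)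
  pair-* φ k ((c , e) ∷ p) = trans (cong (λ t → c ℤ.* (k ℤ.* φ e) ℤ.+ t) (pair-* φ k p)) (lemma c k (φ e) _)
    where
    lemma : ∀ c k x y → c ℤ.* (k ℤ.* x) ℤ.+ k ℤ.* y ≡ k ℤ.* (c ℤ.* x ℤ.+ y)
    lemma = solve-∀

  pair-0 : ∀ p → ⟨ (λ _ → 0ℤ) , p ⟩ ≡ 0ℤ
  pair-0 []            = refl
  pair-0 ((c , e) ∷ p) = trans (cong₂ ℤ._+_ (ℤₚ.*-zeroʳ c) (pair-0 p)) refl

  -- Fubini for the pairing; commutativity of the product rests on it.
  pair-swap : ∀ (F : Mono → Mono → ℤ) p q →
    ⟨ (λ e → ⟨ F e , q ⟩) , p ⟩ ≡ ⟨ (λ f → ⟨ (λ e → F e f) , p ⟩) , q ⟩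
  pair-swap F []            q = sym (pair-0 q)
  pair-swap F ((c , e) ∷ p) q = sym (trans (pair-+ (λ f → c ℤ.* F e f) (λ f → ⟨ (λ e′ → F e′ f) , p ⟩) q)
    (cong₂ ℤ._+_ (pair-* (F e) c q) (sym (pair-swap F p q))))

  pair-*P : ∀ φ p q → ⟨ φ , p *P q ⟩ ≡ ⟨ (λ e → ⟨ (λ f → φ (addMon e f)) , q ⟩) , p ⟩
  pair-*P φ []            q = refl
  pair-*P φ ((c , e) ∷ p) q = trans (pair-++ φ (map _ q) (p *P q)) (cong₂ ℤ._+_ (row q) (pair-*P φ p q))
    where
    lemma : ∀ c d x y → c ℤ.* d ℤ.* x ℤ.+ c ℤ.* y ≡ c ℤ.* (d ℤ.* x ℤ.+ y)
    lemma = solve-∀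
    row : ∀ q → ⟨ φ , map (λ s → (c ℤ.* proj₁ s , addMon e (proj₂ s))) q ⟩ ≡ c ℤ.* ⟨ (λ f → φ (addMon e f)) , q ⟩
    row []            = sym (ℤₚ.*-zeroʳ c)
    row ((d , f) ∷ q) = trans (cong (λ t → c ℤ.* d ℤ.* φ (addMon e f) ℤ.+ t) (row q)) (lemma c d _ _)

  get0-addMon : ∀ a b k → get0 (addMon a b) k ≡ get0 a k ℕ.+ get0 b k
  get0-addMon []       b        k       = refl
  get0-addMon (a ∷ as) []       k       = sym (ℕₚ.+-identityʳ _)
  get0-addMon (a ∷ as) (b ∷ bs) zero    = refl
  get0-addMon (a ∷ as) (b ∷ bs) (suc k) = get0-addMon as bs k

  addMon-comm : ∀ a b → addMon a b ∼ addMon b a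
  addMon-comm a b .at k = trans (get0-addMon a b k) (trans (ℕₚ.+-comm (get0 a k) _) (sym (get0-addMon b a k)))

  addMon-assoc : ∀ a b c → addMon (addMon a b) c ∼ addMon a (addMon b c)
  addMon-assoc a b c .at k = begin
    get0 (addMon (addMon a b) c) k          ≡⟨ get0-addMon (addMon a b) c k ⟩
    get0 (addMon a b) k ℕ.+ get0 c k        ≡⟨ cong (ℕ._+ get0 c k) (get0-addMon a b k) ⟩
    get0 a k ℕ.+ get0 b k ℕ.+ get0 c k      ≡⟨ ℕₚ.+-assoc (get0 a k) _ _ ⟩
    get0 a k ℕ.+ (get0 b k ℕ.+ get0 c k)    ≡⟨ cong (get0 a k ℕ.+_) (get0-addMon b c k) ⟨
    get0 a k ℕ.+ get0 (addMon b c) k        ≡⟨ get0-addMon a (addMon b c) k ⟨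
    get0 (addMon a (addMon b c)) k ∎
    where open ≡-Reasoning

  addMon-congˡ : ∀ {a b} c → a ∼ b → addMon a c ∼ addMon b c
  addMon-congˡ {a} {b} c h .at k = trans (get0-addMon a c k) (trans (cong (ℕ._+ get0 c k) (at h k)) (sym (get0-addMon b c k)))

  addMon-congʳ : ∀ {a b} c → a ∼ b → addMon c a ∼ addMon c b
  addMon-congʳ {a} {b} c h .at k = trans (get0-addMon c a k) (trans (cong (get0 c k ℕ.+_) (at h k)) (sym (get0-addMon c b k)))

  const : ℤ → Poly
  const c = (c , []) ∷ []

  *P-cong : ∀ {p p′ q q′} → p ≋ p′ → q ≋ q′ → p *P q ≋ p′ *P q′
  *P-cong {p} {p′} {q} {q′} hp hq .pair φ rφ = begin
    ⟨ φ , p *P q ⟩                                      ≡⟨ pair-*P φ p q ⟩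
    ⟨ (λ e → ⟨ (λ f → φ (addMon e f)) , q ⟩) , p ⟩      ≡⟨ pair-cong (λ e → pair hq _ (λ h → rφ (addMon-congʳ e h))) p ⟩
    ⟨ (λ e → ⟨ (λ f → φ (addMon e f)) , q′ ⟩) , p ⟩     ≡⟨ pair hp _ (λ h → pair-cong (λ f → rφ (addMon-congˡ f h)) q′) ⟩
    ⟨ (λ e → ⟨ (λ f → φ (addMon e f)) , q′ ⟩) , p′ ⟩    ≡⟨ pair-*P φ p′ q′ ⟨
    ⟨ φ , p′ *P q′ ⟩ ∎
    where open ≡-Reasoning

  *P-comm : ∀ p q → p *P q ≋ q *P p
  *P-comm p q .pair φ rφ = begin
    ⟨ φ , p *P q ⟩                                    ≡⟨ pair-*P φ p q ⟩
    ⟨ (λ e → ⟨ (λ f → φ (addMon e f)) , q ⟩) , p ⟩    ≡⟨ pair-swap (λ e f → φ (addMon e f)) p q ⟩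
    ⟨ (λ f → ⟨ (λ e → φ (addMon e f)) , p ⟩) , q ⟩    ≡⟨ pair-cong (λ f → pair-cong (λ e → rφ (addMon-comm e f)) p) q ⟩
    ⟨ (λ f → ⟨ (λ e → φ (addMon f e)) , p ⟩) , q ⟩    ≡⟨ pair-*P φ q p ⟨
    ⟨ φ , q *P p ⟩ ∎
    where open ≡-Reasoning

  *P-assoc : ∀ p q r → (p *P q) *P r ≋ p *P (q *P r)
  *P-assoc p q r .pair φ rφ = begin
    ⟨ φ , (p *P q) *P r ⟩                             ≡⟨ pair-*P φ (p *P q) r ⟩
    ⟨ (λ e → ⟨ (λ g → φ (addMon e g)) , r ⟩) , p *P q ⟩ ≡⟨ pair-*P _ p q ⟩
    ⟨ (λ e → ⟨ (λ f → ⟨ (λ g → φ (addMon (addMon e f) g)) , r ⟩) , q ⟩) , p ⟩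
      ≡⟨ pair-cong (λ e → pair-cong (λ f → pair-cong (λ g → rφ (addMon-assoc e f g)) r) q) p ⟩
    ⟨ (λ e → ⟨ (λ f → ⟨ (λ g → φ (addMon e (addMon f g))) , r ⟩) , q ⟩) , p ⟩
      ≡⟨ pair-cong (λ e → pair-*P (λ f → φ (addMon e f)) q r) p ⟨
    ⟨ (λ e → ⟨ (λ f → φ (addMon e f)) , q *P r ⟩) , p ⟩ ≡⟨ pair-*P φ p (q *P r) ⟨
    ⟨ φ , p *P (q *P r) ⟩ ∎
    where open ≡-Reasoning

  pair-const* : ∀ φ c p → ⟨ φ , const c *P p ⟩ ≡ c ℤ.* ⟨ φ , p ⟩
  pair-const* φ c p = trans (pair-*P φ (const c) p) (ℤₚ.+-identityʳ _)

  *P-identityˡ : ∀ p → const 1ℤ *P p ≋ p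
  *P-identityˡ p .pair φ _ = trans (pair-const* φ 1ℤ p) (ℤₚ.*-identityˡ _)

  *P-distribʳ : ∀ r p q → (p ++ q) *P r ≋ p *P r ++ q *P r
  *P-distribʳ r p q .pair φ _ = begin
    ⟨ φ , (p ++ q) *P r ⟩                     ≡⟨ pair-*P φ (p ++ q) r ⟩
    ⟨ _ , p ++ q ⟩                            ≡⟨ pair-++ _ p q ⟩
    ⟨ _ , p ⟩ ℤ.+ ⟨ _ , q ⟩                   ≡⟨ cong₂ ℤ._+_ (pair-*P φ p r) (pair-*P φ q r) ⟨
    ⟨ φ , p *P r ⟩ ℤ.+ ⟨ φ , q *P r ⟩         ≡⟨ pair-++ φ (p *P r) (q *P r) ⟨
    ⟨ φ , p *P r ++ q *P r ⟩ ∎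
    where open ≡-Reasoning

  ≋-refl : ∀ {p} → p ≋ p
  ≋-refl .pair _ _ = refl

  ≋-sym : ∀ {p q} → p ≋ q → q ≋ p
  ≋-sym h .pair φ r = sym (pair h φ r)

  ≋-trans : ∀ {p q r} → p ≋ q → q ≋ r → p ≋ r
  ≋-trans h k .pair φ r = trans (pair h φ r) (pair k φ r)

  ++-cong : ∀ {p p′ q q′} → p ≋ p′ → q ≋ q′ → p ++ q ≋ p′ ++ q′
  ++-cong {p} {p′} {q} {q′} hp hq .pair φ r =
    trans (pair-++ φ p q) (trans (cong₂ ℤ._+_ (pair hp φ r) (pair hq φ r)) (sym (pair-++ φ p′ q′)))

  ++-comm : ∀ p q → p ++ q ≋ q ++ p
  ++-comm p q .pair φ _ = trans (pair-++ φ p q) (trans (ℤₚ.+-comm _ ⟨ φ , q ⟩) (sym (pair-++ φ q p)))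

  polyRing : CommutativeRing _ _
  polyRing = record
    { Carrier = Poly ; _≈_ = _≋_ ; _+_ = _++_ ; _*_ = _*P_ ; -_ = scaleP (ℤ.- 1ℤ) ; 0# = [] ; 1# = const 1ℤ
    ; isCommutativeRing = record
      { isRing = record
        { +-isAbelianGroup = record
          { isGroup = record
            { isMonoid = record
              { isSemigroup = record
                { isMagma = record
                  { isEquivalence = record { refl = ≋-refl ; sym = ≋-sym ; trans = ≋-trans }
                  ; ∙-cong = ++-cong }
                ; assoc = λ p q r → ≡⇒≋ (++-assoc p q r) }
              ; identity = (λ p → ≋-refl) , λ p → ≡⇒≋ (++-identityʳ p) }
            ; inverse = inverseˡ , λ p → ≋-trans (++-comm p _) (inverseˡ p)
            ; ⁻¹-cong = λ {p} {q} h → mk≋ λ φ r →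
                trans (pair-scale φ (ℤ.- 1ℤ) p) (trans (cong ((ℤ.- 1ℤ) ℤ.*_) (pair h φ r)) (sym (pair-scale φ (ℤ.- 1ℤ) q))) }
          ; comm = ++-comm }
        ; *-cong = *P-cong
        ; *-assoc = *P-assoc
        ; *-identity = *P-identityˡ , λ p → ≋-trans (*P-comm p _) (*P-identityˡ p)
        ; distrib = (λ p q r → ≋-trans (*P-comm p (q ++ r)) (≋-trans (*P-distribʳ p q r)
                       (++-cong (*P-comm q p) (*P-comm r p))))
                  , *P-distribʳ }
      ; *-comm = *P-comm } }
    where
    ≡⇒≋ : ∀ {p q} → p ≡ q → p ≋ q
    ≡⇒≋ refl = ≋-refl
    neg : ∀ x → ℤ.- 1ℤ ℤ.* x ℤ.+ x ≡ 0ℤ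
    neg = solve-∀
    inverseˡ : ∀ p → scaleP (ℤ.- 1ℤ) p ++ p ≋ []
    inverseˡ p .pair φ _ = trans (pair-++ φ (scaleP (ℤ.- 1ℤ) p) p) (trans (cong (ℤ._+ ⟨ φ , p ⟩) (pair-scale φ (ℤ.- 1ℤ) p)) (neg ⟨ φ , p ⟩))

  remove : Mono → Poly → Poly
  remove m []            = []
  remove m ((c , e) ∷ p) = if eqMon e m then remove m p else (c , e) ∷ remove m p

  remove-length : ∀ m p → length (remove m p) ≤ length p
  remove-length m []            = z≤n
  remove-length m ((c , e) ∷ p) with eqMon e m
  ... | true  = ℕₚ.m≤n⇒m≤1+n (remove-length m p)
  ... | false = s≤s (remove-length m p)

  pair-remove : ∀ φ → Resp φ → ∀ m p → ⟨ φ , p ⟩ ≡ coeff p m ℤ.* φ m ℤ.+ ⟨ φ , remove m p ⟩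
  pair-remove φ r m []            = refl
  pair-remove φ r m ((c , e) ∷ p) with eqMon e m in eq
  ... | true  = trans (cong₂ (λ a b → c ℤ.* a ℤ.+ b) (r (eqMon-sound e m eq)) (pair-remove φ r m p))
                      (lemma c (φ m) (coeff p m) _)
    where
    lemma : ∀ c x d y → c ℤ.* x ℤ.+ (d ℤ.* x ℤ.+ y) ≡ (c ℤ.+ d) ℤ.* x ℤ.+ y
    lemma = solve-∀
  ... | false = trans (cong (λ t → c ℤ.* φ e ℤ.+ t) (pair-remove φ r m p)) (lemma c (φ e) (coeff p m) (φ m) _)
    where
    lemma : ∀ c x d y z → c ℤ.* x ℤ.+ (d ℤ.* y ℤ.+ z) ≡ (0ℤ ℤ.+ d) ℤ.* y ℤ.+ (c ℤ.* x ℤ.+ z)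
    lemma = solve-∀

  coeff-pair : ∀ p m → coeff p m ≡ ⟨ indicator m , p ⟩
  coeff-pair []            m = refl
  coeff-pair ((c , e) ∷ p) m = cong₂ ℤ._+_ (lemma (eqMon e m)) (coeff-pair p m)
    where
    lemma : ∀ b → (if b then c else 0ℤ) ≡ c ℤ.* (if b then 1ℤ else 0ℤ)
    lemma true  = sym (ℤₚ.*-identityʳ c)
    lemma false = sym (ℤₚ.*-zeroʳ c)

  -- All terms with the monomial of the first term are removed at once: their total coefficient is
  -- zero, the remaining list is strictly shorter, and its coefficients are still zero.
  pair-null : ∀ φ → Resp φ → ∀ n p → length p ≤ n → (∀ m → coeff p m ≡ 0ℤ) → ⟨ φ , p ⟩ ≡ 0ℤ
  pair-null φ r n       []              _       null = refl
  pair-null φ r (suc n) P@((c , e) ∷ p) (s≤s l) null = begin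
    ⟨ φ , P ⟩                                       ≡⟨ pair-remove φ r e P ⟩
    coeff P e ℤ.* φ e ℤ.+ ⟨ φ , remove e P ⟩        ≡⟨ cong (λ t → t ℤ.* φ e ℤ.+ ⟨ φ , remove e P ⟩) (null e) ⟩
    0ℤ ℤ.+ ⟨ φ , remove e P ⟩                       ≡⟨ ℤₚ.+-identityˡ _ ⟩
    ⟨ φ , remove e P ⟩                              ≡⟨ pair-null φ r n (remove e P) shorter null′ ⟩
    0ℤ ∎
    where
    open ≡-Reasoning
    shorter : length (remove e P) ≤ n
    shorter rewrite eqMon-complete e e (mk∼ λ _ → refl) = ℕₚ.≤-trans (remove-length e p) l
    null′ : ∀ m → coeff (remove e P) m ≡ 0ℤ
    null′ m = begin
      coeff (remove e P) m                                          ≡⟨ coeff-pair (remove e P) m ⟩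
      ⟨ indicator m , remove e P ⟩                                  ≡⟨ ℤₚ.+-identityˡ _ ⟨
      0ℤ ℤ.* indicator m e ℤ.+ ⟨ indicator m , remove e P ⟩         ≡⟨ cong (λ t → t ℤ.* indicator m e ℤ.+ ⟨ indicator m , remove e P ⟩) (null e) ⟨
      coeff P e ℤ.* indicator m e ℤ.+ ⟨ indicator m , remove e P ⟩  ≡⟨ pair-remove (indicator m) (indicator-resp m) e P ⟨
      ⟨ indicator m , P ⟩                                           ≡⟨ coeff-pair P m ⟨
      coeff P m                                                     ≡⟨ null m ⟩
      0ℤ ∎

  ≈P⇒≋ : ∀ {p q} → p ≈P q → p ≋ q
  ≈P⇒≋ {p} {q} h .pair φ r = ℤₚ.i-j≡0⇒i≡j _ _ (begin
    ⟨ φ , p ⟩ ℤ.- ⟨ φ , q ⟩        ≡⟨ difference φ ⟨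
    ⟨ φ , p ++ scaleP (ℤ.- 1ℤ) q ⟩ ≡⟨ pair-null φ r _ (p ++ scaleP (ℤ.- 1ℤ) q) ℕₚ.≤-refl null ⟩
    0ℤ ∎)
    where
    open ≡-Reasoning
    lemma : ∀ x y → x ℤ.+ ℤ.- 1ℤ ℤ.* y ≡ x ℤ.- y
    lemma = solve-∀
    difference : ∀ φ → ⟨ φ , p ++ scaleP (ℤ.- 1ℤ) q ⟩ ≡ ⟨ φ , p ⟩ ℤ.- ⟨ φ , q ⟩
    difference φ = trans (pair-++ φ p _) (trans (cong (λ t → ⟨ φ , p ⟩ ℤ.+ t) (pair-scale φ (ℤ.- 1ℤ) q)) (lemma ⟨ φ , p ⟩ ⟨ φ , q ⟩))
    null : ∀ m → coeff (p ++ scaleP (ℤ.- 1ℤ) q) m ≡ 0ℤ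
    null m = begin
      coeff (p ++ scaleP (ℤ.- 1ℤ) q) m                ≡⟨ coeff-pair (p ++ scaleP (ℤ.- 1ℤ) q) m ⟩
      ⟨ indicator m , p ++ scaleP (ℤ.- 1ℤ) q ⟩        ≡⟨ difference (indicator m) ⟩
      ⟨ indicator m , p ⟩ ℤ.- ⟨ indicator m , q ⟩     ≡⟨ cong₂ ℤ._-_ (coeff-pair p m) (coeff-pair q m) ⟨
      coeff p m ℤ.- coeff q m                         ≡⟨ ℤₚ.i≡j⇒i-j≡0 (h m) ⟩
      0ℤ ∎

  -- Variables, quotients and elimination on monomials

  unit : ℕ → Mono
  unit j = set0 [] j 1

  x : ℕ → Poly
  x j = (1ℤ , unit j) ∷ []

  get0-set0-same : ∀ e n a → get0 (set0 e n a) n ≡ a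
  get0-set0-same []      zero    a = refl
  get0-set0-same []      (suc n) a = get0-set0-same [] n a
  get0-set0-same (b ∷ e) zero    a = refl
  get0-set0-same (b ∷ e) (suc n) a = get0-set0-same e n a

  get0-set0-diff : ∀ e n a k → k ≢ n → get0 (set0 e n a) k ≡ get0 e k
  get0-set0-diff []      zero    a zero    h = ⊥-elim (h refl)
  get0-set0-diff []      zero    a (suc k) h = refl
  get0-set0-diff []      (suc n) a zero    h = refl
  get0-set0-diff []      (suc n) a (suc k) h = get0-set0-diff [] n a k (h ∘ cong suc)
  get0-set0-diff (b ∷ e) zero    a zero    h = ⊥-elim (h refl)
  get0-set0-diff (b ∷ e) zero    a (suc k) h = refl
  get0-set0-diff (b ∷ e) (suc n) a zero    h = refl
  get0-set0-diff (b ∷ e) (suc n) a (suc k) h = get0-set0-diff e n a k (h ∘ cong suc)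

  get0-bump-same : ∀ j e → get0 (addMon (unit j) e) j ≡ suc (get0 e j)
  get0-bump-same j e = trans (get0-addMon (unit j) e j) (cong (ℕ._+ get0 e j) (get0-set0-same [] j 1))

  get0-bump-diff : ∀ j e k → k ≢ j → get0 (addMon (unit j) e) k ≡ get0 e k
  get0-bump-diff j e k h = trans (get0-addMon (unit j) e k) (cong (ℕ._+ get0 e k) (get0-set0-diff [] j 1 k h))

  pair-x : ∀ φ j p → ⟨ φ , x j *P p ⟩ ≡ ⟨ (λ e → φ (addMon (unit j) e)) , p ⟩
  pair-x φ j p = trans (pair-*P φ (x j) p) (trans (ℤₚ.+-identityʳ _) (ℤₚ.*-identityˡ _))

  linear : (Mono → Poly) → Poly → Poly
  linear t []            = []
  linear t ((c , e) ∷ p) = scaleP c (t e) ++ linear t p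

  pair-linear : ∀ φ t p → ⟨ φ , linear t p ⟩ ≡ ⟨ (λ e → ⟨ φ , t e ⟩) , p ⟩
  pair-linear φ t []            = refl
  pair-linear φ t ((c , e) ∷ p) = trans (pair-++ φ (scaleP c (t e)) (linear t p))
    (cong₂ ℤ._+_ (pair-scale φ c (t e)) (pair-linear φ t p))

  linear-cong : ∀ t → (∀ {e e′} → e ∼ e′ → t e ≋ t e′) → ∀ {p q} → p ≋ q → linear t p ≋ linear t q
  linear-cong t ht {p} {q} h .pair φ r = trans (pair-linear φ t p)
    (trans (pair h _ (λ e∼e′ → pair (ht e∼e′) φ r)) (sym (pair-linear φ t q)))

  linear-++ : ∀ t p q → linear t (p ++ q) ≋ linear t p ++ linear t q
  linear-++ t p q .pair φ r = trans (pair-linear φ t (p ++ q)) (trans (pair-++ _ p q)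
    (trans (sym (cong₂ ℤ._+_ (pair-linear φ t p) (pair-linear φ t q))) (sym (pair-++ φ (linear t p) (linear t q)))))

  monomial : Mono → Poly
  monomial e = (1ℤ , e) ∷ []

  monomial-cong : ∀ {e e′} → e ∼ e′ → monomial e ≋ monomial e′
  monomial-cong h .pair φ r = cong (λ t → 1ℤ ℤ.* t ℤ.+ 0ℤ) (r h)

  pair-monomial : ∀ φ e → ⟨ φ , monomial e ⟩ ≡ φ e
  pair-monomial φ e = trans (ℤₚ.+-identityʳ _) (ℤₚ.*-identityˡ _)

  lower : ℕ → Mono → ℕ → Poly
  lower n e zero    = []
  lower n e (suc a) = monomial (set0 e n a)

  Q : ℕ → Poly → Poly
  Q n = linear (λ e → lower n e (get0 e n))

  set0-cong : ∀ {e e′} n a → e ∼ e′ → set0 e n a ∼ set0 e′ n a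
  set0-cong {e} {e′} n a h .at k with k ℕ.≟ n
  ... | yes refl = trans (get0-set0-same e k a) (sym (get0-set0-same e′ k a))
  ... | no  k≢n  = trans (get0-set0-diff e n a k k≢n) (trans (at h k) (sym (get0-set0-diff e′ n a k k≢n)))

  Q-cong : ∀ n {p q} → p ≋ q → Q n p ≋ Q n q
  Q-cong n = linear-cong _ λ {e} {e′} h → subst (λ a → lower n e (get0 e n) ≋ lower n e′ a) (at h n) (go h (get0 e n))
    where
    go : ∀ {e e′} → e ∼ e′ → ∀ a → lower n e a ≋ lower n e′ a
    go h zero    = ≋-refl
    go h (suc a) = monomial-cong (set0-cong n a h)

  Q-same : ∀ n p → Q n (x n *P p) ≋ p
  Q-same n p .pair φ r = trans (pair-linear φ _ (x n *P p)) (trans (pair-x _ n p) (pair-cong pointwise p))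
    where
    restore : ∀ e → set0 (addMon (unit n) e) n (get0 e n) ∼ e
    restore e .at k with k ℕ.≟ n
    ... | yes refl = get0-set0-same (addMon (unit n) e) n _
    ... | no  k≢n  = trans (get0-set0-diff (addMon (unit n) e) n _ k k≢n) (get0-bump-diff n e k k≢n)
    pointwise : ∀ e → ⟨ φ , lower n (addMon (unit n) e) (get0 (addMon (unit n) e) n) ⟩ ≡ φ e
    pointwise e rewrite get0-bump-same n e = trans (pair-monomial φ _) (r (restore e))

  bump-set0 : ∀ n j → j ≢ n → ∀ e a → set0 (addMon (unit j) e) n a ∼ addMon (unit j) (set0 e n a)
  bump-set0 n j j≢n e a .at k with k ℕ.≟ n
  ... | yes refl = trans (get0-set0-same (addMon (unit j) e) n a)
                     (sym (trans (get0-bump-diff j (set0 e n a) n (j≢n ∘ sym)) (get0-set0-same e n a)))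
  ... | no  k≢n  = trans (get0-set0-diff (addMon (unit j) e) n a k k≢n) (trans (get0-addMon (unit j) e k)
                     (sym (trans (get0-addMon (unit j) (set0 e n a) k) (cong (get0 (unit j) k ℕ.+_) (get0-set0-diff e n a k k≢n)))))

  Q-diff : ∀ n j p → j ≢ n → Q n (x j *P p) ≋ x j *P Q n p
  Q-diff n j p j≢n .pair φ r = trans (pair-linear φ _ (x j *P p)) (trans (pair-x _ j p)
    (trans (pair-cong pointwise p) (trans (sym (pair-linear _ _ p)) (sym (pair-x φ j (Q n p))))))
    where
    go : ∀ e a → ⟨ φ , lower n (addMon (unit j) e) a ⟩ ≡ ⟨ (λ e′ → φ (addMon (unit j) e′)) , lower n e a ⟩
    go e zero    = refl
    go e (suc a) = cong (λ t → 1ℤ ℤ.* t ℤ.+ 0ℤ) (r (bump-set0 n j j≢n e a))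
    pointwise : ∀ e → ⟨ φ , lower n (addMon (unit j) e) (get0 (addMon (unit j) e) n) ⟩
                    ≡ ⟨ (λ e′ → φ (addMon (unit j) e′)) , lower n e (get0 e n) ⟩
    pointwise e rewrite get0-bump-diff j e n (j≢n ∘ sym) = go e (get0 e n)

  Q-const : ∀ n c → Q n (const c) ≋ []
  Q-const n c = ≋-refl

  delete : ℕ → Mono → Mono
  delete _       []      = []
  delete zero    (a ∷ e) = e
  delete (suc i) (a ∷ e) = a ∷ delete i e

  get0-delete : ∀ i e k → get0 (delete i e) k ≡ get0 e (skip i k)
  get0-delete i       []      k       = refl
  get0-delete zero    (a ∷ e) k       = refl
  get0-delete (suc i) (a ∷ e) zero    = refl
  get0-delete (suc i) (a ∷ e) (suc k) = get0-delete i e k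

  skip≢ : ∀ i k → skip i k ≢ i
  skip≢ (suc i) (suc k) h = skip≢ i k (ℕₚ.suc-injective h)

  get0-unit-skip : ∀ i j k → get0 (unit (skip i j)) (skip i k) ≡ get0 (unit j) k
  get0-unit-skip zero    j       k       = refl
  get0-unit-skip (suc i) zero    zero    = refl
  get0-unit-skip (suc i) zero    (suc k) = refl
  get0-unit-skip (suc i) (suc j) zero    = refl
  get0-unit-skip (suc i) (suc j) (suc k) = get0-unit-skip i j k

  erase : ℕ → Mono → ℕ → Poly
  erase i e zero    = monomial (delete i e)
  erase i e (suc _) = []

  ρ : ℕ → Poly → Poly
  ρ i = linear (λ e → erase i e (get0 e i))

  ρ-cong : ∀ n {p q} → p ≋ q → ρ n p ≋ ρ n q
  ρ-cong n = linear-cong _ λ {e} {e′} h → subst (λ a → erase n e (get0 e n) ≋ erase n e′ a) (at h n) (go h (get0 e n))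
    where
    go : ∀ {e e′} → e ∼ e′ → ∀ a → erase n e a ≋ erase n e′ a
    go {e} {e′} h zero    = monomial-cong (mk∼ λ k → trans (get0-delete n e k) (trans (at h _) (sym (get0-delete n e′ k))))
    go h (suc a) = ≋-refl

  ρ-same : ∀ i p → ρ i (x i *P p) ≋ []
  ρ-same i p .pair φ r = trans (pair-linear φ _ (x i *P p)) (trans (pair-x _ i p) (trans (pair-cong pointwise p) (pair-0 p)))
    where
    pointwise : ∀ e → ⟨ φ , erase i (addMon (unit i) e) (get0 (addMon (unit i) e) i) ⟩ ≡ 0ℤ
    pointwise e rewrite get0-bump-same i e = refl

  ρ-skip : ∀ i j p → ρ i (x (skip i j) *P p) ≋ x j *P ρ i p
  ρ-skip i j p .pair φ r = trans (pair-linear φ _ (x (skip i j) *P p)) (trans (pair-x _ (skip i j) p)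
    (trans (pair-cong pointwise p) (trans (sym (pair-linear _ _ p)) (sym (pair-x φ j (ρ i p))))))
    where
    shift : ∀ e → delete i (addMon (unit (skip i j)) e) ∼ addMon (unit j) (delete i e)
    shift e .at k = trans (get0-delete i (addMon (unit (skip i j)) e) k) (trans (get0-addMon (unit (skip i j)) e (skip i k))
      (sym (trans (get0-addMon (unit j) (delete i e) k) (cong₂ ℕ._+_ (sym (get0-unit-skip i j k)) (get0-delete i e k)))))
    go : ∀ e a → ⟨ φ , erase i (addMon (unit (skip i j)) e) a ⟩ ≡ ⟨ (λ e′ → φ (addMon (unit j) e′)) , erase i e a ⟩
    go e zero    = cong (λ t → 1ℤ ℤ.* t ℤ.+ 0ℤ) (r (shift e))
    go e (suc a) = refl
    pointwise : ∀ e → ⟨ φ , erase i (addMon (unit (skip i j)) e) (get0 (addMon (unit (skip i j)) e) i) ⟩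
                    ≡ ⟨ (λ e′ → φ (addMon (unit j) e′)) , erase i e (get0 e i) ⟩
    pointwise e rewrite get0-bump-diff (skip i j) e i (skip≢ i j ∘ sym) = go e (get0 e i)

  ρ-const : ∀ i c → ρ i (const c) ≋ const c
  ρ-const i c .pair φ r = cong (λ t → t ℤ.* φ [] ℤ.+ 0ℤ) (ℤₚ.*-identityʳ c)

  -- Divided differences as sums over antidiagonals

  diagonal : ℕ → (ℕ → ℕ → ℤ) → ℤ
  diagonal zero    ψ = ψ 0 0
  diagonal (suc n) ψ = ψ (suc n) 0 ℤ.+ diagonal n (λ a b → ψ a (suc b))

  -- `diagonal` peels the antidiagonal a + b = n from the end (n, 0); when the exponent of y is the
  -- larger one, the product rules peel it from (0, n).
  diagonal-last : ∀ n ψ → diagonal (suc n) ψ ≡ ψ 0 (suc n) ℤ.+ diagonal n (λ a b → ψ (suc a) b)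
  diagonal-last zero    ψ = ℤₚ.+-comm (ψ 1 0) _
  diagonal-last (suc n) ψ = trans (cong (λ t → ψ (2 ℕ.+ n) 0 ℤ.+ t) (diagonal-last n (λ a b → ψ a (suc b))))
    (lemma (ψ (2 ℕ.+ n) 0) (ψ 0 (2 ℕ.+ n)) _)
    where
    lemma : ∀ a b c → a ℤ.+ (b ℤ.+ c) ≡ b ℤ.+ (a ℤ.+ c)
    lemma = solve-∀

  -- The pairing of ψ with the divided difference of x^p y^q.
  quotient : ℕ → ℕ → (ℕ → ℕ → ℤ) → ℤ
  quotient zero    zero    ψ = 0ℤ
  quotient (suc p) zero    ψ = diagonal p ψ
  quotient zero    (suc q) ψ = ℤ.- diagonal q ψ
  quotient (suc p) (suc q) ψ = quotient p q (λ a b → ψ (suc a) (suc b))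

  diagonal-cong : ∀ n {ψ ψ′} → (∀ a b → ψ a b ≡ ψ′ a b) → diagonal n ψ ≡ diagonal n ψ′
  diagonal-cong zero    h = h 0 0
  diagonal-cong (suc n) h = cong₂ ℤ._+_ (h (suc n) 0) (diagonal-cong n (λ a b → h a (suc b)))

  quotient-cong : ∀ p q {ψ ψ′} → (∀ a b → ψ a b ≡ ψ′ a b) → quotient p q ψ ≡ quotient p q ψ′
  quotient-cong zero    zero    h = refl
  quotient-cong (suc p) zero    h = diagonal-cong p h
  quotient-cong zero    (suc q) h = cong ℤ.-_ (diagonal-cong q h)
  quotient-cong (suc p) (suc q) h = quotient-cong p q (λ a b → h (suc a) (suc b))

  -- The rule ∂ (x m) = m + y ∂ m for m = x^p y^q, seen through ψ; the recursion strips common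
  -- factors x y until one exponent is zero.
  quotient-same : ∀ p q ψ → quotient (suc p) q ψ ≡ ψ p q ℤ.+ quotient p q (λ a b → ψ a (suc b))
  quotient-same zero    zero          ψ = sym (ℤₚ.+-identityʳ _)
  quotient-same (suc p) zero          ψ = refl
  quotient-same zero    (suc zero)    ψ = sym (ℤₚ.+-inverseʳ (ψ 0 1))
  quotient-same zero    (suc (suc q)) ψ =
    trans (lemma (ψ 0 (2 ℕ.+ q)) _) (cong (λ t → ψ 0 (2 ℕ.+ q) ℤ.+ ℤ.- t) (sym (diagonal-last q (λ a b → ψ a (suc b)))))
    where
    lemma : ∀ a b → ℤ.- b ≡ a ℤ.+ ℤ.- (a ℤ.+ b)
    lemma = solve-∀
  quotient-same (suc p) (suc q)       ψ = quotient-same p q (λ a b → ψ (suc a) (suc b))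

  quotient-next : ∀ p q ψ → quotient p (suc q) ψ ≡ ℤ.- ψ p q ℤ.+ quotient p q (λ a b → ψ (suc a) b)
  quotient-next zero          zero    ψ = sym (ℤₚ.+-identityʳ _)
  quotient-next zero          (suc q) ψ = trans (cong ℤ.-_ (diagonal-last q ψ)) (ℤₚ.neg-distrib-+ (ψ 0 (suc q)) _)
  quotient-next (suc zero)    zero    ψ = sym (ℤₚ.+-inverseˡ (ψ 1 0))
  quotient-next (suc (suc p)) zero    ψ = lemma (ψ (2 ℕ.+ p) 0) _
    where
    lemma : ∀ a b → b ≡ ℤ.- a ℤ.+ (a ℤ.+ b)
    lemma = solve-∀
  quotient-next (suc p)       (suc q) ψ = quotient-next p q (λ a b → ψ (suc a) (suc b))

  sumTo : ℕ → (ℕ → ℤ) → ℤ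
  sumTo zero    h = 0ℤ
  sumTo (suc n) h = h 0 ℤ.+ sumTo n (h ∘ suc)

  sumTo-cong : ∀ n {g h} → (∀ k → k < n → g k ≡ h k) → sumTo n g ≡ sumTo n h
  sumTo-cong zero    e = refl
  sumTo-cong (suc n) e = cong₂ ℤ._+_ (e 0 (s≤s z≤n)) (sumTo-cong n (λ k k<n → e (suc k) (s≤s k<n)))

  pair-sumTo : ∀ φ c (m : ℕ → Mono) g n → ⟨ φ , map (λ k → (c , m k)) (applyUpTo g n) ⟩ ≡ c ℤ.* sumTo n (φ ∘ m ∘ g)
  pair-sumTo φ c m g zero    = sym (ℤₚ.*-zeroʳ c)
  pair-sumTo φ c m g (suc n) = trans (cong (λ t → c ℤ.* φ (m (g 0)) ℤ.+ t) (pair-sumTo φ c m (g ∘ suc) n))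
    (sym (ℤₚ.*-distribˡ-+ c _ _))

  diagonal-sumTo : ∀ n ψ → sumTo (suc n) (λ k → ψ (n ∸ k) k) ≡ diagonal n ψ
  diagonal-sumTo zero    ψ = ℤₚ.+-identityʳ _
  diagonal-sumTo (suc n) ψ = cong (λ t → ψ (suc n) 0 ℤ.+ t) (diagonal-sumTo n (λ a b → ψ a (suc b)))

  -- Matches the three branches of `ddTerm` with the recursion that strips x y; the truncated
  -- subtractions agree because k stays below the difference of the exponents.
  quotient-sumTo : ∀ p q ψ →
    (if q <ᵇ p then sumTo (p ∸ q) (λ k → ψ (p ∸ 1 ∸ k) (q ℕ.+ k))
     else (if p <ᵇ q then ℤ.- sumTo (q ∸ p) (λ k → ψ (q ∸ 1 ∸ k) (p ℕ.+ k)) else 0ℤ)) ≡ quotient p q ψ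
  quotient-sumTo zero    zero    ψ = refl
  quotient-sumTo (suc p) zero    ψ = diagonal-sumTo p ψ
  quotient-sumTo zero    (suc q) ψ = cong ℤ.-_ (diagonal-sumTo q ψ)
  quotient-sumTo (suc p) (suc q) ψ with q <ᵇ p in eq | p <ᵇ q in eq′ | quotient-sumTo p q (λ a b → ψ (suc a) (suc b))
  ... | true  | _     | ih = trans (sumTo-cong (p ∸ q) (λ k k< → cong (λ t → ψ t (suc q ℕ.+ k)) (pred p q k k<))) ih
    where
    pred : ∀ p q k → k < p ∸ q → p ∸ k ≡ suc (p ∸ 1 ∸ k)
    pred (suc p) q k k< = ℕₚ.+-∸-assoc 1 (ℕ.s≤s⁻¹ (ℕₚ.≤-trans k< (ℕₚ.m∸n≤m (suc p) q)))
    pred zero q k k< = ⊥-elim (ℕₚ.n≮0 (subst (k <_) (ℕₚ.0∸n≡0 q) k<))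
  ... | false | true  | ih = trans (cong ℤ.-_ (sumTo-cong (q ∸ p) (λ k k< → cong (λ t → ψ t (suc p ℕ.+ k)) (pred q p k k<)))) ih
    where
    pred : ∀ p q k → k < p ∸ q → p ∸ k ≡ suc (p ∸ 1 ∸ k)
    pred (suc p) q k k< = ℕₚ.+-∸-assoc 1 (ℕ.s≤s⁻¹ (ℕₚ.≤-trans k< (ℕₚ.m∸n≤m (suc p) q)))
    pred zero q k k< = ⊥-elim (ℕₚ.n≮0 (subst (k <_) (ℕₚ.0∸n≡0 q) k<))
  ... | false | false | ih = ih

  ∂ : ℕ → Poly → Poly
  ∂ i = dd (suc i)

  update : ℕ → Mono → ℕ → ℕ → Mono
  update i e a b = set0 (set0 e i a) (suc i) b

  pair-ddTerm : ∀ φ i c e →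
    ⟨ φ , ddTerm (suc i) (c , e) ⟩ ≡ c ℤ.* quotient (get0 e i) (get0 e (suc i)) (λ a b → φ (update i e a b))
  pair-ddTerm φ i c e = trans (branch (get0 e (suc i) <ᵇ get0 e i) (get0 e i <ᵇ get0 e (suc i)))
    (cong (c ℤ.*_) (quotient-sumTo (get0 e i) (get0 e (suc i)) (λ a b → φ (update i e a b))))
    where
    P = get0 e i
    R = get0 e (suc i)
    up : ℕ → Mono
    up k = update i e (P ∸ 1 ∸ k) (R ℕ.+ k)
    down : ℕ → Mono
    down k = update i e (R ∸ 1 ∸ k) (P ℕ.+ k)
    neg : ∀ c t → ℤ.- c ℤ.* t ≡ c ℤ.* ℤ.- t
    neg = solve-∀
    branch : ∀ b b′ →
      ⟨ φ , (if b then map (λ k → (c , up k)) (upTo (P ∸ R)) else (if b′ then map (λ k → (ℤ.- c , down k)) (upTo (R ∸ P)) else [])) ⟩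
      ≡ c ℤ.* (if b then sumTo (P ∸ R) (φ ∘ up) else (if b′ then ℤ.- sumTo (R ∸ P) (φ ∘ down) else 0ℤ))
    branch true  _     = pair-sumTo φ c up id (P ∸ R)
    branch false true  = trans (pair-sumTo φ (ℤ.- c) down id (R ∸ P)) (neg c _)
    branch false false = sym (ℤₚ.*-zeroʳ c)

  pair-∂ : ∀ φ i p →
    ⟨ φ , ∂ i p ⟩ ≡ ⟨ (λ e → quotient (get0 e i) (get0 e (suc i)) (λ a b → φ (update i e a b))) , p ⟩
  pair-∂ φ i []            = refl
  pair-∂ φ i ((c , e) ∷ p) = trans (pair-++ φ (ddTerm (suc i) (c , e)) (∂ i p)) (cong₂ ℤ._+_ (pair-ddTerm φ i c e) (pair-∂ φ i p))

  update-cong : ∀ i {e e′} a b → e ∼ e′ → update i e a b ∼ update i e′ a b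
  update-cong i {e} {e′} a b h = set0-cong {set0 e i a} {set0 e′ i a} (suc i) b (set0-cong i a h)

  ∂-cong : ∀ i {p q} → p ≋ q → ∂ i p ≋ ∂ i q
  ∂-cong i {p} {q} h .pair φ r = trans (pair-∂ φ i p) (trans (pair h _ respects) (sym (pair-∂ φ i q)))
    where
    respects : Resp (λ e → quotient (get0 e i) (get0 e (suc i)) (λ a b → φ (update i e a b)))
    respects {e} {e′} e∼ rewrite at e∼ i | at e∼ (suc i) =
      quotient-cong (get0 e′ i) (get0 e′ (suc i)) (λ a b → r (update-cong i a b e∼))

  ∂-++ : ∀ i p q → ∂ i (p ++ q) ≋ ∂ i p ++ ∂ i q
  ∂-++ i p q .pair φ r = trans (pair-∂ φ i (p ++ q)) (trans (pair-++ _ p q)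
    (trans (sym (cong₂ ℤ._+_ (pair-∂ φ i p) (pair-∂ φ i q))) (sym (pair-++ φ (∂ i p) (∂ i q)))))

  ∂-const : ∀ i c → ∂ i (const c) ≋ []
  ∂-const i c .pair φ r = trans (pair-∂ φ i (const c)) (trans (ℤₚ.+-identityʳ _) (ℤₚ.*-zeroʳ c))

  get0-update₁ : ∀ i e a b → get0 (update i e a b) i ≡ a
  get0-update₁ i e a b = trans (get0-set0-diff (set0 e i a) (suc i) b i (ℕₚ.<⇒≢ ℕₚ.≤-refl)) (get0-set0-same e i a)

  get0-update₂ : ∀ i e a b → get0 (update i e a b) (suc i) ≡ b
  get0-update₂ i e a b = get0-set0-same (set0 e i a) (suc i) b

  get0-update-far : ∀ i e a b k → k ≢ i → k ≢ suc i → get0 (update i e a b) k ≡ get0 e k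
  get0-update-far i e a b k k≢i k≢si = trans (get0-set0-diff (set0 e i a) (suc i) b k k≢si) (get0-set0-diff e i a k k≢i)

  update-unique : ∀ i e a b m → get0 m i ≡ a → get0 m (suc i) ≡ b →
    (∀ k → k ≢ i → k ≢ suc i → get0 m k ≡ get0 e k) → update i e a b ∼ m
  update-unique i e a b m hi hsi far .at k with k ℕ.≟ i | k ℕ.≟ suc i
  ... | yes refl | _        = trans (get0-update₁ i e a b) (sym hi)
  ... | no _     | yes refl = trans (get0-update₂ i e a b) (sym hsi)
  ... | no k≢i   | no k≢si  = trans (get0-update-far i e a b k k≢i k≢si) (sym (far k k≢i k≢si))

  i≢1+i : ∀ {i} → i ≢ suc i
  i≢1+i = ℕₚ.<⇒≢ ℕₚ.≤-refl

  ∂-same : ∀ i p → ∂ i (x i *P p) ≋ p ++ x (suc i) *P ∂ i p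
  ∂-same i p .pair φ r = begin
    ⟨ φ , ∂ i (x i *P p) ⟩                        ≡⟨ pair-∂ φ i (x i *P p) ⟩
    ⟨ F , x i *P p ⟩                              ≡⟨ pair-x F i p ⟩
    ⟨ (λ e → F (addMon (unit i) e)) , p ⟩         ≡⟨ pair-cong pointwise p ⟩
    ⟨ (λ e → φ e ℤ.+ G e) , p ⟩                   ≡⟨ pair-+ φ G p ⟩
    ⟨ φ , p ⟩ ℤ.+ ⟨ G , p ⟩                       ≡⟨ cong (λ t → ⟨ φ , p ⟩ ℤ.+ t) (pair-∂ _ i p) ⟨
    ⟨ φ , p ⟩ ℤ.+ ⟨ _ , ∂ i p ⟩                   ≡⟨ cong (λ t → ⟨ φ , p ⟩ ℤ.+ t) (pair-x φ (suc i) (∂ i p)) ⟨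
    ⟨ φ , p ⟩ ℤ.+ ⟨ φ , x (suc i) *P ∂ i p ⟩      ≡⟨ pair-++ φ p _ ⟨
    ⟨ φ , p ++ x (suc i) *P ∂ i p ⟩ ∎
    where
    open ≡-Reasoning
    F G : Mono → ℤ
    F e = quotient (get0 e i) (get0 e (suc i)) (λ a b → φ (update i e a b))
    G e = quotient (get0 e i) (get0 e (suc i)) (λ a b → φ (addMon (unit (suc i)) (update i e a b)))
    first : ∀ e → update i (addMon (unit i) e) (get0 e i) (get0 e (suc i)) ∼ e
    first e = update-unique i _ _ _ e refl refl (λ k k≢i _ → sym (get0-bump-diff i e k k≢i))
    rest : ∀ e a b → update i (addMon (unit i) e) a (suc b) ∼ addMon (unit (suc i)) (update i e a b)
    rest e a b = update-unique i _ _ _ _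
      (trans (get0-bump-diff (suc i) (update i e a b) i i≢1+i) (get0-update₁ i e a b))
      (trans (get0-bump-same (suc i) (update i e a b)) (cong suc (get0-update₂ i e a b)))
      (λ k k≢i k≢si → trans (get0-bump-diff (suc i) (update i e a b) k k≢si)
        (trans (get0-update-far i e a b k k≢i k≢si) (sym (get0-bump-diff i e k k≢i))))
    pointwise : ∀ e → F (addMon (unit i) e) ≡ φ e ℤ.+ G e
    pointwise e rewrite get0-bump-same i e | get0-bump-diff i e (suc i) (i≢1+i ∘ sym) =
      trans (quotient-same (get0 e i) (get0 e (suc i)) _)
        (cong₂ ℤ._+_ (r (first e)) (quotient-cong (get0 e i) (get0 e (suc i)) (λ a b → r (rest e a b))))

  ∂-next : ∀ i p → ∂ i (x (suc i) *P p) ≋ scaleP (ℤ.- 1ℤ) p ++ x i *P ∂ i p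
  ∂-next i p .pair φ r = begin
    ⟨ φ , ∂ i (x (suc i) *P p) ⟩                               ≡⟨ pair-∂ φ i (x (suc i) *P p) ⟩
    ⟨ F , x (suc i) *P p ⟩                                     ≡⟨ pair-x F (suc i) p ⟩
    ⟨ (λ e → F (addMon (unit (suc i)) e)) , p ⟩                ≡⟨ pair-cong pointwise p ⟩
    ⟨ (λ e → ℤ.- 1ℤ ℤ.* φ e ℤ.+ G e) , p ⟩                     ≡⟨ pair-+ _ G p ⟩
    ⟨ (λ e → ℤ.- 1ℤ ℤ.* φ e) , p ⟩ ℤ.+ ⟨ G , p ⟩               ≡⟨ cong₂ ℤ._+_ (trans (pair-* φ (ℤ.- 1ℤ) p) (sym (pair-scale φ (ℤ.- 1ℤ) p)))
                                                                    (sym (trans (pair-x φ i (∂ i p)) (pair-∂ _ i p))) ⟩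
    ⟨ φ , scaleP (ℤ.- 1ℤ) p ⟩ ℤ.+ ⟨ φ , x i *P ∂ i p ⟩         ≡⟨ pair-++ φ (scaleP (ℤ.- 1ℤ) p) _ ⟨
    ⟨ φ , scaleP (ℤ.- 1ℤ) p ++ x i *P ∂ i p ⟩ ∎
    where
    open ≡-Reasoning
    F G : Mono → ℤ
    F e = quotient (get0 e i) (get0 e (suc i)) (λ a b → φ (update i e a b))
    G e = quotient (get0 e i) (get0 e (suc i)) (λ a b → φ (addMon (unit i) (update i e a b)))
    first : ∀ e → update i (addMon (unit (suc i)) e) (get0 e i) (get0 e (suc i)) ∼ e
    first e = update-unique i _ _ _ e refl refl (λ k _ k≢si → sym (get0-bump-diff (suc i) e k k≢si))
    rest : ∀ e a b → update i (addMon (unit (suc i)) e) (suc a) b ∼ addMon (unit i) (update i e a b)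
    rest e a b = update-unique i _ _ _ _
      (trans (get0-bump-same i (update i e a b)) (cong suc (get0-update₁ i e a b)))
      (trans (get0-bump-diff i (update i e a b) (suc i) (i≢1+i ∘ sym)) (get0-update₂ i e a b))
      (λ k k≢i k≢si → trans (get0-bump-diff i (update i e a b) k k≢i)
        (trans (get0-update-far i e a b k k≢i k≢si) (sym (get0-bump-diff (suc i) e k k≢si))))
    pointwise : ∀ e → F (addMon (unit (suc i)) e) ≡ ℤ.- 1ℤ ℤ.* φ e ℤ.+ G e
    pointwise e rewrite get0-bump-same (suc i) e | get0-bump-diff (suc i) e i i≢1+i =
      trans (quotient-next (get0 e i) (get0 e (suc i)) _)
        (cong₂ ℤ._+_ (trans (cong ℤ.-_ (r (first e))) (sym (ℤₚ.-1*i≡-i (φ e))))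
          (quotient-cong (get0 e i) (get0 e (suc i)) (λ a b → r (rest e a b))))

  ∂-far : ∀ i j p → j ≢ i → j ≢ suc i → ∂ i (x j *P p) ≋ x j *P ∂ i p
  ∂-far i j p j≢i j≢si .pair φ r = begin
    ⟨ φ , ∂ i (x j *P p) ⟩                     ≡⟨ pair-∂ φ i (x j *P p) ⟩
    ⟨ F , x j *P p ⟩                           ≡⟨ pair-x F j p ⟩
    ⟨ (λ e → F (addMon (unit j) e)) , p ⟩      ≡⟨ pair-cong pointwise p ⟩
    ⟨ G , p ⟩                                  ≡⟨ pair-∂ _ i p ⟨
    ⟨ _ , ∂ i p ⟩                              ≡⟨ pair-x φ j (∂ i p) ⟨
    ⟨ φ , x j *P ∂ i p ⟩ ∎
    where
    open ≡-Reasoning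
    F G : Mono → ℤ
    F e = quotient (get0 e i) (get0 e (suc i)) (λ a b → φ (update i e a b))
    G e = quotient (get0 e i) (get0 e (suc i)) (λ a b → φ (addMon (unit j) (update i e a b)))
    commute : ∀ e a b → update i (addMon (unit j) e) a b ∼ addMon (unit j) (update i e a b)
    commute e a b = update-unique i _ _ _ _
      (trans (get0-bump-diff j (update i e a b) i (j≢i ∘ sym)) (get0-update₁ i e a b))
      (trans (get0-bump-diff j (update i e a b) (suc i) (j≢si ∘ sym)) (get0-update₂ i e a b))
      (λ k k≢i k≢si → trans (get0-addMon (unit j) (update i e a b) k)
        (trans (cong (get0 (unit j) k ℕ.+_) (get0-update-far i e a b k k≢i k≢si)) (sym (get0-addMon (unit j) e k))))
    pointwise : ∀ e → F (addMon (unit j) e) ≡ G e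
    pointwise e rewrite get0-bump-diff j e i (j≢i ∘ sym) | get0-bump-diff j e (suc i) (j≢si ∘ sym) =
      quotient-cong (get0 e i) (get0 e (suc i)) (λ a b → r (commute e a b))

  -- Constant term, induction on polynomials, and the assembled calculus

  ct : Poly → ℤ
  ct p = ⟨ indicator [] , p ⟩

  ct-cong : ∀ {p q} → p ≋ q → ct p ≡ ct q
  ct-cong h = pair h _ (indicator-resp [])

  ct-x : ∀ j p → ct (x j *P p) ≡ 0ℤ
  ct-x j p = trans (pair-x _ j p) (trans (pair-cong pointwise p) (pair-0 p))
    where
    pointwise : ∀ e → indicator [] (addMon (unit j) e) ≡ 0ℤ
    pointwise e with eqMon (addMon (unit j) e) [] in eq
    ... | false = refl
    ... | true  with trans (sym (get0-bump-same j e)) (at (eqMon-sound (addMon (unit j) e) [] eq) j)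
    ...   | ()

  ct-const : ∀ c → ct (const c) ≡ c
  ct-const c = trans (ℤₚ.+-identityʳ _) (ℤₚ.*-identityʳ c)

  pad : ℕ → Mono → Mono
  pad zero    e = e
  pad (suc k) e = 0 ∷ pad k e

  bump-pad : ∀ k a e → addMon (unit k) (pad k (a ∷ e)) ≡ pad k (suc a ∷ e)
  bump-pad zero    a e = refl
  bump-pad (suc k) a e = cong (0 ∷_) (bump-pad k a e)

  pad-zero : ∀ k e → pad k (0 ∷ e) ≡ pad (suc k) e
  pad-zero zero    e = refl
  pad-zero (suc k) e = cong (0 ∷_) (pad-zero k e)

  pad-[] : ∀ k → pad k [] ∼ []
  pad-[] zero    .at j       = refl
  pad-[] (suc k) .at zero    = refl
  pad-[] (suc k) .at (suc j) = at (pad-[] k) j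

  term-cong : ∀ c {e e′} → e ∼ e′ → (c , e) ∷ [] ≋ (c , e′) ∷ []
  term-cong c h .pair φ r = cong (λ t → c ℤ.* t ℤ.+ 0ℤ) (r h)

  x*term : ∀ j c e → x j *P ((c , e) ∷ []) ≋ (c , addMon (unit j) e) ∷ []
  x*term j c e .pair φ r = pair-x φ j ((c , e) ∷ [])

  -- The helper `term k e` carries k leading zeros: each unit of the head exponent is one
  -- multiplication by x k, and a zero head moves on to the next variable.
  polyInd : (P : Poly → Set) → (∀ {f g} → f ≋ g → P f → P g) → (∀ c → P (const c)) →
    (∀ j f → P f → P (x j *P f)) → (∀ f g → P f → P g → P (f ++ g)) → ∀ f → P f
  polyInd P resp hc hx h+ []            = resp (mk≋ λ φ _ → refl) (hc 0ℤ)
  polyInd P resp hc hx h+ ((c , e) ∷ f) = h+ ((c , e) ∷ []) f (term 0 e) (polyInd P resp hc hx h+ f)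
    where
    term : ∀ k e → P ((c , pad k e) ∷ [])
    term k []            = resp (term-cong c (mk∼ λ j → sym (at (pad-[] k) j))) (hc c)
    term k (zero ∷ e)    = subst (λ m → P ((c , m) ∷ [])) (sym (pad-zero k e)) (term (suc k) e)
    term k (suc a ∷ e)   = subst (λ m → P ((c , m) ∷ [])) (bump-pad k a e)
                             (resp (x*term k c (pad k (a ∷ e))) (hx k _ (term k (a ∷ e))))

  polyCalculus : Calculus
  polyCalculus = record
    { ring = polyRing ; const = const
    ; const-0 = mk≋ λ φ _ → refl ; const-1 = ≋-refl
    ; const-+ = λ a b → mk≋ λ φ _ → lemma a b (φ [])
    ; const-* = λ a b → ≋-refl
    ; x = x ; ind = polyInd
    ; ∂ = ∂ ; ∂-cong = ∂-cong ; ∂-+ = ∂-++ ; ∂-const = ∂-const ; ∂-same = ∂-same ; ∂-next = ∂-next ; ∂-far = ∂-far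
    ; Q = Q ; Q-cong = Q-cong ; Q-+ = λ n → linear-++ _ ; Q-const = Q-const ; Q-same = Q-same ; Q-diff = Q-diff
    ; ρ = ρ ; ρ-cong = ρ-cong ; ρ-+ = λ i → linear-++ _ ; ρ-const = ρ-const ; ρ-same = ρ-same ; ρ-skip = ρ-skip
    ; ct = ct ; ct-cong = ct-cong ; ct-+ = pair-++ (indicator []) ; ct-const = ct-const ; ct-x = ct-x }
    where
    lemma : ∀ a b t → (a ℤ.+ b) ℤ.* t ℤ.+ 0ℤ ≡ a ℤ.* t ℤ.+ (b ℤ.* t ℤ.+ 0ℤ)
    lemma = solve-∀

-- The recursively computed Schubert polynomials satisfy Sch

module Schubert where

  open Polynomials using (mk≋; pair; mk∼; at; ≈P⇒≋; indicator; eqMon-sound; ⟨_,_⟩; pair-linear; pair-scale; pair-const*; polyCalculus;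
    monomial; monomial-cong; pair-monomial; lower; update; get0-set0-same; get0-set0-diff; get0-update₁; get0-update₂; get0-update-far)
  open Core polyCalculus

  <ᵇ-true : ∀ {a b} → a < b → (a <ᵇ b) ≡ true
  <ᵇ-true {zero}  (s≤s h) = ≡.refl
  <ᵇ-true {suc a} (s≤s h) = <ᵇ-true h

  <ᵇ-false : ∀ {a b} → b ≤ a → (a <ᵇ b) ≡ false
  <ᵇ-false {a}     z≤n     = ≡.refl
  <ᵇ-false {suc a} (s≤s h) = <ᵇ-false h

  <ᵇ-sound : ∀ {a b} → (a <ᵇ b) ≡ true → a < b
  <ᵇ-sound {zero}  {suc b} _ = s≤s z≤n
  <ᵇ-sound {suc a} {suc b} h = s≤s (<ᵇ-sound h)

  less : ℕ → ℕ → ℕ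
  less a b = if a <ᵇ b then 1 else 0

  less≤1 : ∀ a b → less a b ≤ 1
  less≤1 a b with a <ᵇ b
  ... | true  = s≤s z≤n
  ... | false = z≤n

  above : ℕ → ℕ → (ℕ → ℕ) → ℕ
  above a zero    p = 0
  above a (suc N) p = less a (p 0) ℕ.+ above a N (p ∘ suc)

  -- The recursion of `schubW` climbs along ascents to the longest element, so the number of
  -- non-inversions in the window is its depth and the measure for the fuel.
  noninv : ℕ → (ℕ → ℕ) → ℕ
  noninv zero    p = 0
  noninv (suc N) p = above (p 0) N (p ∘ suc) ℕ.+ noninv N (p ∘ suc)

  +-left-comm : ∀ a b c → a ℕ.+ (b ℕ.+ c) ≡ b ℕ.+ (a ℕ.+ c)
  +-left-comm a b c = ≡.trans (≡.sym (ℕₚ.+-assoc a b c)) (≡.trans (≡.cong (ℕ._+ c) (ℕₚ.+-comm a b)) (ℕₚ.+-assoc b a c))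

  above-swap : ∀ a N p k → suc k < N → above a N (p ∘ s k) ≡ above a N p
  above-swap a (suc (suc N)) p zero    _       = +-left-comm (less a (p 1)) (less a (p 0)) _
  above-swap a (suc N)       p (suc k) (s≤s h) = ≡.cong (less a (p 0) ℕ.+_) (above-swap a N (p ∘ suc) k h)
  above-swap a (suc zero)    p zero    (s≤s ())

  noninv-swap : ∀ N p k → suc k < N → p k < p (suc k) → noninv N p ≡ suc (noninv N (p ∘ s k))
  noninv-swap (suc zero)    p zero    (s≤s ()) _
  noninv-swap (suc (suc N)) p zero    _        asc
    rewrite <ᵇ-true asc | <ᵇ-false {p 1} {p 0} (ℕₚ.<⇒≤ asc) = ≡.cong suc (+-left-comm (above (p 0) N _) (above (p 1) N _) _)
  noninv-swap (suc N)       p (suc k) (s≤s h)  asc =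
    ≡.trans (≡.cong₂ ℕ._+_ (≡.sym (above-swap (p 0) N (p ∘ suc) k h)) (noninv-swap N (p ∘ suc) k h asc)) (ℕₚ.+-suc _ _)

  above≤ : ∀ a N p → above a N p ≤ N
  above≤ a zero    p = z≤n
  above≤ a (suc N) p = ℕₚ.+-mono-≤ (less≤1 a (p 0)) (above≤ a N (p ∘ suc))

  triangle : ℕ → ℕ
  triangle N = sum (downFrom N)

  noninv≤triangle : ∀ N p → noninv N p ≤ triangle N
  noninv≤triangle zero    p = z≤n
  noninv≤triangle (suc N) p = ℕₚ.+-mono-≤ (above≤ (p 0) N (p ∘ suc)) (noninv≤triangle N (p ∘ suc))

  triangle≤square : ∀ N → triangle N ≤ N ℕ.* N
  triangle≤square zero    = z≤n
  triangle≤square (suc N) = ℕₚ.≤-trans (ℕₚ.+-mono-≤ (ℕₚ.n≤1+n N) (triangle≤square N))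
    (ℕₚ.+-monoʳ-≤ (suc N) (ℕₚ.*-monoʳ-≤ N (ℕₚ.n≤1+n N)))

  noninv-cong : ∀ N {p q} → p ≗ q → noninv N p ≡ noninv N q
  noninv-cong zero    h = ≡.refl
  noninv-cong (suc N) {p} {q} h = ≡.cong₂ ℕ._+_ (go (h 0) N (h ∘ suc)) (noninv-cong N (h ∘ suc))
    where
    go : ∀ {a b} → a ≡ b → ∀ N {p q} → p ≗ q → above a N p ≡ above b N q
    go e zero    h = ≡.refl
    go e (suc N) h = ≡.cong₂ ℕ._+_ (≡.cong₂ less e (h 0)) (go e N (h ∘ suc))

  data FirstAscent (N : ℕ) (p : ℕ → ℕ) : Set where
    none : firstAscent (applyUpTo p N) ≡ nothing → (∀ k → suc k < N → ¬ (p k < p (suc k))) → FirstAscent N p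
    some : ∀ k → firstAscent (applyUpTo p N) ≡ just (suc k) → suc k < N → p k < p (suc k) → FirstAscent N p

  firstAscent? : ∀ N p → FirstAscent N p
  firstAscent? zero          p = none ≡.refl (λ k ())
  firstAscent? (suc zero)    p = none ≡.refl (λ { k (s≤s ()) })
  firstAscent? (suc (suc N)) p = extend (p 0 <ᵇ p 1) ≡.refl (firstAscent? (suc N) (p ∘ suc))
    where
    unfold : ∀ {b} → (p 0 <ᵇ p 1) ≡ b → firstAscent (applyUpTo p (suc (suc N)))
      ≡ (if b then just 1 else Maybe.map suc (firstAscent (applyUpTo (p ∘ suc) (suc N))))
    unfold ≡.refl = ≡.refl
    extend : ∀ b → (p 0 <ᵇ p 1) ≡ b → FirstAscent (suc N) (p ∘ suc) → FirstAscent (suc (suc N)) p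
    extend true  eq _ = some 0 (unfold eq) (s≤s (s≤s z≤n)) (<ᵇ-sound eq)
    extend false eq (some k e l asc) = some (suc k) (≡.trans (unfold eq) (≡.cong (Maybe.map suc) e)) (s≤s l) asc
    extend false eq (none e h) = none (≡.trans (unfold eq) (≡.cong (Maybe.map suc) e)) no-ascent
      where
      no-ascent : ∀ k → suc k < suc (suc N) → ¬ (p k < p (suc k))
      no-ascent zero    _       asc with ≡.trans (≡.sym eq) (<ᵇ-true asc)
      ... | ()
      no-ascent (suc k) (s≤s l) asc = h k l asc

  swapAt-applyUpTo : ∀ N p k → suc k < N → swapAt (suc k) (applyUpTo p N) ≡ applyUpTo (p ∘ s k) N
  swapAt-applyUpTo (suc zero)    p zero    (s≤s ())
  swapAt-applyUpTo (suc (suc N)) p zero    _       = ≡.refl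
  swapAt-applyUpTo (suc N)       p (suc k) (s≤s h) = ≡.cong (p 0 ∷_) (swapAt-applyUpTo N (p ∘ suc) k h)

  applyUpTo-cong : ∀ N {p q : ℕ → ℕ} → p ≗ q → applyUpTo p N ≡ applyUpTo q N
  applyUpTo-cong zero    h = ≡.refl
  applyUpTo-cong (suc N) h = ≡.cong₂ _∷_ (h 0) (applyUpTo-cong N (h ∘ suc))

  schubW-none : ∀ f w → firstAscent w ≡ nothing → schubW (suc f) w ≡ monomial (downFrom (length w))
  schubW-none f w e rewrite e = ≡.refl

  schubW-some : ∀ f w i → firstAscent w ≡ just i → schubW (suc f) w ≡ dd i (schubW f (swapAt i w))
  schubW-some f w i e rewrite e = ≡.refl

  sum-set0 : ∀ e n a → sum (set0 e n a) ℕ.+ get0 e n ≡ sum e ℕ.+ a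
  sum-set0 []      zero    a = ≡.trans (ℕₚ.+-identityʳ (a ℕ.+ 0)) (ℕₚ.+-identityʳ a)
  sum-set0 []      (suc n) a = sum-set0 [] n a
  sum-set0 (b ∷ e) zero    a = ≡.trans (ℕₚ.+-comm (a ℕ.+ sum e) b) (≡.trans (≡.cong (b ℕ.+_) (ℕₚ.+-comm a _)) (≡.sym (ℕₚ.+-assoc b _ a)))
  sum-set0 (b ∷ e) (suc n) a = ≡.trans (ℕₚ.+-assoc b _ _) (≡.trans (≡.cong (b ℕ.+_) (sum-set0 e n a)) (≡.sym (ℕₚ.+-assoc b _ a)))

  sum-update : ∀ i e a b → suc (a ℕ.+ b) ≡ get0 e i ℕ.+ get0 e (suc i) → suc (sum (update i e a b)) ≡ sum e
  sum-update i e a b h = ℕₚ.+-cancelʳ-≡ (a ℕ.+ b) _ _ (begin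
    suc (sum u) ℕ.+ (a ℕ.+ b)                ≡⟨ ≡.sym (ℕₚ.+-suc (sum u) (a ℕ.+ b)) ⟩
    sum u ℕ.+ suc (a ℕ.+ b)                  ≡⟨ ≡.cong (sum u ℕ.+_) (≡.trans h (ℕₚ.+-comm (get0 e i) _)) ⟩
    sum u ℕ.+ (get0 e (suc i) ℕ.+ get0 e i)  ≡⟨ ≡.sym (ℕₚ.+-assoc (sum u) _ _) ⟩
    sum u ℕ.+ get0 e (suc i) ℕ.+ get0 e i    ≡⟨ ≡.cong (ℕ._+ get0 e i) (≡.trans (≡.cong (sum u ℕ.+_) (≡.sym (get0-set0-diff e i a (suc i) (ℕₚ.<⇒≢ ℕₚ.≤-refl ∘ ≡.sym)))) (sum-set0 (set0 e i a) (suc i) b)) ⟩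
    sum (set0 e i a) ℕ.+ b ℕ.+ get0 e i      ≡⟨ ≡.trans (ℕₚ.+-assoc (sum (set0 e i a)) b _) (≡.trans (≡.cong (sum (set0 e i a) ℕ.+_) (ℕₚ.+-comm b _)) (≡.sym (ℕₚ.+-assoc (sum (set0 e i a)) _ b))) ⟩
    sum (set0 e i a) ℕ.+ get0 e i ℕ.+ b      ≡⟨ ≡.cong (ℕ._+ b) (sum-set0 e i a) ⟩
    sum e ℕ.+ a ℕ.+ b                        ≡⟨ ℕₚ.+-assoc (sum e) a b ⟩
    sum e ℕ.+ (a ℕ.+ b) ∎)
    where
    open ≡.≡-Reasoning
    u = update i e a b

  All-∂ : ∀ {P P′ : Mono → Set} i →
    (∀ e a b → P e → suc (a ℕ.+ b) ≡ get0 e i ℕ.+ get0 e (suc i) → a < get0 e i ⊔ get0 e (suc i) → b < get0 e i ⊔ get0 e (suc i) → P′ (update i e a b)) →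
    ∀ f → All (P ∘ proj₂) f → All (P′ ∘ proj₂) (∂ i f)
  All-∂ i h []            []        = []
  All-∂ {P} {P′} i h ((c , e) ∷ f) (Pe ∷ Pf) = All.++⁺ (branch (R <ᵇ L) (L <ᵇ R) <ᵇ-sound <ᵇ-sound) (All-∂ i h f Pf)
    where
    L = get0 e i
    R = get0 e (suc i)
    up down : ℕ → Mono
    up k = update i e (L ∸ 1 ∸ k) (R ℕ.+ k)
    down k = update i e (R ∸ 1 ∸ k) (L ℕ.+ k)
    exponents : ∀ L R k → R < L → k < L ∸ R → suc (L ∸ 1 ∸ k ℕ.+ (R ℕ.+ k)) ≡ L ℕ.+ R × L ∸ 1 ∸ k < L × R ℕ.+ k < L
    exponents (suc L) R k R<L k< =
        ≡.cong suc (≡.trans (≡.cong (L ∸ k ℕ.+_) (ℕₚ.+-comm R k)) (≡.trans (≡.sym (ℕₚ.+-assoc (L ∸ k) k R)) (≡.cong (ℕ._+ R) (ℕₚ.m∸n+n≡m k≤L))))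
      , s≤s (ℕₚ.m∸n≤m L k)
      , ≡.subst (R ℕ.+ k <_) (ℕₚ.m+[n∸m]≡n (ℕₚ.<⇒≤ R<L)) (ℕₚ.+-monoʳ-< R k<)
      where
      k≤L : k ≤ L
      k≤L = ℕ.s≤s⁻¹ (ℕₚ.≤-trans k< (ℕₚ.m∸n≤m (suc L) R))
    branch : ∀ b b′ → (b ≡ true → R < L) → (b′ ≡ true → L < R) →
      All (P′ ∘ proj₂) (if b then map (λ k → (c , up k)) (upTo (L ∸ R)) else (if b′ then map (λ k → (ℤ.- c , down k)) (upTo (R ∸ L)) else []))
    branch true  _     R<L _ = All.map⁺ (All.applyUpTo⁺₁ id (L ∸ R) λ {k} k< → let (s , l , r) = exponents L R k (R<L ≡.refl) k< in
      h e _ _ Pe s (ℕₚ.<-≤-trans l (ℕₚ.m≤m⊔n L R)) (ℕₚ.<-≤-trans r (ℕₚ.m≤m⊔n L R)))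
    branch false true  _ L<R = All.map⁺ (All.applyUpTo⁺₁ id (R ∸ L) λ {k} k< → let (s , l , r) = exponents R L k (L<R ≡.refl) k< in
      h e _ _ Pe (≡.trans s (ℕₚ.+-comm R L)) (ℕₚ.<-≤-trans l (ℕₚ.m≤n⊔m L R)) (ℕₚ.<-≤-trans r (ℕₚ.m≤n⊔m L R)))
    branch false false _ _ = []

  downFrom-bound : ∀ N j → get0 (downFrom N) j ≤ N ∸ suc j
  downFrom-bound zero    j       = z≤n
  downFrom-bound (suc N) zero    = ℕₚ.≤-refl
  downFrom-bound (suc N) (suc j) = downFrom-bound N j

  Q-vanish : ∀ n f → All (λ t → get0 (proj₂ t) n ≡ 0) f → Q n f ≈ 0#
  Q-vanish n f h .pair φ r = ≡.trans (pair-linear φ (λ e → lower n e (get0 e n)) f) (go f h)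
    where
    go : ∀ f → All (λ t → get0 (proj₂ t) n ≡ 0) f → ⟨ (λ e → ⟨ φ , lower n e (get0 e n) ⟩) , f ⟩ ≡ 0ℤ
    go []            []       = ≡.refl
    go ((c , e) ∷ f) (z ∷ zs) rewrite z = ≡.trans (≡.cong₂ ℤ._+_ (ℤₚ.*-zeroʳ c) (go f zs)) ≡.refl

  sum-positive⇒ct : ∀ f → All (λ t → 1 ≤ sum (proj₂ t)) f → ct f ≡ 0ℤ
  sum-positive⇒ct []            []       = ≡.refl
  sum-positive⇒ct ((c , e) ∷ f) (h ∷ hs) = ≡.trans (≡.cong₂ ℤ._+_ (≡.trans (≡.cong (c ℤ.*_) (vanish e h)) (ℤₚ.*-zeroʳ c)) (sum-positive⇒ct f hs)) ≡.refl
    where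
    sum-zero : ∀ e → (∀ j → get0 e j ≡ 0) → sum e ≡ 0
    sum-zero []      z = ≡.refl
    sum-zero (a ∷ e) z = ≡.cong₂ ℕ._+_ (z 0) (sum-zero e (z ∘ suc))
    vanish : ∀ e → 1 ≤ sum e → indicator [] e ≡ 0ℤ
    vanish e h with eqMon e [] in eq
    ... | false = ≡.refl
    ... | true  = ⊥-elim (ℕₚ.<⇒≢ h (≡.sym (sum-zero e (at (eqMon-sound e [] eq)))))

  Q-monomial : ∀ n e → Q n (monomial e) ≈ lower n e (get0 e n)
  Q-monomial n e .pair φ r = ≡.trans (pair-linear φ (λ e → lower n e (get0 e n)) (monomial e)) (pair-monomial (λ e → ⟨ φ , lower n e (get0 e n) ⟩) e)

  Q^-monomial : ∀ n b e → get0 e n ≡ b → Q^ n b (monomial e) ≈ monomial (set0 e n 0)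
  Q^-monomial n zero    e h = monomial-cong (mk∼ λ k → unchanged k (k ℕ.≟ n))
    where
    unchanged : ∀ k → _ → get0 e k ≡ get0 (set0 e n 0) k
    unchanged k (yes ≡.refl) = ≡.trans h (≡.sym (get0-set0-same e k 0))
    unchanged k (no k≢n)     = ≡.sym (get0-set0-diff e n 0 k k≢n)
  Q^-monomial n (suc b) e h = trans (⟨ Q^-additive n b ⟩cong (trans (Q-monomial n e) (reflexive (≡.cong (lower n e) h))))
    (trans (Q^-monomial n b (set0 e n b) (get0-set0-same e n b)) (monomial-cong (mk∼ λ k → overwrite k (k ℕ.≟ n))))
    where
    overwrite : ∀ k → _ → get0 (set0 (set0 e n b) n 0) k ≡ get0 (set0 e n 0) k
    overwrite k (yes ≡.refl) = ≡.trans (get0-set0-same (set0 e k b) k 0) (≡.sym (get0-set0-same e k 0))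
    overwrite k (no k≢n)     = ≡.trans (get0-set0-diff (set0 e n b) n 0 k k≢n) (≡.trans (get0-set0-diff e n b k k≢n) (≡.sym (get0-set0-diff e n 0 k k≢n)))

  Lead-monomial : ∀ n e → (∀ j → n ≤ j → get0 e j ≡ 0) → Lead n (monomial e) 1ℤ
  Lead-monomial zero    e h = monomial-cong (mk∼ λ k → h k z≤n)
  Lead-monomial (suc n) e h = b , monomial e′ , (Q^-monomial n b e ≡.refl , top) , Lead-monomial n e′ rest
    where
    b = get0 e n
    e′ = set0 e n 0
    top : Q^ n (suc b) (monomial e) ≈ 0#
    top = trans (sym (Q^-comm (Q-additive n) n (λ _ → refl) b (monomial e))) (trans (Q-cong n (Q^-monomial n b e ≡.refl))
      (trans (Q-monomial n e′) (reflexive (≡.cong (lower n e′) (get0-set0-same e n 0)))))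
    rest : ∀ j → n ≤ j → get0 e′ j ≡ 0
    rest j n≤j with j ℕ.≟ n
    ... | yes ≡.refl = get0-set0-same e j 0
    ... | no j≢n = ≡.trans (get0-set0-diff e n 0 j j≢n) (h j (ℕₚ.≤∧≢⇒< n≤j (j≢n ∘ ≡.sym)))

  module Window (N : ℕ) where

    S : (ℕ → ℕ) → Poly
    S p = schubW (suc (N ℕ.* N)) (applyUpTo p N)

    S-cong : ∀ {p q} → p ≗ q → S p ≡ S q
    S-cong h = ≡.cong (schubW (suc (N ℕ.* N))) (applyUpTo-cong N h)

    -- The recursive call runs on one unit of fuel less; this lets the recursion be stated for `S`
    -- with its fixed fuel.
    fuel-irrelevant : ∀ f f′ p → noninv N p < f → noninv N p < f′ → schubW f (applyUpTo p N) ≡ schubW f′ (applyUpTo p N)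
    fuel-irrelevant (suc f) (suc f′) p h h′ with firstAscent? N p
    ... | none e _ = ≡.trans (schubW-none f (applyUpTo p N) e) (≡.sym (schubW-none f′ (applyUpTo p N) e))
    ... | some k e l asc = ≡.trans (schubW-some f (applyUpTo p N) (suc k) e) (≡.trans (≡.cong (dd (suc k)) rec) (≡.sym (schubW-some f′ (applyUpTo p N) (suc k) e)))
      where
      smaller : ∀ {g} → noninv N p < suc g → noninv N (p ∘ s k) < g
      smaller {g} h = ≡.subst (_≤ g) (noninv-swap N p k l asc) (ℕ.s≤s⁻¹ h)
      rec : schubW f (swapAt (suc k) (applyUpTo p N)) ≡ schubW f′ (swapAt (suc k) (applyUpTo p N))
      rec = ≡.subst (λ w → schubW f w ≡ schubW f′ w) (≡.sym (swapAt-applyUpTo N p k l)) (fuel-irrelevant f f′ (p ∘ s k) (smaller h) (smaller h′))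

    S-none : ∀ p → firstAscent (applyUpTo p N) ≡ nothing → S p ≡ monomial (downFrom N)
    S-none p e = ≡.trans (schubW-none (N ℕ.* N) (applyUpTo p N) e) (≡.cong (λ n → monomial (downFrom n)) (length-applyUpTo p N))

    noninv≤square : ∀ p → noninv N p ≤ N ℕ.* N
    noninv≤square p = ℕₚ.≤-trans (noninv≤triangle N p) (triangle≤square N)

    S-some : ∀ p k → firstAscent (applyUpTo p N) ≡ just (suc k) → suc k < N → p k < p (suc k) → S p ≡ ∂ k (S (p ∘ s k))
    S-some p k e l asc = ≡.trans (schubW-some (N ℕ.* N) (applyUpTo p N) (suc k) e) (≡.cong (dd (suc k)) (≡.trans
      (≡.cong (schubW (N ℕ.* N)) (swapAt-applyUpTo N p k l))
      (fuel-irrelevant (N ℕ.* N) (suc (N ℕ.* N)) (p ∘ s k) (≡.subst (_≤ N ℕ.* N) (noninv-swap N p k l asc) (noninv≤square p)) (s≤s (noninv≤square (p ∘ s k))))))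

    -- The degree bound makes the constant term vanish as soon as the window has a descent; the
    -- exponent bound, that of the staircase monomial, confines `S p` to x 0, ..., x (N-2).
    Staircase : ℕ → Mono → Set
    Staircase m e = triangle N ≤ sum e ℕ.+ m × (∀ j → get0 e j ≤ N ∸ suc j)

    S-staircase : ∀ n p → noninv N p ≤ n → All (Staircase (noninv N p) ∘ proj₂) (S p)
    S-staircase n p le with firstAscent? N p
    ... | none e _ = ≡.subst (All _) (≡.sym (S-none p e)) ((ℕₚ.m≤m+n _ _ , downFrom-bound N) ∷ [])
    S-staircase zero    p le | some k e l asc = ⊥-elim (ℕₚ.n≮0 (≡.subst (_≤ 0) (noninv-swap N p k l asc) le))
    S-staircase (suc n) p le | some k e l asc = ≡.subst (All _) (≡.sym (S-some p k e l asc))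
      (All-∂ k drop (S (p ∘ s k)) (S-staircase n (p ∘ s k) (ℕ.s≤s⁻¹ (≡.subst (_≤ suc n) (noninv-swap N p k l asc) le))))
      where
      drop : ∀ e a b → Staircase (noninv N (p ∘ s k)) e → suc (a ℕ.+ b) ≡ get0 e k ℕ.+ get0 e (suc k) →
        a < get0 e k ⊔ get0 e (suc k) → b < get0 e k ⊔ get0 e (suc k) → Staircase (noninv N p) (update k e a b)
      drop e a b (deg , exps) eq a< b< = ≡.subst (triangle N ≤_)
          (≡.trans (≡.cong (ℕ._+ noninv N (p ∘ s k)) (≡.sym (sum-update k e a b eq)))
            (≡.trans (≡.sym (ℕₚ.+-suc _ _)) (≡.cong (sum (update k e a b) ℕ.+_) (≡.sym (noninv-swap N p k l asc))))) deg
        , exps′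
        where
        -- Both new exponents lie strictly below N - 1 - k, and this strictness is what gives the
        -- smaller bound N - 2 - k at k + 1.
        top : get0 e k ⊔ get0 e (suc k) ≤ N ∸ suc k
        top = ℕₚ.⊔-lub (exps k) (ℕₚ.≤-trans (exps (suc k)) (ℕₚ.∸-monoʳ-≤ N (ℕₚ.n≤1+n (suc k))))
        exps′ : ∀ j → get0 (update k e a b) j ≤ N ∸ suc j
        exps′ j with j ℕ.≟ k | j ℕ.≟ suc k
        ... | yes ≡.refl | _ rewrite get0-update₁ k e a b = ℕₚ.<⇒≤ (ℕₚ.<-≤-trans a< top)
        ... | no _ | yes ≡.refl rewrite get0-update₂ k e a b =
                ≡.subst (b ≤_) (ℕₚ.pred[m∸n]≡m∸[1+n] N (suc k)) (ℕₚ.<⇒≤pred (ℕₚ.<-≤-trans b< top))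
        ... | no j≢k | no j≢sk rewrite get0-update-far k e a b j j≢k j≢sk = exps j

    S-free : ∀ p n → N ≤ suc n → Q n (S p) ≈ 0#
    S-free p n le = Q-vanish n (S p) (All.map (λ {t} h → ℕₚ.n≤0⇒n≡0 (≡.subst (get0 (proj₂ t) n ≤_) (ℕₚ.m≤n⇒m∸n≡0 le) (proj₂ h n)))
      (S-staircase (noninv N p) p ℕₚ.≤-refl))

    S-ct : ∀ p k → suc k < N → p (suc k) < p k → ct (S p) ≡ 0ℤ
    S-ct p k l desc = sum-positive⇒ct (S p) (All.map (λ { (deg , _) → positive deg }) (S-staircase (noninv N p) p ℕₚ.≤-refl))
      where
      room : suc (noninv N p) ≤ triangle N
      room = ≡.subst (_≤ triangle N) (≡.trans (noninv-swap N (p ∘ s k) k l (≡.subst₂ _<_ (≡.cong p (≡.sym (s-here k))) (≡.cong p (≡.sym (s-next k))) desc))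
        (≡.cong suc (noninv-cong N (λ j → ≡.cong p (s-involutive k j))))) (noninv≤triangle N (p ∘ s k))
      positive : ∀ {d} → triangle N ≤ d ℕ.+ noninv N p → 1 ≤ d
      positive {zero}  deg = ⊥-elim (ℕₚ.<⇒≱ room deg)
      positive {suc d} deg = s≤s z≤n

    Ascends : (ℕ → ℕ) → Set
    Ascends p = ∀ k → suc k < N → p k < p (suc k) → S p ≈ ∂ k (S (p ∘ s k))

    -- `schubW` uses the first ascent k₀; any other ascent k must give the same. Distant ones
    -- commute. For adjacent ones the induction on non-inversions brings both sides to a triple
    -- divided difference at the same permutation, and the braid relation compares them.
    ascends : ∀ n p → noninv N p ≤ n → Ascends p
    ascends n p le k l asc with firstAscent? N p
    ... | none _ h = ⊥-elim (h k l asc)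
    ascends zero    p le k l asc | some k₀ e₀ l₀ asc₀ = ⊥-elim (ℕₚ.n≮0 (≡.subst (_≤ 0) (noninv-swap N p k₀ l₀ asc₀) le))
    ascends (suc n) p le k l asc | some k₀ e₀ l₀ asc₀ = trans (reflexive (S-some p k₀ e₀ l₀ asc₀)) (compare (ℕₚ.<-cmp k k₀))
      where
      smaller : ∀ {m q} i → suc i < N → q i < q (suc i) → noninv N q ≤ suc m → noninv N (q ∘ s i) ≤ m
      smaller {m} {q} i l asc le = ℕ.s≤s⁻¹ (≡.subst (_≤ suc m) (noninv-swap N q i l asc) le)
      ih : ∀ i → suc i < N → p i < p (suc i) → Ascends (p ∘ s i)
      ih i l asc = ascends n (p ∘ s i) (smaller i l asc le)
      far : ∀ i j → suc i < j → suc i < N → suc j < N → p i < p (suc i) → p j < p (suc j) → ∂ i (S (p ∘ s i)) ≈ ∂ j (S (p ∘ s j))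
      far i j i<j li lj ai aj = begin
        ∂ i (S (p ∘ s i))              ≈⟨ ∂-cong i (ih i li ai j lj (≡.subst₂ _<_ (≡.cong p (≡.sym (s-high i j i<j))) (≡.cong p (≡.sym (s-high i (suc j) (ℕₚ.m<n⇒m<1+n i<j)))) aj)) ⟩
        ∂ i (∂ j (S (p ∘ s i ∘ s j)))  ≈⟨ ∂-comm i j (S (p ∘ s i ∘ s j)) i<j ⟩
        ∂ j (∂ i (S (p ∘ s i ∘ s j)))  ≡⟨ ≡.cong (λ f → ∂ j (∂ i f)) (S-cong (λ m → ≡.cong p (s-comm i j m i<j))) ⟩
        ∂ j (∂ i (S (p ∘ s j ∘ s i)))  ≈⟨ ∂-cong j (ih j lj aj i li (≡.subst₂ _<_ (≡.cong p (≡.sym (s-low j i (ℕₚ.<-trans (ℕₚ.n<1+n i) i<j)))) (≡.cong p (≡.sym (s-low j (suc i) i<j))) ai)) ⟨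
        ∂ j (S (p ∘ s j)) ∎
        where open import Relation.Binary.Reasoning.Setoid setoid
      adjacent : ∀ i → 2 ℕ.+ i < N → p i < p (suc i) → p (suc i) < p (2 ℕ.+ i) → ∂ i (S (p ∘ s i)) ≈ ∂ (suc i) (S (p ∘ s (suc i)))
      adjacent i lj ai aj = begin
        ∂ i (S p₁)                       ≈⟨ ∂-cong i (ih i li ai j lj a₁) ⟩
        ∂ i (∂ j (S p₂))                 ≈⟨ ∂-cong i (∂-cong j (ascends n p₂ (ℕₚ.≤-trans (ℕₚ.≤-trans (ℕₚ.n≤1+n _) (ℕₚ.≤-reflexive (≡.sym (noninv-swap N p₁ j lj a₁)))) (smaller i li ai le)) i li a₂)) ⟩
        ∂ i (∂ j (∂ i (S (p₂ ∘ s i))))   ≈⟨ ∂-braid i (S (p₂ ∘ s i)) ⟩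
        ∂ j (∂ i (∂ j (S (p₂ ∘ s i))))   ≡⟨ ≡.cong (λ f → ∂ j (∂ i (∂ j f))) (S-cong (λ m → ≡.cong p (s-braid i m))) ⟩
        ∂ j (∂ i (∂ j (S (q₂ ∘ s j))))   ≈⟨ ∂-cong j (∂-cong i (ascends n q₂ (ℕₚ.≤-trans (ℕₚ.≤-trans (ℕₚ.n≤1+n _) (ℕₚ.≤-reflexive (≡.sym (noninv-swap N q₁ i li b₁)))) (smaller j lj aj le)) j lj b₂)) ⟨
        ∂ j (∂ i (S q₂))                 ≈⟨ ∂-cong j (ih j lj aj i li b₁) ⟨
        ∂ j (S q₁) ∎
        where
        open import Relation.Binary.Reasoning.Setoid setoid
        j = suc i
        li : suc i < N
        li = ℕₚ.<-trans (ℕₚ.n<1+n _) lj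
        p₁ = p ∘ s i
        p₂ = p₁ ∘ s j
        q₁ = p ∘ s j
        q₂ = q₁ ∘ s i
        a₁ : p (s i j) < p (s i (suc j))
        a₁ = ≡.subst₂ _<_ (≡.cong p (≡.sym (s-next i))) (≡.cong p (≡.sym (s-high i (suc j) ℕₚ.≤-refl))) (ℕₚ.<-trans ai aj)
        a₂ : p (s i (s j i)) < p (s i (s j j))
        a₂ = ≡.subst₂ _<_ (≡.cong p (≡.sym (≡.trans (≡.cong (s i) (s-low j i ℕₚ.≤-refl)) (s-here i))))
               (≡.cong p (≡.sym (≡.trans (≡.cong (s i) (s-here j)) (s-high i (suc j) ℕₚ.≤-refl)))) aj
        b₁ : p (s j i) < p (s j j)
        b₁ = ≡.subst₂ _<_ (≡.cong p (≡.sym (s-low j i ℕₚ.≤-refl))) (≡.cong p (≡.sym (s-here j))) (ℕₚ.<-trans ai aj)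
        b₂ : p (s j (s i j)) < p (s j (s i (suc j)))
        b₂ = ≡.subst₂ _<_ (≡.cong p (≡.sym (≡.trans (≡.cong (s j) (s-next i)) (s-low j i ℕₚ.≤-refl))))
               (≡.cong p (≡.sym (≡.trans (≡.cong (s j) (s-high i (suc j) ℕₚ.≤-refl)) (s-next j)))) ai
      compare : _ → ∂ k₀ (S (p ∘ s k₀)) ≈ ∂ k (S (p ∘ s k))
      compare (tri≈ _ ≡.refl _) = refl
      compare (tri< k<k₀ _ _) with ℕₚ.m≤n⇒m<n∨m≡n k<k₀
      ... | inj₁ h      = sym (far k k₀ h l l₀ asc asc₀)
      ... | inj₂ ≡.refl = sym (adjacent k l₀ asc asc₀)
      compare (tri> _ _ k₀<k) with ℕₚ.m≤n⇒m<n∨m≡n k₀<k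
      ... | inj₁ h      = far k₀ k h l₀ l asc₀ asc
      ... | inj₂ ≡.refl = adjacent k₀ l asc₀ asc

    S-ascends : ∀ p → Ascends p
    S-ascends p = ascends (noninv N p) p ℕₚ.≤-refl

    record Windowed (p : ℕ → ℕ) : Set where
      field
        positive  : Positive p
        injective : Injective p
        fixes     : ∀ j → N ≤ j → p j ≡ suc j
    open Windowed public

    Windowed-perm : ∀ {p} → Windowed p → Perm p
    Windowed-perm w = positive w , N , fixes w

    Windowed-swap : ∀ {p} k → suc k < N → Windowed p → Windowed (p ∘ s k)
    Windowed-swap {p} k l w = record { positive = positive w ∘ s k ; injective = s-injective k (injective w)
      ; fixes = λ j le → ≡.trans (≡.cong p (s-high k j (ℕₚ.≤-trans l le))) (fixes w j le) }

    -- A value above N at a position inside the window would be taken a second time at a fixed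
    -- position outside it.
    inside : ∀ {p} → Windowed p → ∀ j → j < N → p j ≤ N
    inside {p} w j j<N with p j ℕₚ.≤? N
    ... | yes h = h
    ... | no h  = ⊥-elim (ℕₚ.<⇒≱ j<N (≡.subst (N ≤_) (injective w i j e) N≤i))
      where
      i = ℕ.pred (p j)
      pj≡ : suc i ≡ p j
      pj≡ = ℕₚ.suc-pred (p j) ⦃ ℕ.>-nonZero (positive w j) ⦄
      N≤i : N ≤ i
      N≤i = ℕ.s≤s⁻¹ (≡.subst (suc N ≤_) (≡.sym pj≡) (ℕₚ.≰⇒> h))
      e : p i ≡ p j
      e = ≡.trans (fixes w i N≤i) pj≡

    outer-ascent : ∀ {p} → Windowed p → ∀ k → N ≤ suc k → p k < p (suc k)
    outer-ascent {p} w k le = ≡.subst (p k <_) (≡.sym (fixes w (suc k) le)) (s≤s (capped (k ℕₚ.<? N)))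
      where
      capped : _ → p k ≤ suc k
      capped (yes k<N) = ℕₚ.≤-trans (inside w k k<N) le
      capped (no k≮N)  = ℕₚ.≤-reflexive (fixes w k (ℕₚ.≮⇒≥ k≮N))

    descent-inside : ∀ {p} → Windowed p → ∀ k → p (suc k) < p k → suc k < N
    descent-inside w k d with suc k ℕₚ.<? N
    ... | yes h = h
    ... | no h  = ⊥-elim (ℕₚ.<-asym d (outer-ascent w k (ℕₚ.≮⇒≥ h)))

    find-descent : ∀ {p} → Windowed p → Increasing p ⊎ ∃ λ k → p (suc k) < p k
    find-descent {p} w = search N (λ k le → outer-ascent w k (ℕₚ.≤-trans le (ℕₚ.n≤1+n k)))
      where
      search : ∀ n → (∀ k → n ≤ k → p k < p (suc k)) → Increasing p ⊎ ∃ λ k → p (suc k) < p k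
      search zero    h = inj₁ (λ k → h k z≤n)
      search (suc n) h with ℕₚ.<-cmp (p n) (p (suc n))
      ... | tri> _ _ d = inj₂ (n , d)
      ... | tri≈ _ e _ = ⊥-elim (ℕₚ.<⇒≢ ℕₚ.≤-refl (injective w n (suc n) e))
      ... | tri< a _ _ = search n λ k le → ascent k (ℕₚ.m≤n⇒m<n∨m≡n le)
        where
        ascent : ∀ k → n < k ⊎ n ≡ k → p k < p (suc k)
        ascent k (inj₁ n<k)    = h k n<k
        ascent k (inj₂ ≡.refl) = a

    S-flat : ∀ {p} → Windowed p → ∀ k → p k < p (suc k) → ∂ k (S p) ≈ 0#
    S-flat {p} w k asc with suc k ℕₚ.<? N
    ... | yes l = trans (∂-cong k (S-ascends p k l asc)) (∂² k (S (p ∘ s k)))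
    ... | no  h = ∂-free k (S p) (S-free p k (ℕₚ.≮⇒≥ h)) (S-free p (suc k) (ℕₚ.≤-trans (ℕₚ.≮⇒≥ h) (ℕₚ.n≤1+n _)))

    S-descends : ∀ p k → suc k < N → p (suc k) < p k → S (p ∘ s k) ≈ ∂ k (S p)
    S-descends p k l desc = trans (S-ascends (p ∘ s k) k l (≡.subst₂ _<_ (≡.cong p (≡.sym (s-here k))) (≡.cong p (≡.sym (s-next k))) desc))
      (∂-cong k (reflexive (S-cong (λ j → ≡.cong p (s-involutive k j)))))

    -- The common factor of all `S p`, left unknown for the moment: the full chain of divided
    -- differences is never evaluated on the staircase monomial.
    identityValue : ℤ
    identityValue = ct (S suc)

    -- Induction on the number of inversions, which `triangle N` minus `noninv N p` measures.
    S-Sch : ∀ {p} → Windowed p → Sch identityValue p (S p)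
    S-Sch {p} w = go (triangle N) w (ℕₚ.m≤n+m _ (noninv N p))
      where
      go : ∀ n {p} → Windowed p → triangle N ≤ noninv N p ℕ.+ n → Sch identityValue p (S p)
      go n {p} w le = sch (λ k e → ℕₚ.<⇒≢ ℕₚ.≤-refl (injective w k (suc k) e)) (constant (find-descent w)) (S-flat w) (step n le)
        where
        constant : Increasing p ⊎ (∃ λ k → p (suc k) < p k) → (Increasing p × ct (S p) ≡ identityValue) ⊎ (∃ λ k → p (suc k) < p k × ct (S p) ≡ 0ℤ)
        constant (inj₁ i)       = inj₁ (i , ≡.cong ct (S-cong (increasing-id (Windowed-perm w) i)))
        constant (inj₂ (k , d)) = inj₂ (k , d , S-ct p k (descent-inside w k d) d)
        gain : ∀ k → p (suc k) < p k → noninv N (p ∘ s k) ≡ suc (noninv N p)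
        gain k d = ≡.trans (noninv-swap N (p ∘ s k) k (descent-inside w k d) (≡.subst₂ _<_ (≡.cong p (≡.sym (s-here k))) (≡.cong p (≡.sym (s-next k))) d))
          (≡.cong suc (noninv-cong N (λ j → ≡.cong p (s-involutive k j))))
        step : ∀ n → triangle N ≤ noninv N p ℕ.+ n → ∀ k → p (suc k) < p k → Sch identityValue (p ∘ s k) (∂ k (S p))
        step zero    le k d = ⊥-elim (ℕₚ.<⇒≱ (≡.subst (_≤ triangle N) (gain k d) (noninv≤triangle N (p ∘ s k))) (≡.subst (triangle N ≤_) (ℕₚ.+-identityʳ _) le))
        step (suc n) le k d = Sch-cong (S-descends p k (descent-inside w k d) d)
          (go n (Windowed-swap k (descent-inside w k d) w) (≡.subst (triangle N ≤_) (≡.trans (ℕₚ.+-suc _ n) (≡.cong (ℕ._+ n) (≡.sym (gain k d)))) le))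

    w₀ : ℕ → ℕ
    w₀ j with j ℕₚ.<? N
    ... | yes _ = N ∸ j
    ... | no  _ = suc j

    w₀-low : ∀ j → j < N → w₀ j ≡ N ∸ j
    w₀-low j h with j ℕₚ.<? N
    ... | yes _ = ≡.refl
    ... | no h′ = ⊥-elim (h′ h)

    w₀-high : ∀ j → N ≤ j → w₀ j ≡ suc j
    w₀-high j h with j ℕₚ.<? N
    ... | yes h′ = ⊥-elim (ℕₚ.<⇒≱ h′ h)
    ... | no _ = ≡.refl

    w₀-windowed : Windowed w₀
    w₀-windowed = record { positive = pos ; injective = inj ; fixes = w₀-high }
      where
      pos : Positive w₀
      pos j with j ℕₚ.<? N
      ... | yes h = ℕₚ.m<n⇒0<n∸m h
      ... | no _  = s≤s z≤n
      inj : Injective w₀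
      inj i j e with i ℕₚ.<? N | j ℕₚ.<? N
      ... | yes h | yes h′ = ℕₚ.∸-cancelˡ-≡ (ℕₚ.<⇒≤ h) (ℕₚ.<⇒≤ h′) e
      ... | yes h | no h′ = ⊥-elim (ℕₚ.<⇒≱ (s≤s (ℕₚ.≮⇒≥ h′)) (≡.subst (_≤ N) e (ℕₚ.m∸n≤m N i)))
      ... | no h | yes h′ = ⊥-elim (ℕₚ.<⇒≱ (s≤s (ℕₚ.≮⇒≥ h)) (≡.subst (_≤ N) (≡.sym e) (ℕₚ.m∸n≤m N j)))
      ... | no h | no h′ = ℕₚ.suc-injective e

    S-w₀ : S w₀ ≡ monomial (downFrom N)
    S-w₀ with firstAscent? N w₀
    ... | none e _ = S-none w₀ e
    ... | some k _ l asc = ⊥-elim (ℕₚ.<⇒≱ asc (≡.subst₂ _≤_ (≡.sym (w₀-low (suc k) l)) (≡.sym (w₀-low k (ℕₚ.<-trans (ℕₚ.n<1+n k) l)))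
            (ℕₚ.∸-monoʳ-≤ N (ℕₚ.n≤1+n k))))

    -- The leading coefficient of S w₀ is 1, so the constant cannot be anything else.
    identityValue≡1 : identityValue ≡ 1ℤ
    identityValue≡1 = Lead-unique N refl (≡.subst (λ f → Lead N f identityValue) S-w₀ (Top⇒Lead N (proj₂ (Sch-Top (S-Sch w₀-windowed) N inc))))
      lead nonzero (λ ())
      where
      lead : Lead N (monomial (downFrom N)) 1ℤ
      lead = Lead-monomial N (downFrom N) (λ j N≤j → ℕₚ.n≤0⇒n≡0 (≡.subst (get0 (downFrom N) j ≤_) (ℕₚ.m≤n⇒m∸n≡0 (ℕₚ.m≤n⇒m≤1+n N≤j)) (downFrom-bound N j)))
      inc : ∀ j → N ≤ j → w₀ j < w₀ (suc j)
      inc j le = outer-ascent w₀-windowed j (ℕₚ.m≤n⇒m≤1+n le)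
      nonzero : identityValue ≢ 0ℤ
      nonzero z with Lead-0 N lead (trans (reflexive (≡.sym S-w₀)) (Sch-0 (≡.subst (λ c → Sch c w₀ (S w₀)) z (S-Sch w₀-windowed))))
      ... | ()

    S-Schubert : ∀ {p} → Windowed p → Sch 1ℤ p (S p)
    S-Schubert {p} w = ≡.subst (λ c → Sch c p (S p)) identityValue≡1 (S-Sch w)

  -- From bijections of the integers to one-line notation

  fun-injective : ∀ w {i j} → fun w i ≡ fun w j → i ≡ j
  fun-injective w {i} {j} e = ≡.trans (≡.sym (inv∘fun w i)) (≡.trans (≡.cong (inv w) e) (inv∘fun w j))

  perm : SZ+ → ℕ → ℕ
  perm u j = ∣ fun (proj₁ u) (+ suc j) ∣

  -- Every integer ≤ 0 is already the value at itself, and the map is injective.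
  fun-positive : ∀ (u : SZ+) j → ∃ λ m → fun (proj₁ u) (+ suc j) ≡ + suc m
  fun-positive (w , fix) j with fun w (+ suc j) in eq
  ... | + suc m  = m , ≡.refl
  ... | + zero   with fun-injective w (≡.trans eq (≡.sym (fix 0ℤ ℤₚ.≤-refl)))
  ...   | ()
  fun-positive (w , fix) j | -[1+ m ] with fun-injective w (≡.trans eq (≡.sym (fix -[1+ m ] ℤ.-≤+)))
  ...   | ()

  fun-perm : ∀ u j → fun (proj₁ u) (+ suc j) ≡ + perm u j
  fun-perm u j with fun-positive u j
  ... | m , e = ≡.trans e (≡.cong (λ i → + ∣ i ∣) (≡.sym e))

  perm-windowed : ∀ u → Window.Windowed (bound (proj₁ u)) (perm u)
  perm-windowed u = record
    { positive = λ j → ≡.subst (λ i → 1 ≤ ∣ i ∣) (≡.sym (proj₂ (fun-positive u j))) (s≤s z≤n)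
    ; injective = λ i j e → ℕₚ.suc-injective (ℤₚ.+-injective (fun-injective (proj₁ u)
        (≡.trans (fun-perm u i) (≡.trans (≡.cong +_ e) (≡.sym (fun-perm u j))))))
    ; fixes = λ j le → ≡.cong ∣_∣ (fixed (proj₁ u) (+ suc j) (s≤s le)) }

  perm-perm : ∀ u → Perm (perm u)
  perm-perm u = Window.Windowed-perm (bound (proj₁ u)) (perm-windowed u)

  perm-positive : ∀ u → Positive (perm u)
  perm-positive u = proj₁ (perm-perm u)

  schubert-Sch : ∀ u → Sch 1ℤ (perm u) (schubert u)
  schubert-Sch u = ≡.subst (Sch 1ℤ (perm u)) (≡.sym unfold) (Window.S-Schubert N (perm-windowed u))
    where
    N = bound (proj₁ u)
    word≡ : word (proj₁ u) ≡ applyUpTo (perm u) N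
    word≡ = map-upTo (perm u) N
    unfold : schubert u ≡ Window.S N (perm u)
    unfold = ≡.trans (≡.cong (λ l → schubW (suc (length l ℕ.* length l)) l) word≡)
      (≡.cong (λ n → schubW (suc (n ℕ.* n)) (applyUpTo (perm u) N)) (length-applyUpTo (perm u) N))

  ≐⇒≗ : ∀ u v → proj₁ u ≐ proj₁ v → perm u ≗ perm v
  ≐⇒≗ u v e j = ≡.cong ∣_∣ (e (+ suc j))

  ≗⇒≐ : ∀ u v → perm u ≗ perm v → proj₁ u ≐ proj₁ v
  ≗⇒≐ u v e (+ suc j)  = ≡.trans (fun-perm u j) (≡.trans (≡.cong +_ (e j)) (≡.sym (fun-perm v j)))
  ≗⇒≐ u v e (+ zero)   = ≡.trans (proj₂ u _ ℤₚ.≤-refl) (≡.sym (proj₂ v _ ℤₚ.≤-refl))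
  ≗⇒≐ u v e (-[1+ m ]) = ≡.trans (proj₂ u _ ℤ.-≤+) (≡.sym (proj₂ v _ ℤ.-≤+))

  -- Beyond both bounds the two permutations are the identity, so finitely many comparisons decide.
  _≐?_ : ∀ u v → Dec (proj₁ u ≐ proj₁ v)
  u ≐? v with ℕₚ.allUpTo? (λ j → perm u j ℕ.≟ perm v j) (bound (proj₁ u) ⊔ bound (proj₁ v))
  ... | no ne = no (λ e → ne (λ {j} _ → ≐⇒≗ u v e j))
  ... | yes h = yes (≗⇒≐ u v agree)
    where
    agree : perm u ≗ perm v
    agree j with j ℕₚ.<? bound (proj₁ u) ⊔ bound (proj₁ v)
    ... | yes j<N = h j<N
    ... | no j≮N = ≡.trans (Window.fixes (perm-windowed u) j (ℕₚ.m⊔n≤o⇒m≤o _ (bound (proj₁ v)) (ℕₚ.≮⇒≥ j≮N)))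
                    (≡.sym (Window.fixes (perm-windowed v) j (ℕₚ.m⊔n≤o⇒n≤o (bound (proj₁ u)) _ (ℕₚ.≮⇒≥ j≮N))))

  scaleP≈ : ∀ a f → scaleP a f ≈ const a * f
  scaleP≈ a f .pair φ r = ≡.trans (pair-scale φ a f) (≡.sym (pair-const* φ a f))

  κ-scale : ∀ ks a f → κ ks (scaleP a f) ≡ a ℤ.* κ ks f
  κ-scale ks a f = ≡.trans (ct-cong (trans (⟨ ∂∗-additive ks ⟩cong (scaleP≈ a f)) (homo-const (∂∗-additive ks) a f)))
    (pair-const* (indicator []) a (∂∗ ks f))

  κ-other : ∀ w x {ks} → Reduced (perm w) ks → ¬ (proj₁ w ≐ proj₁ x) → κ ks (schubert x) ≡ 0ℤ
  κ-other w x r ne = κ-diff (perm-perm x) (perm-perm w) (λ e → ne (≗⇒≐ w x (λ j → ≡.sym (e j)))) (schubert-Sch x) r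

  κ-sumS-none : ∀ w {ks} → Reduced (perm w) ks → ∀ c L → (∀ x → x ∈ L → ¬ (proj₁ w ≐ proj₁ x)) → κ ks (sumS c L) ≡ 0ℤ
  κ-sumS-none w {ks} r c []      h = κ-0 ks refl
  κ-sumS-none w {ks} r c (x ∷ L) h = ≡.trans (κ-+ ks (scaleP (c x) (schubert x)) (sumS c L)) (≡.cong₂ ℤ._+_
    (≡.trans (κ-scale ks (c x) (schubert x)) (≡.trans (≡.cong (c x ℤ.*_) (κ-other w x r (h x (here ≡.refl)))) (ℤₚ.*-zeroʳ (c x))))
    (κ-sumS-none w r c L (λ y y∈ → h y (there y∈))))

  -- The list of an expansion need not mention w: either it holds an equal permutation, whose
  -- coefficient is read off, or κ does not see the sum, and there the definition of structure
  -- constants makes c zero.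
  κ-sumS : ∀ w {ks} → Reduced (perm w) ks → ∀ c L → AllPairs (λ x y → ¬ (proj₁ x ≐ proj₁ y)) L →
    (∃ λ x → proj₁ w ≐ proj₁ x × κ ks (sumS c L) ≡ c x) ⊎ ((∀ x → x ∈ L → ¬ (proj₁ w ≐ proj₁ x)) × κ ks (sumS c L) ≡ 0ℤ)
  κ-sumS w {ks} r c [] _ = inj₂ ((λ x ()) , κ-0 ks refl)
  κ-sumS w {ks} r c (x ∷ L) (x# ∷ L#) = cases (w ≐? x) (κ-sumS w r c L L#)
    where
    split : κ ks (sumS c (x ∷ L)) ≡ c x ℤ.* κ ks (schubert x) ℤ.+ κ ks (sumS c L)
    split = ≡.trans (κ-+ ks (scaleP (c x) (schubert x)) (sumS c L)) (≡.cong (λ t → t ℤ.+ κ ks (sumS c L)) (κ-scale ks (c x) (schubert x)))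
    skipped : ¬ (proj₁ w ≐ proj₁ x) → κ ks (sumS c (x ∷ L)) ≡ κ ks (sumS c L)
    skipped ne = ≡.trans split (≡.trans (≡.cong (λ t → c x ℤ.* t ℤ.+ κ ks (sumS c L)) (κ-other w x r ne))
      (≡.trans (≡.cong (λ t → t ℤ.+ κ ks (sumS c L)) (ℤₚ.*-zeroʳ (c x))) (ℤₚ.+-identityˡ _)))
    cases : Dec (proj₁ w ≐ proj₁ x) → _ → _
    cases (yes e) _ = inj₁ (x , e , ≡.trans split (≡.trans (≡.cong₂ (λ s t → c x ℤ.* s ℤ.+ t)
        (κ-same (≐⇒≗ x w (λ i → ≡.sym (e i))) (schubert-Sch x) r)
        (κ-sumS-none w r c L (λ y y∈ w≐y → All.lookup x# y∈ (λ i → ≡.trans (≡.sym (e i)) (w≐y i)))))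
      (≡.trans (ℤₚ.+-identityʳ _) (ℤₚ.*-identityʳ (c x)))))
    cases (no ne) (inj₁ (y , e , k)) = inj₁ (y , e , ≡.trans (skipped ne) k)
    cases (no ne) (inj₂ (h , k)) = inj₂ ((λ { y (here ≡.refl) → ne ; y (there y∈) → h y y∈ }) , ≡.trans (skipped ne) k)

  shiftSZ : ℤ → SZ → SZ
  shiftSZ t w = record
    { fun = λ i → fun w (i ℤ.- t) ℤ.+ t
    ; inv = λ i → inv w (i ℤ.- t) ℤ.+ t
    ; inv∘fun = λ i → ≡.trans (≡.cong (λ j → inv w j ℤ.+ t) (cancel (fun w (i ℤ.- t)) t)) (≡.trans (≡.cong (ℤ._+ t) (inv∘fun w _)) (restore i t))
    ; fun∘inv = λ i → ≡.trans (≡.cong (λ j → fun w j ℤ.+ t) (cancel (inv w (i ℤ.- t)) t)) (≡.trans (≡.cong (ℤ._+ t) (fun∘inv w _)) (restore i t))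
    ; bound = bound w ℕ.+ ∣ t ∣
    ; fixed = λ i h → ≡.trans (≡.cong (ℤ._+ t) (fixed w (i ℤ.- t) (far i h))) (restore i t) }
    where
    cancel : ∀ a t → a ℤ.+ t ℤ.- t ≡ a
    cancel = solve-∀
    restore : ∀ i t → i ℤ.- t ℤ.+ t ≡ i
    restore = solve-∀
    far : ∀ i → bound w ℕ.+ ∣ t ∣ < ∣ i ∣ → bound w < ∣ i ℤ.- t ∣
    far i h = ℕₚ.+-cancelʳ-< ∣ t ∣ _ _ (ℕₚ.<-≤-trans h (≡.subst (λ j → ∣ j ∣ ≤ ∣ i ℤ.- t ∣ ℕ.+ ∣ t ∣) (restore i t) (ℤₚ.∣i+j∣≤∣i∣+∣j∣ (i ℤ.- t) t)))

  up : SZ+ → SZ+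
  up (w , fix) = shiftSZ 1ℤ w , λ i i≤0 → ≡.trans (≡.cong (ℤ._+ 1ℤ) (fix (i ℤ.- 1ℤ) (ℤₚ.≤-trans (ℤₚ.i-j≤i i 1ℤ) i≤0))) (restore i)
    where
    restore : ∀ i → i ℤ.- 1ℤ ℤ.+ 1ℤ ≡ i
    restore = solve-∀

  -- Shifting back makes the former image of 1 the image of 0, so 1 has to be fixed beforehand.
  down : ∀ u → perm u 0 ≡ 1 → SZ+
  down (w , fix) p0 = shiftSZ (ℤ.- 1ℤ) w , fixes
    where
    fixes : ∀ i → i ℤ.≤ 0ℤ → fun w (i ℤ.- (ℤ.- 1ℤ)) ℤ.+ (ℤ.- 1ℤ) ≡ i
    fixes (+ zero)   _ = ≡.cong (ℤ._+ (ℤ.- 1ℤ)) (≡.trans (fun-perm (w , fix) 0) (≡.cong +_ p0))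
    fixes (+ suc _)  (ℤ.+≤+ ())
    fixes -[1+ zero ]  _ = ≡.cong (ℤ._+ (ℤ.- 1ℤ)) (fix 0ℤ ℤₚ.≤-refl)
    fixes -[1+ suc m ] _ = ≡.trans (≡.cong (ℤ._+ (ℤ.- 1ℤ)) (fix -[1+ m ] ℤ.-≤+)) (≡.cong (λ n → -[1+ suc n ]) (ℕₚ.+-identityʳ m))

  perm-up : ∀ u → perm (up u) ≗ γ (perm u)
  perm-up u zero    = ≡.cong (λ i → ∣ i ℤ.+ 1ℤ ∣) (proj₂ u 0ℤ ℤₚ.≤-refl)
  perm-up u (suc j) = ≡.trans (≡.cong (λ i → ∣ i ℤ.+ 1ℤ ∣) (fun-perm u j)) (ℕₚ.+-comm (perm u j) 1)

  perm-down : ∀ u p0 → perm u ≗ γ (perm (down u p0))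
  perm-down u p0 zero    = p0
  perm-down u p0 (suc j) = ≡.sym (≡.trans (≡.cong suc (≡.cong ∣_∣ shifted)) (ℕₚ.suc-pred n ⦃ ℕ.>-nonZero (perm-positive u (suc j)) ⦄))
    where
    n = perm u (suc j)
    pred⊖ : ∀ n → 1 ≤ n → + n ℤ.+ (ℤ.- 1ℤ) ≡ + ℕ.pred n
    pred⊖ (suc n) _ = ≡.refl
    next : ∀ j → + suc j ℤ.- (ℤ.- 1ℤ) ≡ + suc (suc j)
    next j = ≡.cong (λ n → + suc n) (ℕₚ.+-comm j 1)
    shifted : fun (proj₁ (down u p0)) (+ suc j) ≡ + ℕ.pred n
    shifted = ≡.trans (≡.cong (λ i → fun (proj₁ u) i ℤ.+ (ℤ.- 1ℤ)) (next j))
      (≡.trans (≡.cong (ℤ._+ (ℤ.- 1ℤ)) (fun-perm u (suc j))) (pred⊖ n (perm-positive u (suc j))))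

  schubert-γ : ∀ {u u₁} → perm u₁ ≗ γ (perm u) → schubert u₁ ≈ Γ (schubert u)
  schubert-γ {u} {u₁} h = Sch-unique (Sch-≗ h (schubert-Sch u₁)) (Sch-Γ (perm-positive u) (schubert-Sch u))

  -- Structure constants under one shift

  module StructureConstants (c : SZ+ → SZ+ → SZ+ → ℤ) (isc : IsStructureConstants c) where

    private
      respects = proj₁ isc
      expand = proj₂ isc

    c-κ : ∀ u v w {ks} → Reduced (perm w) ks → c u v w ≡ κ ks (schubert u * schubert v)
    c-κ u v w {ks} r = ≡.trans (cases (κ-sumS w r (c u v) L distinct)) (≡.sym (κ-cong ks (≈P⇒≋ product)))
      where
      L = proj₁ (expand u v)
      distinct = proj₁ (proj₂ (expand u v))
      outside = proj₁ (proj₂ (proj₂ (expand u v)))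
      product = proj₂ (proj₂ (proj₂ (expand u v)))
      cases : _ → c u v w ≡ κ ks (sumS (c u v) L)
      cases (inj₁ (x , e , k)) = ≡.trans (respects u u v v w x (λ _ → ≡.refl) (λ _ → ≡.refl) e) (≡.sym k)
      cases (inj₂ (h , k))     = ≡.trans (outside w h) (≡.sym k)

    -- A reduced word of the shifted w has all letters raised by one. Its functional factors through
    -- ρ 0, which is multiplicative and undoes Γ on both factors.
    c-shift : ∀ {u u₁ v v₁ w w₁} → perm u₁ ≗ γ (perm u) → perm v₁ ≗ γ (perm v) → perm w₁ ≗ γ (perm w) → c u₁ v₁ w₁ ≡ c u v w
    c-shift {u} {u₁} {v} {v₁} {w} {w₁} hu hv hw = begin
      c u₁ v₁ w₁                                              ≡⟨ c-κ u₁ v₁ w₁ (Reduced-≗ (λ j → ≡.sym (hw j)) (Reduced-γ (perm-positive w) r)) ⟩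
      κ (map suc ks) (schubert u₁ * schubert v₁)              ≡⟨ κ-cong (map suc ks) (*-cong (schubert-γ {u} {u₁} hu) (schubert-γ {v} {v₁} hv)) ⟩
      κ (map suc ks) (Γ (schubert u) * Γ (schubert v))        ≡⟨ κ-ρ ks _ ⟩
      κ ks (ρ 0 (Γ (schubert u) * Γ (schubert v)))            ≡⟨ κ-cong ks (trans (ρ-* 0 (Γ (schubert u)) (Γ (schubert v))) (*-cong (ρ₀-Γ (schubert u)) (ρ₀-Γ (schubert v)))) ⟩
      κ ks (schubert u * schubert v)                          ≡⟨ c-κ u v w r ⟨
      c u v w ∎
      where
      open ≡.≡-Reasoning
      ks = proj₁ (Sch-reduced (schubert-Sch w))
      r = proj₂ (Sch-reduced (schubert-Sch w))

    -- The shifted product lies in the image of Γ, on which κ vanishes for permutations moving 1.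
    c-stable : ∀ {u u₁ v v₁ ε δ} → perm u₁ ≗ γ (perm u) → perm v₁ ≗ γ (perm v) → IsTheta ε (perm u) → IsTheta δ (perm v) →
      (∀ j → total ε δ j ≤ j) → ∀ x → ¬ (c u₁ v₁ x ≡ 0ℤ) → perm x 0 ≡ 1
    c-stable {u} {u₁} {v} {v₁} hu hv Θu Θv bound x c≢0 with perm x 0 ℕ.≟ 1
    ... | yes e = e
    ... | no ne = ⊥-elim (c≢0 (≡.trans (c-κ u₁ v₁ x r) (≡.trans (κ-cong ks product) (κ-Γ (perm-perm x) ne r (schubert u * schubert v)))))
      where
      ks = proj₁ (Sch-reduced (schubert-Sch x))
      r = proj₂ (Sch-reduced (schubert-Sch x))
      product : schubert u₁ * schubert v₁ ≈ Γ (schubert u * schubert v)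
      product = trans (*-cong (schubert-γ {u} {u₁} hu) (schubert-γ {v} {v₁} hv))
        (Γ-multiplicative (perm-perm u) (perm-perm v) (schubert-Sch u) (schubert-Sch v) Θu Θv bound)

    -- Were there no such term, every Schubert polynomial with nonzero coefficient would be in the
    -- image of Γ, hence fixed by Γ ∘ ρ 0; then Γ f · Γ g = Γ (ρ 0 (Γ f · Γ g)) = Γ (f g), which the
    -- excess forbids. The expansion is a finite list, so the witness is found by search.
    c-unstable : ∀ {u u₁ v v₁ ε δ} → perm u₁ ≗ γ (perm u) → perm v₁ ≗ γ (perm v) → IsTheta ε (perm u) → IsTheta δ (perm v) →
      ∀ k → ε k ≡ 1 → δ k ≡ 1 → total ε δ k ≡ k → (∀ j → j ≤ k → total ε δ j ≤ j) →
      ∃ λ x → ¬ (c u₁ v₁ x ≡ 0ℤ) × perm x 0 ≢ 1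
    c-unstable {u} {u₁} {v} {v₁} hu hv Θu Θv k εk δk tot bound = search (Any.any? moved? L)
      where
      L = proj₁ (expand u₁ v₁)
      Moved : SZ+ → Set
      Moved x = ¬ (c u₁ v₁ x ≡ 0ℤ) × perm x 0 ≢ 1
      moved? : ∀ x → Dec (Moved x)
      moved? x with c u₁ v₁ x ℤ.≟ 0ℤ | perm x 0 ℕ.≟ 1
      ... | yes z | _     = no (λ m → proj₁ m z)
      ... | no _  | yes e = no (λ m → proj₂ m e)
      ... | no z  | no e  = yes (z , e)
      f = schubert u
      g = schubert v
      Γρ : Additive (λ h → Γ (ρ 0 h))
      Γρ = ∘-additive Γ-additive (ρ-additive 0)
      fixed-term : ∀ x → ¬ Moved x → Γ (ρ 0 (scaleP (c u₁ v₁ x) (schubert x))) ≈ scaleP (c u₁ v₁ x) (schubert x)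
      fixed-term x h = trans (⟨ Γρ ⟩cong (scaleP≈ a (schubert x))) (trans (homo-const Γρ a (schubert x)) (trans same (sym (scaleP≈ a (schubert x)))))
        where
        a = c u₁ v₁ x
        same : const a * Γ (ρ 0 (schubert x)) ≈ const a * schubert x
        same with a ℤ.≟ 0ℤ | perm x 0 ℕ.≟ 1
        ... | yes z | _ rewrite z = trans (*≈0ˡ const-0) (sym (*≈0ˡ const-0))
        ... | no z | no e = ⊥-elim (h (z , e))
        ... | no _ | yes e = ⟨ *-additive (const a) ⟩cong (trans (Γ-cong (trans (ρ-cong 0 lifted) (ρ₀-Γ (schubert y)))) (sym lifted))
          where
          y = down x e
          lifted : schubert x ≈ Γ (schubert y)
          lifted = schubert-γ {y} {x} (perm-down x e)
      fixed-sum : ∀ L → ¬ Any Moved L → Γ (ρ 0 (sumS (c u₁ v₁) L)) ≈ sumS (c u₁ v₁) L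
      fixed-sum []      _ = homo-0 Γρ
      fixed-sum (x ∷ L) h = trans (homo-+ Γρ (scaleP (c u₁ v₁ x) (schubert x)) (sumS (c u₁ v₁) L))
        (+-cong (fixed-term x (λ m → h (here m))) (fixed-sum L (λ a → h (there a))))
      search : Dec (Any Moved L) → ∃ Moved
      search (yes m) = proj₁ (find m) , proj₂ (proj₂ (find m))
      search (no h)  = ⊥-elim (Γ-not-multiplicative (perm-perm u) (perm-perm v) (schubert-Sch u) (schubert-Sch v) Θu Θv k εk δk tot bound multiplicative)
        where
        product : Γ f * Γ g ≈ sumS (c u₁ v₁) L
        product = trans (sym (*-cong (schubert-γ {u} {u₁} hu) (schubert-γ {v} {v₁} hv))) (≈P⇒≋ (proj₂ (proj₂ (proj₂ (expand u₁ v₁)))))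
        restored : ρ 0 (sumS (c u₁ v₁) L) ≈ f * g
        restored = trans (ρ-cong 0 (sym product)) (trans (ρ-* 0 (Γ f) (Γ g)) (*-cong (ρ₀-Γ f) (ρ₀-Γ g)))
        multiplicative : Γ f * Γ g ≈ Γ (f * g)
        multiplicative = trans product (trans (sym (fixed-sum L h)) (Γ-cong restored))

  -- The given θ, and iterated shifts

  perm-tail : ∀ u m → bound (proj₁ u) ≤ m → NoInv (perm u) m
  perm-tail u m le = NoInv-from m (Perm-increasing (perm-perm u) m le)

  -- Justifies the finite search in `thetaB`: position j stands for the integer j + 1, which is
  -- beyond the bound here.
  perm-late : ∀ u m j → m < j → bound (proj₁ u) ≤ j → perm u m < perm u j
  perm-late u m j m<j le = ≡.subst (perm u m <_) (≡.sym (Window.fixes W j le)) (s≤s (below (m ℕₚ.<? bound (proj₁ u))))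
    where
    W = perm-windowed u
    below : _ → perm u m ≤ j
    below (yes m<N) = ℕₚ.≤-trans (Window.inside (bound (proj₁ u)) W m m<N) le
    below (no m≮N)  = ℕₚ.≤-trans (ℕₚ.≤-reflexive (Window.fixes W m (ℕₚ.≮⇒≥ m≮N))) m<j

  θ-theta : ∀ u → IsTheta (λ m → θ u (suc m)) (perm u)
  θ-theta u@(w , _) = binary , λ m → noInv m , zero-θ m
    where
    -- Position m stands for the integer m + 1, so the search starts at m + 2.
    candidates : ℕ → List ℕ
    candidates m = map (λ t → suc (suc m) ℕ.+ t) (upTo (bound w ∸ suc m))
    smaller : ℕ → ℕ → Bool
    smaller m j = ⌊ fun w (+ j) ℤ.<? fun w (+ suc m) ⌋
    binary : Binary (λ m → θ u (suc m))
    binary m with thetaB w (suc m)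
    ... | true  = inj₂ ≡.refl
    ... | false = inj₁ ≡.refl
    noInv : ∀ m → θ u (suc m) ≡ 0 → NoInv (perm u) m
    noInv m z j m<j with bound w ℕₚ.≤? j
    ... | yes le = perm-late u m j m<j le
    ... | no nle = ℕₚ.≤∧≢⇒< (ℕₚ.≮⇒≥ not-smaller) (λ e → ℕₚ.<⇒≢ m<j (Window.injective (perm-windowed u) m j e))
      where
      t = j ∸ suc m
      position : suc (suc m) ℕ.+ t ≡ suc j
      position = ≡.cong suc (ℕₚ.m+[n∸m]≡n m<j)
      member : suc j ∈ candidates m
      member = ≡.subst (_∈ candidates m) position (∈-map⁺ (λ t → suc (suc m) ℕ.+ t)
        (∈-upTo⁺ (ℕₚ.∸-monoˡ-< (ℕₚ.≰⇒> nle) m<j)))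
      detect : ∀ b → (if b then 1 else 0) ≡ 0 → ¬ T b
      detect false _ ()
      not-smaller : ¬ (perm u j < perm u m)
      not-smaller lt = detect (thetaB w (suc m)) z (Any.any⁺ (smaller m) (lose member
        (fromWitness {a? = fun w (+ suc j) ℤ.<? fun w (+ suc m)} (≡.subst₂ ℤ._<_ (≡.sym (fun-perm u j)) (≡.sym (fun-perm u m)) (ℤ.+<+ lt)))))
    zero-θ : ∀ m → NoInv (perm u) m → θ u (suc m) ≡ 0
    zero-θ m h = undetected (thetaB w (suc m)) absent
      where
      undetected : ∀ b → ¬ T b → (if b then 1 else 0) ≡ 0
      undetected false _ = ≡.refl
      undetected true  n = ⊥-elim (n _)
      absent : ¬ T (thetaB w (suc m))
      absent t with find (Any.any⁻ (smaller m) (candidates m) t)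
      ... | j , j∈ , s with ∈-map⁻ (λ t → suc (suc m) ℕ.+ t) j∈
      ... | t′ , _ , ≡.refl = ℕₚ.<-asym (h (suc m ℕ.+ t′) (s≤s (ℕₚ.m≤m+n m t′)))
            (ℤₚ.drop‿+<+ (≡.subst₂ ℤ._<_ (fun-perm u (suc m ℕ.+ t′)) (fun-perm u m)
              (toWitness {a? = fun w (+ suc (suc m ℕ.+ t′)) ℤ.<? fun w (+ suc m)} s)))

  lift : ℕ → SZ+ → SZ+
  lift zero    u = u
  lift (suc k) u = up (lift k u)

  up-shiftF : ∀ k (f : ℤ → ℤ) a → (∀ i → fun (proj₁ a) i ≡ shiftF k f i) → ∀ i → fun (proj₁ (up a)) i ≡ shiftF (suc k) f i
  up-shiftF k f a h i = ≡.trans (≡.cong (ℤ._+ 1ℤ) (h (i ℤ.- 1ℤ)))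
    (≡.trans (outer (f (i ℤ.- 1ℤ ℤ.- + k)) (+ k)) (≡.cong (λ j → f j ℤ.+ + suc k) (inner i (+ k))))
    where
    inner : ∀ i k → i ℤ.- 1ℤ ℤ.- k ≡ i ℤ.- (1ℤ ℤ.+ k)
    inner = solve-∀
    outer : ∀ a k → a ℤ.+ k ℤ.+ 1ℤ ≡ a ℤ.+ (1ℤ ℤ.+ k)
    outer = solve-∀

  lift-shiftF : ∀ k u i → fun (proj₁ (lift k u)) i ≡ shiftF k (fun (proj₁ u)) i
  lift-shiftF zero    u i = ≡.sym (≡.trans (ℤₚ.+-identityʳ _) (≡.cong (fun (proj₁ u)) (ℤₚ.+-identityʳ i)))
  lift-shiftF (suc k) u   = up-shiftF k (fun (proj₁ u)) (lift k u) (lift-shiftF k u)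

  lift-theta : ∀ k {u η} → IsTheta η (perm u) → IsTheta (cons0s k η) (perm (lift k u))
  lift-theta zero    Θ = Θ
  lift-theta (suc k) {u} Θ = IsTheta-≗ (λ j → ≡.sym (perm-up (lift k u) j)) (IsTheta-γ (perm-positive (lift k u)) (lift-theta k Θ))

  -- Equality and inequality of successive V_k

  module Stability (c : SZ+ → SZ+ → SZ+ → ℤ) (isc : IsStructureConstants c) (u v : SZ+) {ε δ : ℕ → ℕ}
    (Θu : IsTheta ε (perm u)) (Θv : IsTheta δ (perm v)) where

    open StructureConstants c isc

    lift-perm : ∀ k a (a₁ : SZ+) → (∀ i → fun (proj₁ a₁) i ≡ shiftF (suc k) (fun (proj₁ a)) i) → perm a₁ ≗ γ (perm (lift k a))
    lift-perm k a a₁ h j = ≡.trans (≐⇒≗ a₁ (lift (suc k) a) (λ i → ≡.trans (h i) (≡.sym (lift-shiftF (suc k) a i))) j) (perm-up (lift k a) j)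

    V-grows : ∀ k w → InV c u v k w → InV c u v (suc k) w
    V-grows k w (u′ , v′ , x′ , hu , hv , hx , c≢0) = up u′ , up v′ , up x′
      , up-shiftF k (fun (proj₁ u)) u′ hu , up-shiftF k (fun (proj₁ v)) v′ hv , up-shiftF k (fun w) x′ hx
      , λ z → c≢0 (≡.trans (≡.sym (c-shift {u′} {up u′} {v′} {up v′} {x′} {up x′} (perm-up u′) (perm-up v′) (perm-up x′))) z)

    -- A member of V_{k+1} comes from some x with nonzero coefficient; the bound forces x to fix 1,
    -- so x can be shifted back.
    V-stable : ∀ k → (∀ j → total (cons0s k ε) (cons0s k δ) j ≤ j) → VEq c u v k (suc k)
    V-stable k bound w = V-grows k w , back
      where
      inner : ∀ i k → i ℤ.- (ℤ.- 1ℤ) ℤ.- (1ℤ ℤ.+ k) ≡ i ℤ.- k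
      inner = solve-∀
      outer : ∀ a k → a ℤ.+ (1ℤ ℤ.+ k) ℤ.+ (ℤ.- 1ℤ) ≡ a ℤ.+ k
      outer = solve-∀
      back : InV c u v (suc k) w → InV c u v k w
      back (u′ , v′ , x′ , hu , hv , hx , c≢0) = lift k u , lift k v , y , lift-shiftF k u , lift-shiftF k v , hy
        , λ z → c≢0 (≡.trans (c-shift {lift k u} {u′} {lift k v} {v′} {y} {x′} hu′ hv′ (perm-down x′ p0)) z)
        where
        hu′ = lift-perm k u u′ hu
        hv′ = lift-perm k v v′ hv
        p0 : perm x′ 0 ≡ 1
        p0 = c-stable {lift k u} {u′} {lift k v} {v′} hu′ hv′ (lift-theta k Θu) (lift-theta k Θv) bound x′ c≢0
        y = down x′ p0
        hy : ∀ i → fun (proj₁ y) i ≡ shiftF k (fun w) i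
        hy i = ≡.trans (≡.cong (ℤ._+ (ℤ.- 1ℤ)) (hx (i ℤ.- (ℤ.- 1ℤ))))
          (≡.trans (outer (fun w (i ℤ.- (ℤ.- 1ℤ) ℤ.- (1ℤ ℤ.+ + k))) (+ k)) (≡.cong (λ t → fun w t ℤ.+ + k) (inner i (+ k))))

    -- `c-unstable` gives a term of the (k+1)-st product moving 1. Shifted back k + 1 times it
    -- becomes some w in V_{k+1}; were w in V_k, its k-fold shift would fix 0, so the term would fix
    -- 1.
    V-unstable : ∀ k n → n < total (cons0s k ε) (cons0s k δ) n → ¬ VEq c u v k (suc k)
    V-unstable k n excess equal = contradiction (first-excess _ _ (proj₁ (lift-theta k {u} Θu)) (proj₁ (lift-theta k {v} Θv)) n excess)
      where
      K = + suc k
      contradiction : (∃ λ m → cons0s k ε m ≡ 1 × cons0s k δ m ≡ 1 × total (cons0s k ε) (cons0s k δ) m ≡ m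
                         × (∀ j → j ≤ m → total (cons0s k ε) (cons0s k δ) j ≤ j)) → ⊥
      contradiction (m , εm , δm , tot , bound) = proj₂ (proj₂ moved) (≡.cong ∣_∣ fixes-1)
        where
        moved : ∃ λ x → ¬ (c (lift (suc k) u) (lift (suc k) v) x ≡ 0ℤ) × perm x 0 ≢ 1
        moved = c-unstable {lift k u} {lift (suc k) u} {lift k v} {lift (suc k) v} (perm-up (lift k u)) (perm-up (lift k v))
          (lift-theta k Θu) (lift-theta k Θv) m εm δm tot bound
        y = proj₁ moved
        w = shiftSZ (ℤ.- K) (proj₁ y)
        inner : ∀ i k → i ≡ i ℤ.- k ℤ.- (ℤ.- k)
        inner = solve-∀
        outer : ∀ a k → a ≡ a ℤ.+ (ℤ.- k) ℤ.+ k
        outer = solve-∀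
        hy : ∀ i → fun (proj₁ y) i ≡ shiftF (suc k) (fun w) i
        hy i = ≡.trans (≡.cong (fun (proj₁ y)) (inner i K)) (outer (fun (proj₁ y) (i ℤ.- K ℤ.- (ℤ.- K))) K)
        inV : InV c u v k w
        inV = proj₂ (equal w) (lift (suc k) u , lift (suc k) v , y , lift-shiftF (suc k) u , lift-shiftF (suc k) v , hy , proj₁ (proj₂ moved))
        x′ = proj₁ (proj₂ (proj₂ inV))
        hx′ = proj₁ (proj₂ (proj₂ (proj₂ (proj₂ (proj₂ inV)))))
        at-1 : ∀ k → 0ℤ ℤ.- k ℤ.- (ℤ.- (1ℤ ℤ.+ k)) ≡ 1ℤ
        at-1 = solve-∀
        collect : ∀ a k → a ℤ.+ (ℤ.- (1ℤ ℤ.+ k)) ℤ.+ k ≡ a ℤ.- 1ℤ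
        collect = solve-∀
        zero≡ : 0ℤ ≡ fun (proj₁ y) 1ℤ ℤ.- 1ℤ
        zero≡ = ≡.trans (≡.sym (proj₂ x′ 0ℤ ℤₚ.≤-refl)) (≡.trans (hx′ 0ℤ)
          (≡.trans (collect (fun (proj₁ y) (0ℤ ℤ.- + k ℤ.- (ℤ.- K))) (+ k)) (≡.cong (λ i → fun (proj₁ y) i ℤ.- 1ℤ) (at-1 (+ k)))))
        fixes-1 : fun (proj₁ y) 1ℤ ≡ 1ℤ
        fixes-1 = ℤₚ.i-j≡0⇒i≡j _ _ (≡.sym zero≡)

    -- After j or more shifts no positive excess is left, so no step from j on adds anything.
    V-eventually : ∀ j → (∀ i → total ε δ i ≤ i ℕ.+ j) → ∀ d → VEq c u v j (d ℕ.+ j)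
    V-eventually j h zero    w = (λ z → z) , λ z → z
    V-eventually j h (suc d) w = proj₁ (step w) ∘ proj₁ (V-eventually j h d w) , proj₂ (V-eventually j h d w) ∘ proj₂ (step w)
      where
      step : VEq c u v (d ℕ.+ j) (suc (d ℕ.+ j))
      step = V-stable (d ℕ.+ j) λ i → ≡.subst (total (cons0s (d ℕ.+ j) ε) (cons0s (d ℕ.+ j) δ) i ≤_) (ℕₚ.+-identityʳ i)
        (total-cons0s-≤ (d ℕ.+ j) 0 ε δ (λ i → ℕₚ.≤-trans (h i) (ℕₚ.+-monoʳ-≤ i (≡.subst (j ≤_) (≡.sym (ℕₚ.+-identityʳ _)) (ℕₚ.m≤n+m j d)))) i)

  -- The sums λ and the maximum

  sum-snoc : ∀ f n → sum (applyUpTo f (suc n)) ≡ sum (applyUpTo f n) ℕ.+ f n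
  sum-snoc f zero    = ℕₚ.+-identityʳ (f 0)
  sum-snoc f (suc n) = ≡.trans (≡.cong (f 0 ℕ.+_) (sum-snoc (f ∘ suc) n)) (≡.sym (ℕₚ.+-assoc (f 0) _ _))

  λ′-suc : ∀ u i → λ' u (suc i) ≡ λ' u i ℕ.+ θ u (suc i)
  λ′-suc u i = ≡.trans (≡.cong sum (map-upTo f (suc i))) (≡.trans (sum-snoc f i) (≡.cong (λ l → sum l ℕ.+ f i) (≡.sym (map-upTo f i))))
    where
    f : ℕ → ℕ
    f t = θ u (suc t)

  λ′-total : ∀ u v i → λ' u i ℕ.+ λ' v i ≡ total (λ m → θ u (suc m)) (λ m → θ v (suc m)) i
  λ′-total u v zero    = ≡.refl
  λ′-total u v (suc i) = ≡.trans (≡.cong₂ ℕ._+_ (λ′-suc u i) (λ′-suc v i)) (≡.trans (interchange (λ' u i) (θ u (suc i)) (λ' v i) (θ v (suc i)))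
    (≡.cong (ℕ._+ (θ u (suc i) ℕ.+ θ v (suc i))) (λ′-total u v i)))
    where
    interchange : ∀ a b c d → (a ℕ.+ b) ℕ.+ (c ℕ.+ d) ≡ (a ℕ.+ c) ℕ.+ (b ℕ.+ d)
    interchange a b c d = ≡.trans (ℕₚ.+-assoc a b (c ℕ.+ d)) (≡.trans (≡.cong (a ℕ.+_) (+-left-comm b c d)) (≡.sym (ℕₚ.+-assoc a c (b ℕ.+ d))))

  λ′≤ : ∀ u i → λ' u i ≤ i
  λ′≤ u zero    = z≤n
  λ′≤ u (suc i) = ≡.subst₂ _≤_ (≡.sym (λ′-suc u i)) (ℕₚ.+-comm i 1) (ℕₚ.+-mono-≤ (λ′≤ u i) (Binary-≤1 (proj₁ (θ-theta u)) i))

  -- The sum grows only at positions with θ = 1, where it is at most the position and hence at most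
  -- M.
  λ′≤M : ∀ u M → (∀ i → θ u i ≡ 1 → i ≤ M) → ∀ i → λ' u i ≤ M
  λ′≤M u M h zero    = z≤n
  λ′≤M u M h (suc i) with proj₁ (θ-theta u) i
  ... | inj₁ e = ≡.subst (_≤ M) (≡.sym (≡.trans (λ′-suc u i) (≡.trans (≡.cong (λ' u i ℕ.+_) e) (ℕₚ.+-identityʳ _)))) (λ′≤M u M h i)
  ... | inj₂ e = ℕₚ.≤-trans (λ′≤ u (suc i)) (h (suc i) e)

open import Data.Nat using (_+_)
open import Data.Integer using (_-_) renaming (_≤_ to _≤ℤ_)
open Schubert

theorem1p3 : (c : SZ+ → SZ+ → SZ+ → Data.Integer.ℤ) → IsStructureConstants c →
    (u v : SZ+) → Σ ℕ λ j →
    (IsBS c u v j × IsSt c u v j)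
    × (∀ M → (∀ i → (θ u i ≡ 1 ⊎ θ v i ≡ 1) → i ≤ M) → j ≤ M)
    × ((∀ i → (+ (λ' u i + λ' v i)) - (+ i) ≤ℤ + j)
    × ∃ λ i → (+ (λ' u i + λ' v i)) - (+ i) ≡ + j)
-- Minimality for BS reduces to that for St: constancy from j′ on contains the single equality
-- V_{j′} = V_{j′+1}.
theorem1p3 c isc u v = j , ((eventually , λ j′ lt h → minimal j′ lt (h (suc j′) (ℕₚ.n≤1+n j′))) , (V-eventually j within 1 , minimal))
  , below , upper , i₀ , ≡.trans (≡.cong (λ t → + t ℤ.- + i₀) (≡.trans (λ′-total u v i₀) i₀-attains)) (difference i₀ j)
  where
  ε δ : ℕ → ℕ
  ε m = θ u (suc m)
  δ m = θ v (suc m)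
  open Stability c isc u v (θ-theta u) (θ-theta v)
  B = bound (proj₁ u) ⊔ bound (proj₁ v)
  -- The sums stay at most `B + B`, so past that index there is no positive excess and a finite
  -- search suffices.
  maximum = maximal-excess (total ε δ) ≡.refl (B ℕ.+ B)
  j = proj₁ maximum
  i₀ = proj₁ (proj₂ (proj₂ maximum))
  i₀-attains : total ε δ i₀ ≡ i₀ ℕ.+ j
  i₀-attains = proj₂ (proj₂ (proj₂ maximum))
  within : ∀ i → total ε δ i ≤ i ℕ.+ j
  within i with i ℕₚ.≤? B ℕ.+ B
  ... | yes le = proj₁ (proj₂ maximum) i le
  ... | no nle = ℕₚ.≤-trans (total≤2B (proj₁ (θ-theta u)) (proj₁ (θ-theta v)) B
          (λ m le → proj₂ (proj₂ (θ-theta u) m) (perm-tail u m (ℕₚ.m⊔n≤o⇒m≤o _ (bound (proj₁ v)) le)))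
          (λ m le → proj₂ (proj₂ (θ-theta v) m) (perm-tail v m (ℕₚ.m⊔n≤o⇒n≤o (bound (proj₁ u)) _ le))) i)
        (ℕₚ.≤-trans (ℕₚ.<⇒≤ (ℕₚ.≰⇒> nle)) (ℕₚ.m≤m+n i j))
  eventually : ∀ m → j ≤ m → VEq c u v j m
  eventually m le = ≡.subst (VEq c u v j) (ℕₚ.m∸n+n≡m le) (V-eventually j within (m ∸ j))
  minimal : ∀ j′ → j′ < j → ¬ VEq c u v j′ (suc j′)
  -- At index `j′ + i₀` the sum after j′ shifts is still i₀ + j, which exceeds the index.
  minimal j′ lt = V-unstable j′ (j′ ℕ.+ i₀) (≡.subst (j′ ℕ.+ i₀ <_) (≡.sym (≡.trans (total-cons0s j′ ε δ i₀) (≡.trans i₀-attains (ℕₚ.+-comm i₀ j))))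
    (ℕₚ.+-monoˡ-< i₀ lt))
  below : ∀ M → (∀ i → (θ u i ≡ 1 ⊎ θ v i ≡ 1) → i ≤ M) → j ≤ M
  -- At the maximising index i₀ + j is the sum of λ_{i₀}(u), at most i₀, and λ_{i₀}(v), at most M.
  below M h = ℕₚ.+-cancelˡ-≤ i₀ _ _ (≡.subst (_≤ i₀ ℕ.+ M) (≡.trans (λ′-total u v i₀) i₀-attains)
    (ℕₚ.+-mono-≤ (λ′≤ u i₀) (λ′≤M v M (λ i e → h i (inj₂ e)) i₀)))
  difference : ∀ i j → + (i ℕ.+ j) ℤ.- + i ≡ + j
  difference i j = cancel (+ i) (+ j)
    where
    cancel : ∀ a b → a ℤ.+ b ℤ.- a ≡ b
    cancel = solve-∀
  upper : ∀ i → (+ (λ' u i ℕ.+ λ' v i)) ℤ.- (+ i) ≤ℤ + j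
  upper i = ≡.subst (+ (λ' u i ℕ.+ λ' v i) ℤ.- + i ≤ℤ_) (difference i j)
    (ℤₚ.+-monoˡ-≤ (ℤ.- + i) (ℤ.+≤+ (≡.subst (_≤ i ℕ.+ j) (≡.sym (λ′-total u v i)) (within i))))
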